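{- Let $\lambda=(\lambda_1,\dots,\lambda_s)$ be a partition of $n$ and let $\mu=(k+1,1^{n-k-1})$ with $k\le s-1$. Then \[ \mathrm{F}_{\mu\lambda}(q)=(q-1)^kq^{\binom{n}{2}-\binom{n-k}{2}-k}\sum_{j=2}^{s-k+1}[\lambda_1+\dots+\lambda_{j-1}]_{1/q}\sum_{A\subseteq\{2,\dots,s\},\ |A|=k,\ \min A=j}\ \prod_{i\in A}[\lambda_i]_{1/q}. \]
   Context: For a prime power $q$, $\mathfrak{u}_\lambda(\mathbb{F}_q)$ is the nilradical of the standard parabolic subalgebra of $\mathfrak{gl}_n(\mathbb{F}_q)$ with diagonal blocks of sizes $\lambda_1,\dots,\lambda_s$; $J_\mu$ the nilpotent Jordan matrix of type $\mu$; $\mathcal{C}_\mu$ its $\mathrm{GL}_n(\mathbb{F}_q)$-conjugacy class; $\mathrm{F}_{\mu\lambda}(q)=|\mathcal{C}_\mu\cap\mathfrak{u}_\lambda(\mathbb{F}_q)|$. $[m]_{1/q}=(q^{ -m}-1)/(q^{ -1}-1)=q^{1-m}(q^m-1)/(q-1)$.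
   Formalization: The formal theorem assumes k ≥ 1; for k = 0 the formula fails, since no A with |A| = 0 has a minimum j, so the right side is 0 while F is 1 (the zero matrix). -}

module Defs where

open import Level using (Level; 0ℓ)
open import Data.Nat as ℕ using (ℕ; zero; suc; _+_; _*_; _∸_; _^_; _≤_; _≥_; _>_; NonZero; _≤ᵇ_; _≡ᵇ_)
open import Data.Nat.Properties using (m^n≢0)
open import Data.Nat.Combinatorics using (_C_)
open import Data.Integer as ℤ using ()
open import Data.Rational as ℚ using (ℚ; 0ℚ; 1ℚ)
open import Data.Bool using (Bool; true; false; if_then_else_; _∧_; not)
open import Data.Fin using (Fin; toℕ)
open import Data.Vec using (Vec; tabulate; lookup)
open import Data.List using (List; []; _∷_; map; _++_; foldr; length; filter; applyUpTo; allFin; replicate; take)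
open import Data.Nat.ListAction using (sum)
open import Data.List.Relation.Unary.All using (All)
open import Data.List.Relation.Unary.Linked using (Linked)
open import Data.List.Relation.Unary.Unique.Propositional using (Unique)
open import Data.List.Membership.Propositional using (_∈_)
open import Data.Product using (Σ; _×_; ∃; ∃-syntax; _,_)
open import Relation.Binary.PropositionalEquality using (_≡_; _≢_)
open import Relation.Nullary using (¬_)
open import Algebra.Structures using (IsCommutativeRing)
open import Function.Bundles using (_↔_; _⇔_; Inverse)

record FiniteField : Set₁ where
  field
    K    : Set
    _+K_ : K → K → K
    _*K_ : K → K → K
    -K_  : K → K
    0K   : K
    1K   : K
    isCommutativeRing : IsCommutativeRing _≡_ _+K_ _*K_ -K_ 0K 1K
    0≢1  : 0K ≢ 1K
    inverse : ∀ x → x ≢ 0K → ∃[ y ] (x *K y ≡ 1K)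
    card : ℕ
    enum : Fin card ↔ K

fin-nonzero : ∀ {q} → Fin q → NonZero q
fin-nonzero {suc q} _ = _

card-nonzero : (F : FiniteField) → NonZero (FiniteField.card F)
card-nonzero F = fin-nonzero (Inverse.from (FiniteField.enum F) (FiniteField.0K F))

module _ (F : FiniteField) where
  open FiniteField F

  Mat : ℕ → Set
  Mat n = Vec (Vec K n) n

  entry : ∀ {n} → Mat n → Fin n → Fin n → K
  entry A i j = lookup (lookup A i) j

  mkMat : ∀ {n} → (Fin n → Fin n → K) → Mat n
  mkMat f = tabulate λ i → tabulate λ j → f i j

  _·_ : ∀ {n} → Mat n → Mat n → Mat n
  _·_ {n} A B = mkMat λ i j → foldr (λ l acc → (entry A i l *K entry B l j) +K acc) 0K (allFin n)

  Id : ∀ n → Mat n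
  Id n = mkMat λ i j → if toℕ i ≡ᵇ toℕ j then 1K else 0K

  Conj : ∀ {n} → Mat n → Mat n → Set
  Conj {n} A B = Σ (Mat n) λ g → Σ (Mat n) λ h →
                   ((g · h) ≡ Id n) × ((h · g) ≡ Id n) × (A ≡ ((g · B) · h))

filterᵇ : {X : Set} → (X → Bool) → List X → List X
filterᵇ p []       = []
filterᵇ p (x ∷ xs) = if p x then x ∷ filterᵇ p xs else filterᵇ p xs

partialSums : List ℕ → List ℕ
partialSums []       = []
partialSums (x ∷ xs) = x ∷ map (x +_) (partialSums xs)

elemᵇ : ℕ → List ℕ → Bool
elemᵇ m []       = false
elemᵇ m (x ∷ xs) = if m ≡ᵇ x then true else elemᵇ m xs

-- 0-based index of the diagonal block containing position i (0-based)
blockOf : List ℕ → ℕ → ℕ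
blockOf λs i = length (filterᵇ (λ c → c ≤ᵇ i) (partialSums λs))

IsPartitionOf : List ℕ → ℕ → Set
IsPartitionOf λs n = All (λ x → x ≥ 1) λs × Linked _≥_ λs × sum λs ≡ n

hook : ℕ → ℕ → List ℕ
hook n k = suc k ∷ replicate (n ∸ suc k) 1

module _ (F : FiniteField) where
  open FiniteField F

  -- nilpotent Jordan matrix J_μ: Jordan blocks of sizes μ₁, μ₂, … along the
  -- diagonal, entry (i,i+1) = 1 when i, i+1 lie in the same block
  Jordan : ∀ n → List ℕ → Mat F n
  Jordan n μ = mkMat F λ i j →
    if (toℕ j ≡ᵇ suc (toℕ i)) ∧ not (elemᵇ (suc (toℕ i)) (partialSums μ))
    then 1K else 0K

  InNilradical : ∀ {n} → List ℕ → Mat F n → Set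
  InNilradical λs A = ∀ i j → blockOf λs (toℕ j) ≤ blockOf λs (toℕ i) → entry F A i j ≡ 0K

  InCμ∩uλ : ∀ n → List ℕ → List ℕ → Mat F n → Set
  InCμ∩uλ n μ λs A = Conj F A (Jordan n μ) × InNilradical λs A

HasCard : {X : Set} → (X → Set) → ℕ → Set
HasCard {X} P N = Σ (List X) λ xs → length xs ≡ N × Unique xs × (∀ x → (x ∈ xs) ⇔ P x)

Fμλ≡ : (F : FiniteField) → (n : ℕ) → List ℕ → List ℕ → ℕ → Set
Fμλ≡ F n μ λs N = HasCard (InCμ∩uλ F n μ λs) N

ℕ→ℚ : ℕ → ℚ
ℕ→ℚ m = ℤ.+_ m ℚ./ 1

sumℚ : List ℚ → ℚ
sumℚ = foldr ℚ._+_ 0ℚ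

prodℚ : List ℚ → ℚ
prodℚ = foldr ℚ._*_ 1ℚ

-- [m]_{1/q} = 1 + q⁻¹ + ⋯ + q^{-(m-1)} = (q^{-m} - 1)/(q^{-1} - 1)
qint : (q : ℕ) → .{{NonZero q}} → ℕ → ℚ
qint q m = sumℚ (applyUpTo (λ i → ℚ._/_ (ℤ.+_ 1) (q ^ i) {{m^n≢0 q i}}) m)

-- λ_i, 1-indexed (0 outside range)
nth : List ℕ → ℕ → ℕ
nth []       _             = 0
nth (x ∷ xs) zero          = 0
nth (x ∷ xs) (suc zero)    = x
nth (x ∷ xs) (suc (suc i)) = nth xs (suc i)

subsets : List ℕ → List (List ℕ)
subsets []       = [] ∷ []
subsets (x ∷ xs) = map (x ∷_) (subsets xs) ++ subsets xs

listMin : ℕ → List ℕ → ℕ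
listMin m []       = m
listMin m (x ∷ xs) = listMin (ℕ._⊓_ m x) xs

minIsᵇ : List ℕ → ℕ → Bool
minIsᵇ []       j = false
minIsᵇ (x ∷ xs) j = listMin x xs ≡ᵇ j

subsetsWith : (s k j : ℕ) → List (List ℕ)
subsetsWith s k j =
  filterᵇ (λ A → (length A ≡ᵇ k) ∧ minIsᵇ A j) (subsets (applyUpTo (2 +_) (s ∸ 1)))

hookRHS : (q : ℕ) → .{{NonZero q}} → (n k : ℕ) → List ℕ → ℚ
hookRHS q n k λs =
  ℚ._*_ (ℕ→ℚ ((q ∸ 1) ^ k * q ^ ((n C 2) ∸ ((n ∸ k) C 2) ∸ k)))
    (sumℚ (map (λ j → ℚ._*_ (qint q (sum (take (j ∸ 1) λs)))
                        (sumℚ (map (λ A → prodℚ (map (λ i → qint q (nth λs i)) A))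
                                   (subsetsWith s k j))))
               (applyUpTo (2 +_) (s ∸ k))))
  where s = length λs

{-# OPTIONS --safe #-}
module Submission where

-- A matrix of type (k+1, 1^(n-k-1)) is a nilpotent A of rank k with A^k ≠ 0.  Build a strictly upper
-- triangular matrix column by column: appending a column b to A keeps k exactly when b lies in the image
-- of A, which has q^k elements, and raises it to k + 1 exactly when A^k b ≠ 0.  In a block starting at m
-- the column b is supported on the first m coordinates; there the second condition excludes a hyperplane
-- if A^k does not vanish on them, and admits nothing if it does, so the index grows at most once per
-- block (for k = 0 only b = 0 is excluded).  This gives, for a new block of size l,
--   F_k = q^(kl) F_k + (q^m - q^(m-1)) q^(k(l-1)) [l]_{1/q} F_(k-1)
-- with q^m - 1 in place of q^m - q^(m-1) if k = 1, where F on the right is taken before the block;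
-- the sum of the theorem, read from its last part, satisfies the same recursion.
-- Over a finite field the linear algebra reduces to counting: an injective linear endomorphism is
-- bijective, and a set of q^k vectors inside an image with q^k elements exhausts it.

open import Defs
open import Data.Nat as ℕ using (ℕ; zero; suc; NonZero; _≤_; _<_; _≥_; _∸_; _⊓_; _≤ᵇ_; _≡ᵇ_; z≤n; s≤s)
import Data.Nat.Properties as ℕP
import Data.Nat.Solver as ℕSolver
open import Data.Nat.Combinatorics using (_C_; nC1≡n; nCk+nC[k+1]≡[n+1]C[k+1])
open import Data.Nat.ListAction using (sum)
open import Data.Nat.ListAction.Properties using (sum-++)
import Data.Integer as ℤ
import Data.Integer.Properties as ℤP
import Data.Rational as ℚ
import Data.Rational.Properties as ℚP
import Data.Rational.Solver as ℚSolver
import Data.Rational.Unnormalised as ℚᵘ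
import Data.Rational.Unnormalised.Properties as ℚᵘP
open import Data.Bool using (Bool; true; false; if_then_else_; _∧_; not)
import Data.Bool as Bool
import Data.Bool.Properties as BoolP
open import Data.Fin using (Fin; zero; suc; toℕ; opposite; inject₁; fromℕ)
import Data.Fin.Properties as FinP
open import Data.List as List using (List; []; _∷_; _++_; _∷ʳ_; map; length; take; filter; foldr; applyUpTo; allFin)
import Data.List.Properties as ListP
open import Data.List.Relation.Unary.Any as Any using (here; there)
open import Data.List.Relation.Unary.All as All using (All; []; _∷_)
import Data.List.Relation.Unary.All.Properties as AllP
open import Data.List.Relation.Unary.AllPairs using ([]; _∷_)
open import Data.List.Relation.Unary.Unique.Propositional using (Unique)
import Data.List.Relation.Unary.Unique.Propositional.Properties as UniqueP
open import Data.List.Membership.Propositional using (_∈_; find; lose)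
open import Data.List.Membership.Propositional.Properties
  using (∈-map⁺; ∈-map⁻; ∈-++⁺ˡ; ∈-++⁺ʳ; ∈-++⁻; ∈-filter⁺; ∈-filter⁻; ∈-allFin; ∈-∃++)
open import Data.Vec as Vec using (Vec; []; _∷_; head; tail; last; lookup; tabulate; zipWith; replicate)
import Data.Vec.Properties as VecP
open import Data.Product using (_×_; ∃; _,_; proj₁; proj₂)
open import Data.Sum using (_⊎_; inj₁; inj₂; [_,_]′)
open import Data.Empty using (⊥; ⊥-elim)
open import Data.Unit using (⊤; tt)
open import Relation.Nullary using (Dec; yes; no; ¬?)
open import Relation.Nullary.Decidable using (map′; decidable-stable)
open import Relation.Binary.PropositionalEquality hiding (J; [_])
open import Function.Bundles using (_⇔_; _↔_; mk⇔; Equivalence; Inverse)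
open import Algebra.Bundles using (CommutativeRing)
import Algebra.Properties.CommutativeSemigroup
import Algebra.Properties.CommutativeSemiring.Exp
import Algebra.Properties.Group as GroupProperties
import Algebra.Solver.CommutativeMonoid

open ≡-Reasoning

-- Finite cardinalities

-- The set A of the formula records the blocks in which the index grows, and j = min A is the block
-- of the first nonzero column. As long as the matrix is zero, the q^m - 1 choices of that column
-- give [λ_1 + ... + λ_(j-1)]; every later growth has the proportion 1 - 1/q of the q^m columns to
-- choose from, whatever A is. The factor [λ_i] comes from the position of the growing column inside
-- block i: each move to the right replaces a column after the growth, with q^(k+1) choices, by one
-- before it, with q^k choices, hence a factor 1/q. The obstacle is that T^k b ≠ 0 depends on the
-- matrix already built. Its count is uniform only because T^k has rank one for k > 0, and only once
-- it is known whether T^k vanishes on the first m coordinates. Whether the index has already grown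
-- within the block decides the latter, so the matrices of each block are counted in two classes.
-- The image condition and the block condition do not interfere, since within a block the image
-- stays inside the first m coordinates.

module _ {X : Set} where

  unique-⊆⇒length≤ : {xs ys : List X} → Unique xs → (∀ {x} → x ∈ xs → x ∈ ys) → length xs ≤ length ys
  unique-⊆⇒length≤ {[]} _ _ = z≤n
  unique-⊆⇒length≤ {x ∷ xs} (x∉ ∷ u) sub with ∈-∃++ (sub (here refl))
  ... | as , bs , refl = subst (suc (length xs) ≤_) (sym len) (s≤s (unique-⊆⇒length≤ u sub′))
    where
    len : length (as ++ x ∷ bs) ≡ suc (length (as ++ bs))
    len = trans (ListP.length-++ as)
            (trans (ℕP.+-suc _ _) (cong suc (sym (ListP.length-++ as))))
    sub′ : ∀ {y} → y ∈ xs → y ∈ as ++ bs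
    sub′ y∈ with ∈-++⁻ as (sub (there y∈))
    ... | inj₁ y∈as = ∈-++⁺ˡ y∈as
    ... | inj₂ (here refl) = ⊥-elim (All.lookup x∉ y∈ refl)
    ... | inj₂ (there y∈bs) = ∈-++⁺ʳ as y∈bs

  card-mono : {P Q : X → Set} {N M : ℕ} → (∀ x → P x → Q x) → HasCard P N → HasCard Q M → N ≤ M
  card-mono P⇒Q (xs , refl , u , xs⇔) (ys , refl , _ , ys⇔) =
    unique-⊆⇒length≤ u λ {x} x∈ →
      Equivalence.from (ys⇔ x) (P⇒Q x (Equivalence.to (xs⇔ x) x∈))

  card-unique : {P Q : X → Set} {N M : ℕ} → (∀ x → P x → Q x) → (∀ x → Q x → P x) →
                HasCard P N → HasCard Q M → N ≡ M
  card-unique f g p q = ℕP.≤-antisym (card-mono f p q) (card-mono g q p)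

  card-resp : {P Q : X → Set} {N : ℕ} → (∀ x → P x → Q x) → (∀ x → Q x → P x) →
              HasCard P N → HasCard Q N
  card-resp f g (xs , l , u , e) =
    xs , l , u , λ x → mk⇔ (λ x∈ → f x (Equivalence.to (e x) x∈)) (λ q → Equivalence.from (e x) (g x q))

  -- Pigeonhole: an element of Q outside P, put in front of the list of P, would make a list without
  -- repetitions that is longer than the list of Q. This replaces dimension arguments throughout.
  card-full : {P Q : X → Set} {N : ℕ} → ((x y : X) → Dec (x ≡ y)) →
              (∀ x → P x → Q x) → HasCard P N → HasCard Q N → ∀ x → Q x → P x
  card-full {P} {Q} _≟_ P⇒Q (xs , lx , u , ex) (ys , ly , _ , ey) x Qx with Any.any? (x ≟_) xs
  ... | yes x∈ = Equivalence.to (ex x) x∈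
  ... | no x∉ = ⊥-elim (ℕP.<-irrefl (trans lx (sym ly)) (unique-⊆⇒length≤ uniq sub))
    where
    uniq : Unique (x ∷ xs)
    uniq = All.tabulate (λ y∈ x≡y → x∉ (subst (_∈ xs) (sym x≡y) y∈)) ∷ u
    sub : ∀ {y} → y ∈ x ∷ xs → y ∈ ys
    sub (here refl) = Equivalence.from (ey x) Qx
    sub {y} (there y∈) = Equivalence.from (ey y) (P⇒Q y (Equivalence.to (ex y) y∈))

  card-⊎ : {P Q : X → Set} {N M : ℕ} → (∀ x → P x → Q x → ⊥) → HasCard P N → HasCard Q M →
           HasCard (λ x → P x ⊎ Q x) (N ℕ.+ M)
  card-⊎ {P} {Q} disj (xs , refl , u , ex) (ys , refl , v , ey) =
    xs ++ ys , ListP.length-++ xs ,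
    UniqueP.++⁺ u v (λ { (a , b) → disj _ (Equivalence.to (ex _) a) (Equivalence.to (ey _) b) }) ,
    λ x → mk⇔ (to x) (from x)
    where
    to : ∀ x → x ∈ xs ++ ys → P x ⊎ Q x
    to x x∈ with ∈-++⁻ xs x∈
    ... | inj₁ a = inj₁ (Equivalence.to (ex x) a)
    ... | inj₂ b = inj₂ (Equivalence.to (ey x) b)
    from : ∀ x → P x ⊎ Q x → x ∈ xs ++ ys
    from x (inj₁ p) = ∈-++⁺ˡ (Equivalence.from (ex x) p)
    from x (inj₂ q) = ∈-++⁺ʳ xs (Equivalence.from (ey x) q)

  card-filter : {Q : X → Set} {M : ℕ} {P : X → Set} → HasCard Q M → (∀ x → Dec (P x)) →
                ∃ λ N → HasCard (λ x → Q x × P x) N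
  card-filter (xs , l , u , e) P? =
    _ , filter P? xs , refl , UniqueP.filter⁺ P? u ,
    λ x → mk⇔ (λ x∈ → let a , b = ∈-filter⁻ P? x∈ in Equivalence.to (e x) a , b)
              (λ { (a , b) → ∈-filter⁺ P? (Equivalence.from (e x) a) b })

  card-any? : {Q : X → Set} {M : ℕ} {P : X → Set} → HasCard Q M → (∀ x → Dec (P x)) →
              Dec (∃ λ x → Q x × P x)
  card-any? (xs , l , u , e) P? with Any.any? P? xs
  ... | yes a = let x , x∈ , p = find a in yes (x , Equivalence.to (e x) x∈ , p)
  ... | no ¬a = no λ { (x , q , p) → ¬a (lose (Equivalence.from (e x) q) p) }

  card-∅ : HasCard {X} (λ _ → ⊥) 0
  card-∅ = [] , refl , [] , λ x → mk⇔ (λ ()) (λ ())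

  card-singleton : (x : X) → HasCard (_≡ x) 1
  card-singleton x = x ∷ [] , refl , ([] ∷ []) ,
    λ y → mk⇔ (λ { (here e) → e ; (there ()) }) here

map-unique : {X Y : Set} (f : X → Y) {xs : List X} →
             (∀ {x y} → x ∈ xs → y ∈ xs → f x ≡ f y → x ≡ y) → Unique xs → Unique (map f xs)
map-unique f {[]} inj [] = []
map-unique f {x ∷ xs} inj (x∉ ∷ u) =
  AllP.map⁺ (All.tabulate (λ y∈ fx≡fy → All.lookup x∉ y∈ (inj (here refl) (there y∈) fx≡fy)))
  ∷ map-unique f (λ a b → inj (there a) (there b)) u

card-image : {X Y : Set} {P : X → Set} {N : ℕ} (f : X → Y) →
             (∀ x y → P x → P y → f x ≡ f y → x ≡ y) →
             HasCard P N → HasCard (λ y → ∃ λ x → P x × y ≡ f x) N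
card-image {P = P} f inj (xs , l , u , e) =
  map f xs , trans (ListP.length-map f xs) l ,
  map-unique f (λ a b → inj _ _ (Equivalence.to (e _) a) (Equivalence.to (e _) b)) u ,
  λ y → mk⇔ (λ y∈ → let x , x∈ , y≡ = ∈-map⁻ f y∈ in x , Equivalence.to (e x) x∈ , y≡)
            (λ { (x , p , refl) → ∈-map⁺ f (Equivalence.from (e x) p) })

-- The dependent component comes first in the pair to match `Tri`, where the last column precedes
-- the rest of the matrix.
card-fibres : {X Y : Set} {P : X → Set} {Q : X → Y → Set} {N M : ℕ} →
              HasCard P N → (∀ x → P x → HasCard (Q x) M) →
              HasCard {Y × X} (λ z → P (proj₂ z) × Q (proj₂ z) (proj₁ z)) (N ℕ.* M)
card-fibres {X} {Y} {P} {Q} {N} {M} (xs , refl , u , e) fib =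
  let zs , l , v , f = go xs u (λ x∈ → Equivalence.to (e _) x∈) in
  zs , l , v , λ { (y , x) → mk⇔ (λ z∈ → let a , q = Equivalence.to (f (y , x)) z∈ in Equivalence.to (e x) a , q)
                                (λ { (p , q) → Equivalence.from (f (y , x)) (Equivalence.from (e x) p , q) }) }
  where
  go : ∀ xs → Unique xs → (∀ {x} → x ∈ xs → P x) →
       HasCard {Y × X} (λ z → proj₂ z ∈ xs × Q (proj₂ z) (proj₁ z)) (length xs ℕ.* M)
  go [] _ _ = [] , refl , [] , λ x → mk⇔ (λ ()) (λ { (() , _) })
  go (x ∷ xs) (x∉ ∷ u) xs⊆P =
    card-resp {Q = λ z → proj₂ z ∈ x ∷ xs × Q (proj₂ z) (proj₁ z)}
      (λ { (y , z) (inj₁ (w , q , refl)) → here refl , q ; (y , z) (inj₂ (z∈ , q)) → there z∈ , q })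
      (λ { (y , z) (here refl , q) → inj₁ (y , q , refl) ; (y , z) (there z∈ , q) → inj₂ (z∈ , q) })
      (card-⊎ {P = λ z → ∃ λ y → Q x y × z ≡ (y , x)} {Q = λ z → proj₂ z ∈ xs × Q (proj₂ z) (proj₁ z)} (λ { (y , z) (w , _ , refl) (z∈ , _) → All.lookup x∉ z∈ refl })
        (card-image (_, x) (λ { a b _ _ refl → refl }) (fib x (xs⊆P (here refl))))
        (go xs u (λ z∈ → xs⊆P (there z∈))))

card-Fin : {X : Set} {n : ℕ} → Fin n ↔ X → HasCard {X} (λ _ → ⊤) n
card-Fin {X} {n} i =
  map to (allFin n) , trans (ListP.length-map to (allFin n)) (ListP.length-tabulate (λ i → i)) ,
  UniqueP.map⁺ to-inj (UniqueP.allFin⁺ n) ,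
  λ x → mk⇔ (λ _ → tt) (λ _ → subst (_∈ map to (allFin n)) (Inverse.strictlyInverseˡ i x)
                                 (∈-map⁺ to (∈-allFin (Inverse.from i x))))
  where
  to = Inverse.to i
  to-inj : ∀ {a b} → to a ≡ to b → a ≡ b
  to-inj {a} {b} e = trans (sym (Inverse.strictlyInverseʳ i a))
                       (trans (cong (Inverse.from i) e) (Inverse.strictlyInverseʳ i b))

-- Linear algebra over a finite field

module LinearAlgebra (F : FiniteField) where

  open FiniteField F public
  open import Data.Nat using (_+_; _*_; _^_)

  K-ring : CommutativeRing _ _
  K-ring = record { isCommutativeRing = isCommutativeRing }

  module KR = CommutativeRing K-ring
  module GroupP = GroupProperties KR.+-group

  q : ℕ
  q = card

  _≟K_ : (x y : K) → Dec (x ≡ y)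
  x ≟K y = map′ (λ e → trans (sym (Inverse.strictlyInverseˡ enum x))
                         (trans (cong (Inverse.to enum) e) (Inverse.strictlyInverseˡ enum y)))
                (cong (Inverse.from enum)) (Inverse.from enum x FinP.≟ Inverse.from enum y)

  card-K : HasCard {K} (λ _ → ⊤) q
  card-K = card-Fin enum

  V : ℕ → Set
  V n = Vec K n

  infixl 6 _⊕_
  infixr 7 _⊙_

  _⊕_ : ∀ {n} → V n → V n → V n
  _⊕_ = zipWith _+K_

  _⊙_ : ∀ {n} → K → V n → V n
  t ⊙ x = Vec.map (t *K_) x

  𝟎 : ∀ {n} → V n
  𝟎 = replicate _ 0K

  _≟V_ : ∀ {n} → (x y : V n) → Dec (x ≡ y)
  _≟V_ = VecP.≡-dec _≟K_

  ⊕-assoc : ∀ {n} (x y z : V n) → (x ⊕ y) ⊕ z ≡ x ⊕ (y ⊕ z)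
  ⊕-assoc = VecP.zipWith-assoc KR.+-assoc

  ⊕-comm : ∀ {n} (x y : V n) → x ⊕ y ≡ y ⊕ x
  ⊕-comm = VecP.zipWith-comm KR.+-comm

  ⊕-idˡ : ∀ {n} (x : V n) → 𝟎 ⊕ x ≡ x
  ⊕-idˡ = VecP.zipWith-identityˡ KR.+-identityˡ

  ⊕-idʳ : ∀ {n} (x : V n) → x ⊕ 𝟎 ≡ x
  ⊕-idʳ = VecP.zipWith-identityʳ KR.+-identityʳ

  ⊙-distribˡ : ∀ {n} t (x y : V n) → t ⊙ (x ⊕ y) ≡ t ⊙ x ⊕ t ⊙ y
  ⊙-distribˡ t [] [] = refl
  ⊙-distribˡ t (a ∷ x) (b ∷ y) = cong₂ _∷_ (KR.distribˡ t a b) (⊙-distribˡ t x y)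

  ⊙-distribʳ : ∀ {n} s t (x : V n) → (s +K t) ⊙ x ≡ s ⊙ x ⊕ t ⊙ x
  ⊙-distribʳ s t [] = refl
  ⊙-distribʳ s t (a ∷ x) = cong₂ _∷_ (KR.distribʳ a s t) (⊙-distribʳ s t x)

  ⊙-assoc : ∀ {n} s t (x : V n) → (s *K t) ⊙ x ≡ s ⊙ t ⊙ x
  ⊙-assoc s t [] = refl
  ⊙-assoc s t (a ∷ x) = cong₂ _∷_ (KR.*-assoc s t a) (⊙-assoc s t x)

  1⊙ : ∀ {n} (x : V n) → 1K ⊙ x ≡ x
  1⊙ [] = refl
  1⊙ (a ∷ x) = cong₂ _∷_ (KR.*-identityˡ a) (1⊙ x)

  0⊙ : ∀ {n} (x : V n) → 0K ⊙ x ≡ 𝟎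
  0⊙ [] = refl
  0⊙ (a ∷ x) = cong₂ _∷_ (KR.zeroˡ a) (0⊙ x)

  ⊙𝟎 : ∀ {n} t → t ⊙ 𝟎 {n} ≡ 𝟎
  ⊙𝟎 {zero} t = refl
  ⊙𝟎 {suc n} t = cong₂ _∷_ (KR.zeroʳ t) (⊙𝟎 t)

  ⊕-invʳ : ∀ {n} t (x : V n) → t ⊙ x ⊕ (-K t) ⊙ x ≡ 𝟎
  ⊕-invʳ t x = trans (sym (⊙-distribʳ t (-K t) x)) (trans (cong (_⊙ x) (KR.-‿inverseʳ t)) (0⊙ x))

  ⊕-cancelʳ : ∀ {n} t (x y : V n) → (y ⊕ t ⊙ x) ⊕ (-K t) ⊙ x ≡ y
  ⊕-cancelʳ t x y = trans (⊕-assoc y _ _) (trans (cong (y ⊕_) (⊕-invʳ t x)) (⊕-idʳ y))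

  ⊕-cancelʳ′ : ∀ {n} t (x y : V n) → (y ⊕ (-K t) ⊙ x) ⊕ t ⊙ x ≡ y
  ⊕-cancelʳ′ t x y = trans (⊕-assoc y _ _) (trans (cong (y ⊕_) (trans (⊕-comm _ _) (⊕-invʳ t x))) (⊕-idʳ y))

  ⊕-interchange : ∀ {n} (a b c d : V n) → (a ⊕ b) ⊕ (c ⊕ d) ≡ (a ⊕ c) ⊕ (b ⊕ d)
  ⊕-interchange a b c d = begin
    (a ⊕ b) ⊕ (c ⊕ d)  ≡⟨ ⊕-assoc a b _ ⟩
    a ⊕ (b ⊕ (c ⊕ d))  ≡⟨ cong (a ⊕_) (trans (sym (⊕-assoc b c d)) (trans (cong (_⊕ d) (⊕-comm b c)) (⊕-assoc c b d))) ⟩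
    a ⊕ (c ⊕ (b ⊕ d))  ≡⟨ ⊕-assoc a c _ ⟨
    (a ⊕ c) ⊕ (b ⊕ d)  ∎

  -- A difference is written x ⊕ (- 1) ⊙ y, so that linear maps act on it termwise.
  difference-zero : ∀ {n} (x y : V n) → x ⊕ (-K 1K) ⊙ y ≡ 𝟎 → x ≡ y
  difference-zero x y e = begin
    x                              ≡⟨ ⊕-cancelʳ′ 1K y x ⟨
    (x ⊕ (-K 1K) ⊙ y) ⊕ 1K ⊙ y    ≡⟨ cong₂ _⊕_ e (1⊙ y) ⟩
    𝟎 ⊕ y                         ≡⟨ ⊕-idˡ y ⟩
    y                              ∎

  difference-self : ∀ {n} (x : V n) → x ⊕ (-K 1K) ⊙ x ≡ 𝟎
  difference-self x = trans (cong (_⊕ (-K 1K) ⊙ x) (sym (1⊙ x))) (⊕-invʳ 1K x)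

  ⊙-cancel : ∀ {n} t {x : V n} → x ≢ 𝟎 → t ⊙ x ≡ 𝟎 → t ≡ 0K
  ⊙-cancel t {x} x≢0 e with t ≟K 0K
  ... | yes t≡0 = t≡0
  ... | no t≢0 = let s , ts≡1 = inverse t t≢0 in ⊥-elim (x≢0 (begin
    x             ≡⟨ 1⊙ x ⟨
    1K ⊙ x        ≡⟨ cong (_⊙ x) (trans (sym ts≡1) (KR.*-comm t s)) ⟩
    (s *K t) ⊙ x  ≡⟨ ⊙-assoc s t x ⟩
    s ⊙ t ⊙ x     ≡⟨ cong (s ⊙_) e ⟩
    s ⊙ 𝟎         ≡⟨ ⊙𝟎 s ⟩
    𝟎             ∎))

  ⊙-injective : ∀ {n} s t {x : V n} → x ≢ 𝟎 → s ⊙ x ≡ t ⊙ x → s ≡ t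
  ⊙-injective s t {x} x≢0 e = GroupP.x∙y⁻¹≈ε⇒x≈y s t (⊙-cancel _ x≢0
    (trans (⊙-distribʳ s (-K t) x) (trans (cong (_⊕ (-K t) ⊙ x) e) (⊕-invʳ t x))))

  𝟎≢1∷ : ∀ {n} {x : V n} → 1K ∷ x ≢ 𝟎
  𝟎≢1∷ e = 0≢1 (sym (cong Vec.head e))

  card-V : ∀ n → HasCard {V n} (λ _ → ⊤) (q ^ n)
  card-V zero = card-resp (λ _ _ → tt) (λ { [] _ → refl }) (card-singleton [])
  card-V (suc n) = subst (HasCard _) (ℕP.*-comm (q ^ n) q)
    (card-resp (λ _ _ → tt) (λ { (t ∷ x) _ → (t , x) , _ , refl })
      (card-image (λ { (t , x) → t ∷ x }) (λ { (t , x) (s , y) _ _ refl → refl })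
        (card-fibres (card-V n) (λ _ _ → card-K))))

  record Lin {m n : ℕ} (f : V m → V n) : Set where
    field
      add : ∀ x y → f (x ⊕ y) ≡ f x ⊕ f y
      smul : ∀ t x → f (t ⊙ x) ≡ t ⊙ f x

    at-𝟎 : f 𝟎 ≡ 𝟎
    at-𝟎 = trans (cong f (sym (0⊙ 𝟎))) (trans (smul 0K 𝟎) (0⊙ _))

    injective : (∀ x → f x ≡ 𝟎 → x ≡ 𝟎) → ∀ x y → f x ≡ f y → x ≡ y
    injective ker x y e = difference-zero x y (ker _ (begin
      f (x ⊕ (-K 1K) ⊙ y)      ≡⟨ add _ _ ⟩
      f x ⊕ f ((-K 1K) ⊙ y)    ≡⟨ cong₂ _⊕_ e (smul _ _) ⟩
      f y ⊕ (-K 1K) ⊙ f y      ≡⟨ difference-self (f y) ⟩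
      𝟎                        ∎))

  Lin-∘ : ∀ {l m n} {f : V m → V n} {g : V l → V m} → Lin f → Lin g → Lin (λ x → f (g x))
  Lin-∘ {f = f} F G = record
    { add = λ x y → trans (cong f (Lin.add G x y)) (Lin.add F _ _)
    ; smul = λ t x → trans (cong f (Lin.smul G t x)) (Lin.smul F t _) }

  Lin-⊕ : ∀ {m n} {f g : V m → V n} → Lin f → Lin g → Lin (λ x → f x ⊕ g x)
  Lin-⊕ F G = record
    { add = λ x y → trans (cong₂ _⊕_ (Lin.add F x y) (Lin.add G x y)) (⊕-interchange _ _ _ _)
    ; smul = λ t x → trans (cong₂ _⊕_ (Lin.smul F t x) (Lin.smul G t x)) (sym (⊙-distribˡ t _ _)) }

  Lin-id : ∀ {n} → Lin {n} (λ x → x)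
  Lin-id = record { add = λ _ _ → refl ; smul = λ _ _ → refl }

  Lin-0∷ : ∀ {n} → Lin {n} (0K ∷_)
  Lin-0∷ = record { add = λ x y → cong (_∷ _) (sym (KR.+-identityˡ 0K))
                  ; smul = λ t x → cong (_∷ _) (sym (KR.zeroʳ t)) }

  Lin-tail : ∀ {n} → Lin {suc n} Vec.tail
  Lin-tail = record { add = λ { (_ ∷ _) (_ ∷ _) → refl } ; smul = λ { _ (_ ∷ _) → refl } }

  Lin-head⊙ : ∀ {m n} (b : V n) → Lin {suc m} (λ x → Vec.head x ⊙ b)
  Lin-head⊙ b = record { add = λ { (s ∷ _) (t ∷ _) → ⊙-distribʳ s t b }
                       ; smul = λ { s (t ∷ _) → ⊙-assoc s t b } }

  linear-bijective : ∀ {n} {g : V n → V n} → Lin g → (∀ x → g x ≡ 𝟎 → x ≡ 𝟎) →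
    ∃ λ h → Lin h × (∀ y → g (h y) ≡ y) × (∀ x → h (g x) ≡ x)
  linear-bijective {n} {g} G ker = h , lin-h , gh , λ x → inj _ _ (gh (g x))
    where
    inj = Lin.injective G ker
    onto : ∀ y → ∃ λ x → ⊤ × y ≡ g x
    onto y = card-full _≟V_ (λ _ _ → tt) (card-image g (λ x y _ _ → inj x y) (card-V n)) (card-V n) y tt
    h : V n → V n
    h y = proj₁ (onto y)
    gh : ∀ y → g (h y) ≡ y
    gh y = sym (proj₂ (proj₂ (onto y)))
    lin-h : Lin h
    lin-h = record
      { add = λ x y → inj _ _ (trans (gh _) (sym (trans (Lin.add G _ _) (cong₂ _⊕_ (gh x) (gh y)))))
      ; smul = λ t x → inj _ _ (trans (gh _) (sym (trans (Lin.smul G _ _) (cong (t ⊙_) (gh x))))) }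

  -- T is applied innermost, so that `pow T (suc k) x ≡ 𝟎` says by definition that T^k kills the
  -- element T x of the image.
  pow : ∀ {n} → (V n → V n) → ℕ → V n → V n
  pow T zero x = x
  pow T (suc k) x = pow T k (T x)

  pow-suc : ∀ {n} (T : V n → V n) k x → pow T (suc k) x ≡ T (pow T k x)
  pow-suc T zero x = refl
  pow-suc T (suc k) x = pow-suc T k (T x)

  Lin-pow : ∀ {n} {T : V n → V n} → Lin T → ∀ k → Lin (pow T k)
  Lin-pow L zero = Lin-id
  Lin-pow L (suc k) = Lin-∘ (Lin-pow L k) L

  -- The linear combination of the Jordan chain w, T w, T² w, ... with the given coefficients,
  -- lowest power first.
  poly : ∀ {n m} → (V n → V n) → V n → V m → V n
  poly T w [] = 𝟎
  poly T w (c ∷ cs) = c ⊙ w ⊕ poly T (T w) cs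

  Lin-poly : ∀ {n m} (T : V n → V n) w → Lin (poly {n} {m} T w)
  Lin-poly {m = zero} T w = record { add = λ { [] [] → sym (⊕-idˡ 𝟎) } ; smul = λ { t [] → sym (⊙𝟎 t) } }
  Lin-poly {m = suc m} T w = record
    { add = λ { (s ∷ x) (t ∷ y) → Lin.add L (s ∷ x) (t ∷ y) }
    ; smul = λ { s (t ∷ y) → Lin.smul L s (t ∷ y) } }
    where
    poly′ : V (suc m) → _
    poly′ x = Vec.head x ⊙ w ⊕ poly T (T w) (Vec.tail x)
    L : Lin poly′
    L = Lin-⊕ (Lin-head⊙ w) (Lin-∘ (Lin-poly T (T w)) Lin-tail)

  last-∷ : ∀ {m} c (cs : V (suc m)) → Vec.last (c ∷ cs) ≡ Vec.last cs
  last-∷ c (_ ∷ _) = refl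

  module _ {n} {T : V n → V n} (L : Lin T) where

    poly-commute : ∀ {m} w (cs : V m) → T (poly T w cs) ≡ poly T (T w) cs
    poly-commute w [] = Lin.at-𝟎 L
    poly-commute w (c ∷ cs) =
      trans (Lin.add L _ _) (cong₂ _⊕_ (Lin.smul L c w) (poly-commute (T w) cs))

    pow-poly : ∀ {m} k w (cs : V m) → pow T k (poly T w cs) ≡ poly T (pow T k w) cs
    pow-poly zero w cs = refl
    pow-poly (suc k) w cs = trans (cong (pow T k) (poly-commute w cs)) (pow-poly k (T w) cs)

    poly-zero : ∀ {m} w (cs : V m) → w ≡ 𝟎 → poly T w cs ≡ 𝟎
    poly-zero w [] e = refl
    poly-zero w (c ∷ cs) refl =
      trans (cong₂ _⊕_ (⊙𝟎 c) (poly-zero (T 𝟎) cs (Lin.at-𝟎 L))) (⊕-idˡ 𝟎)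

    -- T^k moves every member of the chain after w beyond its end, so it isolates the first
    -- coefficient.
    pow-poly-top : ∀ {m} k w c (cs : V m) → pow T (suc k) w ≡ 𝟎 →
                   pow T k (poly T w (c ∷ cs)) ≡ c ⊙ pow T k w
    pow-poly-top k w c cs nil = begin
      pow T k (c ⊙ w ⊕ poly T (T w) cs)               ≡⟨ Lin.add (Lin-pow L k) _ _ ⟩
      pow T k (c ⊙ w) ⊕ pow T k (poly T (T w) cs)     ≡⟨ cong₂ _⊕_ (Lin.smul (Lin-pow L k) c w)
                                                          (trans (pow-poly k (T w) cs) (poly-zero _ cs nil)) ⟩
      c ⊙ pow T k w ⊕ 𝟎                              ≡⟨ ⊕-idʳ _ ⟩
      c ⊙ pow T k w                                   ∎

    -- Applying T^m, T^(m-1), … to the relation kills the coefficients one after the other.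
    poly-kernel : ∀ m w (cs : V (suc m)) z → pow T (suc m) w ≡ 𝟎 → pow T m w ≢ 𝟎 → T z ≡ 𝟎 →
      z ⊕ poly T w cs ≡ 𝟎 → z ⊕ Vec.last cs ⊙ pow T m w ≡ 𝟎 × (Vec.last cs ≡ 0K → cs ≡ 𝟎)
    poly-kernel zero w (c ∷ []) z _ _ _ e =
      trans (cong (z ⊕_) (sym (⊕-idʳ _))) e , cong (_∷ [])
    poly-kernel (suc m) w (c ∷ cs) z nil nz Tz e =
      subst (λ y → z ⊕ y ⊙ pow T (suc m) w ≡ 𝟎) (sym last≡) (proj₁ rec) ,
      λ l → cong₂ _∷_ c≡0 (proj₂ rec (trans (sym last≡) l))
      where
      last≡ : Vec.last (c ∷ cs) ≡ Vec.last cs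
      last≡ = last-∷ c cs
      c≡0 : c ≡ 0K
      c≡0 = ⊙-cancel c nz (begin
        c ⊙ pow T (suc m) w                                   ≡⟨ pow-poly-top (suc m) w c cs nil ⟨
        pow T (suc m) (poly T w (c ∷ cs))                     ≡⟨ ⊕-idˡ _ ⟨
        𝟎 ⊕ pow T (suc m) (poly T w (c ∷ cs))
          ≡⟨ cong (_⊕ pow T (suc m) (poly T w (c ∷ cs))) (trans (cong (pow T m) Tz) (Lin.at-𝟎 (Lin-pow L m))) ⟨
        pow T (suc m) z ⊕ pow T (suc m) (poly T w (c ∷ cs))   ≡⟨ Lin.add (Lin-pow L (suc m)) _ _ ⟨
        pow T (suc m) (z ⊕ poly T w (c ∷ cs))                 ≡⟨ cong (pow T (suc m)) e ⟩
        pow T (suc m) 𝟎                                       ≡⟨ Lin.at-𝟎 (Lin-pow L (suc m)) ⟩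
        𝟎                                                     ∎)
      rec = poly-kernel m (T w) cs z nil nz Tz (begin
        z ⊕ poly T (T w) cs              ≡⟨ cong (z ⊕_) (⊕-idˡ _) ⟨
        z ⊕ (𝟎 ⊕ poly T (T w) cs)        ≡⟨ cong (λ y → z ⊕ (y ⊕ poly T (T w) cs)) (trans (cong (_⊙ w) c≡0) (0⊙ w)) ⟨
        z ⊕ poly T w (c ∷ cs)            ≡⟨ e ⟩
        𝟎                                ∎)

-- Nilpotent maps of hook type

module Hooks (F : FiniteField) where

  open LinearAlgebra F public
  open import Data.Nat using (_+_; _*_; _^_)

  Image : ∀ {m n} → (V m → V n) → V n → Set
  Image T y = ∃ λ x → y ≡ T x

  PowNonzero : ∀ {n} → ℕ → (V n → V n) → Set
  PowNonzero k T = ∃ λ w → pow T k w ≢ 𝟎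

  TopNonzero : ∀ {n} → ℕ → (V n → V n) → Set
  TopNonzero zero T = ⊤
  TopNonzero (suc k) T = PowNonzero (suc k) T

  -- T has Jordan type (k+1, 1, …, 1): nilpotent of rank k with T^k ≠ 0, where T^k ≠ 0 is
  -- dropped for k = 0, so that Hook 0 also holds for the zero map of the zero space.
  record Hook {n : ℕ} (k : ℕ) (T : V n → V n) : Set where
    field
      nil  : ∀ x → pow T (suc k) x ≡ 𝟎
      top  : TopNonzero k T
      rank : HasCard (Image T) (q ^ k)
  open Hook public

  topNonzero : ∀ {n} k {T : V n → V n} → PowNonzero k T → TopNonzero k T
  topNonzero zero _ = tt
  topNonzero (suc k) t = t

  pow-zero? : ∀ {n} k (T : V n → V n) → PowNonzero k T ⊎ (∀ x → pow T k x ≡ 𝟎)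
  pow-zero? {n} k T with card-any? (card-V n) (λ x → ¬? (pow T k x ≟V 𝟎))
  ... | yes (x , _ , nz) = inj₁ (x , nz)
  ... | no ¬nz = inj₂ λ x → decidable-stable (pow T k x ≟V 𝟎) (λ nz → ¬nz (x , _ , nz))

  image? : ∀ {m n} (T : V m → V n) → ∀ y → Dec (Image T y)
  image? {m} T y = map′ (λ { (x , _ , e) → x , e }) (λ { (x , e) → x , _ , e })
                        (card-any? (card-V m) (λ x → y ≟V T x))

  card-image-T : ∀ {m n} (T : V m → V n) → ∃ (HasCard (Image T))
  card-image-T {n = n} T with card-filter (card-V n) (image? T)
  ... | N , h = N , card-resp (λ _ → proj₂) (λ _ i → tt , i) h

  module _ {n k} {T : V n → V n} (L : Lin T) (nil : ∀ x → pow T (suc (suc k)) x ≡ 𝟎)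
           (w : V n) (nz : pow T (suc k) w ≢ 𝟎) where

    -- The chain starts at T w so that it lies in the image. Its k + 1 members are independent
    -- because T^(k+1) w, the last one, is nonzero, and their combinations are as many as the image
    -- of a map of rank k + 1 has elements.
    card-chain : HasCard {V n} (λ v → ∃ λ (cs : V (suc k)) → ⊤ × v ≡ poly T (T w) cs) (q ^ suc k)
    card-chain = card-image (poly T (T w)) (λ x y _ _ → inj x y) (card-V (suc k))
      where
      kernel : ∀ (cs : V (suc k)) → poly T (T w) cs ≡ 𝟎 → cs ≡ 𝟎
      kernel cs e with poly-kernel L k (T w) cs 𝟎 (nil w) nz (Lin.at-𝟎 L) (trans (⊕-idˡ _) e)
      ... | e′ , f = f (⊙-cancel _ nz (trans (sym (⊕-idˡ _)) e′))
      inj = Lin.injective (Lin-poly T (T w)) kernel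

    image-chain : HasCard (Image T) (q ^ suc k) → ∀ x → ∃ λ (cs : V (suc k)) → T x ≡ poly T (T w) cs
    image-chain rank x with card-full _≟V_
      (λ { v (cs , _ , e) → poly T w cs , trans e (sym (poly-commute L w cs)) }) card-chain rank (T x) (x , refl)
    ... | cs , _ , e = cs , e

    -- T x is a combination of T w, ..., T^(k+1) w, and T^k kills all of these but the first. So
    -- T^(k+1) has rank one and its kernel is a hyperplane, which is where q^m - q^(m-1) comes from.
    pow-line : HasCard (Image T) (q ^ suc k) → ∀ x → ∃ λ t → pow T (suc k) x ≡ t ⊙ pow T (suc k) w
    pow-line rank x with image-chain rank x
    ... | c ∷ cs , e = c , trans (cong (pow T k) e) (pow-poly-top L k (T w) c cs (nil w))

  Hook-conjugate : ∀ {n k} {S T : V n → V n} {g h : V n → V n} → Lin g → Lin h →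
    (∀ x → g (h x) ≡ x) → (∀ x → h (g x) ≡ x) → (∀ x → T x ≡ g (S (h x))) → Hook k S → Hook k T
  Hook-conjugate {n} {k} {S} {T} {g} {h} G H gh hg T≡ hook = record
    { nil = λ x → trans (pow-conj (suc k) x) (trans (cong g (nil hook (h x))) (Lin.at-𝟎 G))
    ; top = top′ k (top hook)
    ; rank = card-resp (λ { y (x , (z , e) , e′) → g z , trans e′ (trans (cong g (trans e (cong S (sym (hg z))))) (sym (T≡ (g z)))) })
                       (λ { y (x , e) → S (h x) , (h x , refl) , trans e (T≡ x) })
                       (card-image g (λ x y _ _ e → trans (sym (hg x)) (trans (cong h e) (hg y))) (rank hook)) }
    where
    pow-conj : ∀ i x → pow T i x ≡ g (pow S i (h x))
    pow-conj zero x = sym (gh x)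
    pow-conj (suc i) x = trans (cong (pow T i) (T≡ x))
      (trans (pow-conj i _) (cong (λ y → g (pow S i y)) (hg _)))
    top′ : ∀ i → TopNonzero i S → TopNonzero i T
    top′ zero _ = tt
    top′ (suc i) (w , nz) = g w , λ e → nz (begin
      pow S (suc i) w               ≡⟨ hg _ ⟨
      h (g (pow S (suc i) w))       ≡⟨ cong (λ y → h (g (pow S (suc i) y))) (hg w) ⟨
      h (g (pow S (suc i) (h (g w)))) ≡⟨ cong h (pow-conj (suc i) (g w)) ⟨
      h (pow T (suc i) (g w))       ≡⟨ cong h e ⟩
      h 𝟎                           ≡⟨ Lin.at-𝟎 H ⟩
      𝟎                             ∎)

  -- Strictly lower triangular matrices, given by their columns; the coordinates are numbered
  -- in reverse, so that the last coordinate of the space is the head of a vector.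
  Tri : ℕ → Set
  Tri zero = ⊤
  Tri (suc c) = V c × Tri c

  app : ∀ {c} → Tri c → V c → V c
  app {zero} _ _ = []
  app {suc c} (b , A) (t ∷ y) = 0K ∷ (t ⊙ b ⊕ app A y)

  Lin-app : ∀ {c} (A : Tri c) → Lin (app A)
  Lin-app {zero} A = record { add = λ { [] [] → refl } ; smul = λ { _ [] → refl } }
  Lin-app {suc c} (b , A) = record
    { add = λ { (s ∷ x) (t ∷ y) → Lin.add L (s ∷ x) (t ∷ y) }
    ; smul = λ { s (t ∷ y) → Lin.smul L s (t ∷ y) } }
    where
    app′ : V (suc c) → V (suc c)
    app′ x = 0K ∷ (head x ⊙ b ⊕ app A (tail x))
    L : Lin app′
    L = Lin-∘ Lin-0∷ (Lin-⊕ (Lin-head⊙ b) (Lin-∘ (Lin-app A) Lin-tail))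

  module Step {c} (b : V c) (A : Tri c) where

    T : V c → V c
    T = app A

    T⁺ : V (suc c) → V (suc c)
    T⁺ = app (b , A)

    L : Lin T
    L = Lin-app A

    L⁺ : Lin T⁺
    L⁺ = Lin-app (b , A)

    T⁺-0∷ : ∀ y → T⁺ (0K ∷ y) ≡ 0K ∷ T y
    T⁺-0∷ y = cong (0K ∷_) (trans (cong (_⊕ T y) (0⊙ b)) (⊕-idˡ _))

    T⁺-1∷𝟎 : T⁺ (1K ∷ 𝟎) ≡ 0K ∷ b
    T⁺-1∷𝟎 = cong (0K ∷_) (trans (cong₂ _⊕_ (1⊙ b) (Lin.at-𝟎 L)) (⊕-idʳ b))

    pow-0∷ : ∀ i y → pow T⁺ i (0K ∷ y) ≡ 0K ∷ pow T i y
    pow-0∷ zero y = refl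
    pow-0∷ (suc i) y = trans (cong (pow T⁺ i) (T⁺-0∷ y)) (pow-0∷ i (T y))

    pow-∷ : ∀ i t y → pow T⁺ (suc i) (t ∷ y) ≡ 0K ∷ (t ⊙ pow T i b ⊕ pow T (suc i) y)
    pow-∷ i t y = trans (pow-0∷ i _) (cong (0K ∷_)
      (trans (Lin.add (Lin-pow L i) _ _) (cong (_⊕ pow T (suc i) y) (Lin.smul (Lin-pow L i) t b))))

    poly-0∷ : ∀ {m} w (cs : V m) → poly T⁺ (0K ∷ w) cs ≡ 0K ∷ poly T w cs
    poly-0∷ w [] = refl
    poly-0∷ w (s ∷ cs) = begin
      s ⊙ (0K ∷ w) ⊕ poly T⁺ (T⁺ (0K ∷ w)) cs      ≡⟨ cong₂ _⊕_ (sym (Lin.smul Lin-0∷ s w)) (trans (cong (λ v → poly T⁺ v cs) (T⁺-0∷ w)) (poly-0∷ (T w) cs)) ⟩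
      (0K ∷ s ⊙ w) ⊕ (0K ∷ poly T (T w) cs)       ≡⟨ Lin.add Lin-0∷ _ _ ⟨
      0K ∷ (s ⊙ w ⊕ poly T (T w) cs)              ∎

    -- T^k kills the image of T but not b, so applying it to t b + z recovers t, and then z. The
    -- size N is left open because `Hook-shrink` uses this lemma backwards, to find the rank of T
    -- from that of `T⁺`.
    rank-grows : ∀ {k N} → (∀ x → pow T (suc k) x ≡ 𝟎) → pow T k b ≢ 𝟎 →
                 HasCard (Image T) N → HasCard (Image T⁺) (N * q)
    rank-grows {k} nil nz im =
      card-resp (λ { v ((t , z) , ((x , e) , _) , e′) → t ∷ x , trans e′ (cong (λ z → 0K ∷ (t ⊙ b ⊕ z)) e) })
                (λ { v (t ∷ x , e) → (t , T x) , ((x , refl) , _) , e })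
        (card-image (λ { (t , z) → 0K ∷ (t ⊙ b ⊕ z) }) inj
          (card-fibres im (λ _ _ → card-K)))
      where
      kill : ∀ t z → Image T z → pow T k (t ⊙ b ⊕ z) ≡ t ⊙ pow T k b
      kill t z (x , e) = trans (Lin.add (Lin-pow L k) _ _)
        (trans (cong₂ _⊕_ (Lin.smul (Lin-pow L k) t b) (trans (cong (pow T k) e) (nil x))) (⊕-idʳ _))
      inj : ∀ u v → Image T (proj₂ u) × ⊤ → Image T (proj₂ v) × ⊤ →
            _≡_ {A = V (suc c)} (0K ∷ (proj₁ u ⊙ b ⊕ proj₂ u)) (0K ∷ (proj₁ v ⊙ b ⊕ proj₂ v)) → u ≡ v
      inj (t , z) (s , y) (iz , _) (iy , _) e = cong₂ _,_ t≡s z≡y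
        where
        e′ : t ⊙ b ⊕ z ≡ s ⊙ b ⊕ y
        e′ = VecP.∷-injectiveʳ e
        t≡s : t ≡ s
        t≡s = ⊙-injective t s nz (trans (sym (kill t z iz)) (trans (cong (pow T k) e′) (kill s y iy)))
        z≡y : z ≡ y
        z≡y = trans (sym (⊕-cancelʳ t b z)) (trans (cong (_⊕ (-K t) ⊙ b)
               (trans (⊕-comm z _) (trans e′ (trans (cong (λ r → r ⊙ b ⊕ y) (sym t≡s)) (⊕-comm _ y))))) (⊕-cancelʳ t b y))

    -- With b = T x, the combination t b + T y equals T (t x + y): the new column adds nothing to
    -- the image.
    Hook-stay : ∀ {k} → Hook k T → Image T b → Hook k T⁺
    Hook-stay {k} hook (x , b≡) = record
      { nil = nil′
      ; top = top′ k (top hook)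
      ; rank = card-resp (λ { v (z , (y , e) , e′) → 0K ∷ y , trans e′ (trans (cong (0K ∷_) e) (sym (T⁺-0∷ y))) })
                 (λ { v (t ∷ y , e) → T (t ⊙ x ⊕ y) , (_ , refl) , trans e (cong (0K ∷_) (absorb t y)) })
                 (card-image (0K ∷_) (λ { _ _ _ _ refl → refl }) (rank hook)) }
      where
      absorb : ∀ t y → t ⊙ b ⊕ T y ≡ T (t ⊙ x ⊕ y)
      absorb t y = sym (trans (Lin.add L _ _) (cong (_⊕ T y) (trans (Lin.smul L t x) (cong (t ⊙_) (sym b≡)))))
      nil′ : ∀ v → pow T⁺ (suc k) v ≡ 𝟎
      nil′ (t ∷ y) = trans (pow-0∷ k _) (cong (0K ∷_) (trans (cong (pow T k) (absorb t y)) (nil hook _)))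
      top′ : ∀ i → TopNonzero i T → TopNonzero i T⁺
      top′ zero _ = tt
      top′ (suc i) (w , nz) = 0K ∷ w , λ e → nz (VecP.∷-injectiveʳ (trans (sym (pow-0∷ (suc i) w)) e))

    Hook-grow : ∀ {k} → Hook k T → pow T k b ≢ 𝟎 → Hook (suc k) T⁺
    Hook-grow {k} hook nz = record
      { nil = λ { (t ∷ y) → trans (pow-0∷ (suc k) _) (cong (0K ∷_) (nil hook _)) }
      -- The new basis vector is sent to b, on which T^k does not vanish.
      ; top = 1K ∷ 𝟎 , λ e → nz (VecP.∷-injectiveʳ (trans (sym (pow-0∷ k b)) (trans (cong (pow T⁺ k) (sym T⁺-1∷𝟎)) e)))
      ; rank = subst (HasCard _) (ℕP.*-comm (q ^ k) q) (rank-grows {k} (nil hook) nz (rank hook)) }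

    -- For positive index k + 1 the question is whether T^(k+1) is already nonzero on the old
    -- coordinates. If so, at w say, the chain of w fills the whole image of `T⁺`, hence b and the
    -- image of T lie in that chain and the rank has not changed. If not, the nonzero power of `T⁺`
    -- can only come from the new column, so T^k b ≠ 0.
    Hook-shrink : ∀ k → Hook k T⁺ →
      (Hook k T × Image T b) ⊎ (∃ λ k′ → k ≡ suc k′ × Hook k′ T × pow T k′ b ≢ 𝟎)
    Hook-shrink zero hook = inj₁ (record
        { nil = T≡𝟎 ; top = tt
        ; rank = card-resp (λ { _ refl → 𝟎 , sym (T≡𝟎 𝟎) }) (λ { y (x , e) → trans e (T≡𝟎 x) }) (card-singleton 𝟎) }
      , 𝟎 , trans (VecP.∷-injectiveʳ (trans (sym T⁺-1∷𝟎) (nil hook (1K ∷ 𝟎)))) (sym (Lin.at-𝟎 L)))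
      where
      T≡𝟎 : ∀ y → T y ≡ 𝟎
      T≡𝟎 y = VecP.∷-injectiveʳ (trans (sym (T⁺-0∷ y)) (nil hook (0K ∷ y)))
    Hook-shrink (suc k) hook with pow-zero? (suc k) T
    ... | inj₁ (w , nz) = inj₁ (record
          { nil = nil′ ; top = w , nz
          ; rank = card-resp (λ { v (cs , _ , e) → poly T w cs , trans e (sym (poly-commute L w cs)) })
                             (λ { v (y , e) → let cs , e′ = chain (0K ∷ y) in
                                  cs , _ , trans e (VecP.∷-injectiveʳ (trans (sym (T⁺-0∷ y)) e′)) })
                             (card-chain L nil′ w nz) }
        , let cs , e = chain (1K ∷ 𝟎) in
          poly T w cs , trans (VecP.∷-injectiveʳ (trans (sym T⁺-1∷𝟎) e)) (sym (poly-commute L w cs)))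
      where
      nil′ : ∀ x → pow T (suc (suc k)) x ≡ 𝟎
      nil′ y = VecP.∷-injectiveʳ (trans (sym (pow-0∷ (suc (suc k)) y)) (nil hook (0K ∷ y)))
      chain : ∀ v → ∃ λ (cs : V (suc k)) → T⁺ v ≡ 0K ∷ poly T (T w) cs
      chain v with image-chain L⁺ (nil hook) (0K ∷ w)
                     (λ e → nz (VecP.∷-injectiveʳ (trans (sym (pow-0∷ (suc k) w)) e))) (rank hook) v
      ... | cs , e = cs , trans e (trans (cong (λ u → poly T⁺ u cs) (T⁺-0∷ w)) (poly-0∷ (T w) cs))
    ... | inj₂ nil′ = inj₂ (k , refl , record
          { nil = nil′ ; top = topNonzero k (b , nz) ; rank = rank′ } , nz)
      where
      nz : pow T k b ≢ 𝟎
      nz e with top hook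
      ... | t ∷ y , nz⁺ = nz⁺ (trans (pow-∷ k t y) (cong (0K ∷_)
             (trans (cong₂ _⊕_ (trans (cong (t ⊙_) e) (⊙𝟎 t)) (nil′ y)) (⊕-idʳ _))))
      -- The image of T has some size N; `rank-grows` gives N q = q^(k+1), and q is cancelled.
      rank′ : HasCard (Image T) (q ^ k)
      rank′ with card-image-T T
      ... | N , h = subst (HasCard (Image T)) (ℕP.*-cancelʳ-≡ N (q ^ k) q {{card-nonzero F}}
              (trans (card-unique (λ _ i → i) (λ _ i → i) (rank-grows {k} nil′ nz h) (rank hook)) (ℕP.*-comm q (q ^ k)))) h

-- Jordan normal form of hook type

module NormalForm (F : FiniteField) where

  open Hooks F public
  open import Data.Nat using (_+_; _*_; _^_)

  record KernelBasis {n : ℕ} (r : ℕ) (T : V n → V n) : Set where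
    field
      Z     : V r → V n
      lin   : Lin Z
      indep : ∀ ds → Z ds ≡ 𝟎 → ds ≡ 𝟎
      kills : ∀ ds → T (Z ds) ≡ 𝟎
      spans : ∀ y → T y ≡ 𝟎 → ∃ λ ds → y ≡ Z ds

  module _ {c} (b : V c) (A : Tri c) where
    open Step b A

    -- If b = T x, the new basis vector minus x is killed; this one vector is added to the old
    -- kernel basis and explains the summand with `(-K 1K) ⊙ x` in `Z⁺`.
    kernel-stay : ∀ {r} → KernelBasis r T → Image T b → KernelBasis (suc r) T⁺
    kernel-stay {r} B (x , b≡) = record
      { Z = Z⁺ ; lin = lin⁺
      ; indep = λ { (t ∷ ds) e → indep⁺ t ds e }
      ; kills = λ { (t ∷ ds) → cong (0K ∷_) (begin
          t ⊙ b ⊕ T (Z ds ⊕ t ⊙ (-K 1K) ⊙ x)  ≡⟨ cong (t ⊙ b ⊕_) (trans (Lin.add L _ _) (cong₂ _⊕_ (kills ds) (shift t))) ⟩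
          t ⊙ b ⊕ (𝟎 ⊕ t ⊙ (-K 1K) ⊙ b)       ≡⟨ cong (t ⊙ b ⊕_) (⊕-idˡ _) ⟩
          t ⊙ b ⊕ t ⊙ (-K 1K) ⊙ b             ≡⟨ ⊙-distribˡ t _ _ ⟨
          t ⊙ (b ⊕ (-K 1K) ⊙ b)               ≡⟨ cong (t ⊙_) (difference-self b) ⟩
          t ⊙ 𝟎                               ≡⟨ ⊙𝟎 t ⟩
          𝟎                                   ∎) }
      ; spans = λ { (t ∷ y) e → spans⁺ t y (VecP.∷-injectiveʳ e) } }
      where
      open KernelBasis B
      Z⁺ : V (suc r) → V (suc c)
      Z⁺ ds = head ds ∷ (Z (tail ds) ⊕ head ds ⊙ (-K 1K) ⊙ x)
      lin⁺ : Lin Z⁺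
      lin⁺ = record
        { add = λ { (s ∷ x) (t ∷ y) → cong (_ ∷_) (Lin.add M (s ∷ x) (t ∷ y)) }
        ; smul = λ { s (t ∷ y) → cong (_ ∷_) (Lin.smul M s (t ∷ y)) } }
        where M = Lin-⊕ (Lin-∘ lin Lin-tail) (Lin-head⊙ ((-K 1K) ⊙ x))
      shift : ∀ t → T (t ⊙ (-K 1K) ⊙ x) ≡ t ⊙ (-K 1K) ⊙ b
      shift t = trans (Lin.smul L t _) (cong (t ⊙_) (trans (Lin.smul L _ x) (cong (_ ⊙_) (sym b≡))))
      indep⁺ : ∀ t ds → Z⁺ (t ∷ ds) ≡ 𝟎 → t ∷ ds ≡ 𝟎
      indep⁺ t ds e = cong₂ _∷_ (VecP.∷-injectiveˡ e) (indep ds (begin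
        Z ds                        ≡⟨ ⊕-idʳ _ ⟨
        Z ds ⊕ 𝟎                    ≡⟨ cong (Z ds ⊕_) (trans (cong (_⊙ (-K 1K) ⊙ x) (VecP.∷-injectiveˡ e)) (0⊙ _)) ⟨
        Z ds ⊕ t ⊙ (-K 1K) ⊙ x      ≡⟨ VecP.∷-injectiveʳ e ⟩
        𝟎                           ∎))
      spans⁺ : ∀ t y → t ⊙ b ⊕ T y ≡ 𝟎 → ∃ λ ds → t ∷ y ≡ Z⁺ ds
      spans⁺ t y e with spans (y ⊕ t ⊙ x) (trans (Lin.add L _ _)
                           (trans (cong (T y ⊕_) (trans (Lin.smul L t x) (cong (t ⊙_) (sym b≡)))) (trans (⊕-comm _ _) e)))
      ... | ds , e′ = t ∷ ds , cong (t ∷_) (begin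
        y                                       ≡⟨ ⊕-idʳ y ⟨
        y ⊕ 𝟎                                   ≡⟨ cong (y ⊕_) (trans (cong (t ⊙_) (difference-self x)) (⊙𝟎 t)) ⟨
        y ⊕ t ⊙ (x ⊕ (-K 1K) ⊙ x)               ≡⟨ cong (y ⊕_) (⊙-distribˡ t _ _) ⟩
        y ⊕ (t ⊙ x ⊕ t ⊙ (-K 1K) ⊙ x)           ≡⟨ ⊕-assoc y _ _ ⟨
        (y ⊕ t ⊙ x) ⊕ t ⊙ (-K 1K) ⊙ x           ≡⟨ cong (_⊕ _) e′ ⟩
        Z ds ⊕ t ⊙ (-K 1K) ⊙ x                  ∎)

    -- Applying T^k to t b + T y = 0 leaves t T^k b = 0, hence t = 0: a kernel vector does not
    -- involve the new coordinate.
    kernel-grow : ∀ {r k} → (∀ x → pow T (suc k) x ≡ 𝟎) → pow T k b ≢ 𝟎 → KernelBasis r T → KernelBasis r T⁺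
    kernel-grow {r} {k} nil nz B = record
      { Z = λ ds → 0K ∷ Z ds
      ; lin = Lin-∘ Lin-0∷ lin
      ; indep = λ ds e → indep ds (VecP.∷-injectiveʳ e)
      ; kills = λ ds → trans (T⁺-0∷ (Z ds)) (cong (0K ∷_) (kills ds))
      ; spans = λ { (t ∷ y) e → spans⁺ t y e } }
      where
      open KernelBasis B
      spans⁺ : ∀ t y → T⁺ (t ∷ y) ≡ 𝟎 → ∃ λ ds → t ∷ y ≡ 0K ∷ Z ds
      spans⁺ t y e with ⊙-cancel t nz (begin
            t ⊙ pow T k b                          ≡⟨ ⊕-idʳ _ ⟨
            t ⊙ pow T k b ⊕ 𝟎                      ≡⟨ cong (t ⊙ pow T k b ⊕_) (nil y) ⟨
            t ⊙ pow T k b ⊕ pow T (suc k) y        ≡⟨ VecP.∷-injectiveʳ (trans (sym (pow-∷ k t y))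
                                                      (trans (cong (pow T⁺ k) e) (Lin.at-𝟎 (Lin-pow L⁺ k)))) ⟩
            𝟎                                      ∎)
      ... | refl with spans y (VecP.∷-injectiveʳ (trans (sym (T⁺-0∷ y)) e))
      ... | ds , e′ = ds , cong (0K ∷_) e′

  -- Rank plus nullity, by induction on the columns: a column in the image raises the nullity by
  -- one, any other raises the index k by one.
  kernel-basis : ∀ c (A : Tri c) k → Hook k (app A) → ∃ λ r → r + k ≡ c × KernelBasis r (app A)
  kernel-basis zero A zero hook = 0 , refl , record
    { Z = λ _ → [] ; lin = record { add = λ _ _ → refl ; smul = λ _ _ → refl }
    ; indep = λ { [] _ → refl } ; kills = λ _ → refl ; spans = λ { [] _ → [] , refl } }
  kernel-basis zero A (suc k) hook with top hook
  ... | [] , nz = ⊥-elim (nz (nil′ _))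
    where
    nil′ : ∀ (v : V 0) → v ≡ []
    nil′ [] = refl
  kernel-basis (suc c) (b , A) k hook with Step.Hook-shrink b A k hook
  ... | inj₁ (hook′ , im) with kernel-basis c A k hook′
  ...   | r , refl , B = suc r , refl , kernel-stay b A B im
  kernel-basis (suc c) (b , A) k hook | inj₂ (k′ , refl , hook′ , nz) with kernel-basis c A k′ hook′
  ...   | r , refl , B = r , ℕP.+-suc r k′ , kernel-grow b A {k = k′} (nil hook′) nz B

  -- If the first coordinate of p is nonzero, p can replace the first standard basis vector.
  -- Otherwise p lives in the remaining coordinates, where the induction hypothesis applies, and the
  -- second parameter takes over the first coordinate.
  basis-with-first : ∀ r (p : V (suc r)) → p ≢ 𝟎 →
    ∃ λ P → Lin P × (∀ x → P x ≡ 𝟎 → x ≡ 𝟎) × P (1K ∷ 𝟎) ≡ p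
  basis-with-first r (β ∷ b) p≢0 with β ≟K 0K
  ... | no β≢0 = P , lin , ker , trans (⊕-idʳ _) (1⊙ _)
    where
    P : V (suc r) → V (suc r)
    P x = head x ⊙ (β ∷ b) ⊕ (0K ∷ tail x)
    lin : Lin P
    lin = Lin-⊕ (Lin-head⊙ _) (Lin-∘ Lin-0∷ Lin-tail)
    tβ : ∀ t → (t *K β) +K 0K ≡ 0K → t ≡ 0K
    tβ t e with t ≟K 0K
    ... | yes t≡0 = t≡0
    ... | no t≢0 = let s , ts≡1 = inverse t t≢0 in ⊥-elim (β≢0 (begin
      β                  ≡⟨ KR.*-identityˡ β ⟨
      1K *K β            ≡⟨ cong (_*K β) (trans (sym ts≡1) (KR.*-comm t s)) ⟩
      (s *K t) *K β      ≡⟨ KR.*-assoc s t β ⟩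
      s *K (t *K β)      ≡⟨ cong (s *K_) (trans (sym (KR.+-identityʳ _)) e) ⟩
      s *K 0K            ≡⟨ KR.zeroʳ s ⟩
      0K                 ∎))
    ker : ∀ x → P x ≡ 𝟎 → x ≡ 𝟎
    ker (t ∷ x) e with tβ t (VecP.∷-injectiveˡ e)
    ... | refl = cong (0K ∷_) (trans (sym (⊕-idˡ x)) (trans (cong (_⊕ x) (sym (0⊙ b))) (VecP.∷-injectiveʳ e)))
  basis-with-first zero (β ∷ []) p≢0 | yes refl = ⊥-elim (p≢0 refl)
  basis-with-first (suc r) (β ∷ b) p≢0 | yes refl with basis-with-first r b (λ { refl → p≢0 refl })
  ... | P , lin , ker , Pe = P⁺ , lin⁺ , ker⁺ , cong (0K ∷_) Pe
    where
    P⁺ : V (suc (suc r)) → V (suc (suc r))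
    P⁺ (t ∷ d ∷ ds) = d ∷ P (t ∷ ds)
    lin⁺ : Lin P⁺
    lin⁺ = record { add = λ { (t ∷ d ∷ ds) (t′ ∷ d′ ∷ ds′) → cong (_ ∷_) (Lin.add lin (t ∷ ds) (t′ ∷ ds′)) }
                  ; smul = λ { s (t ∷ d ∷ ds) → cong (_ ∷_) (Lin.smul lin s (t ∷ ds)) } }
    ker⁺ : ∀ x → P⁺ x ≡ 𝟎 → x ≡ 𝟎
    ker⁺ (t ∷ d ∷ ds) e with ker (t ∷ ds) (VecP.∷-injectiveʳ e)
    ... | e′ = cong₂ _∷_ (VecP.∷-injectiveˡ e′) (cong₂ _∷_ (VecP.∷-injectiveˡ e) (VecP.∷-injectiveʳ e′))

  left : ∀ r {m} → V (r + m) → V r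
  left zero x = []
  left (suc r) (t ∷ x) = t ∷ left r x

  right : ∀ r {m} → V (r + m) → V m
  right zero x = x
  right (suc r) (t ∷ x) = right r x

  Lin-left : ∀ r {m} → Lin (left r {m})
  Lin-left zero = record { add = λ _ _ → refl ; smul = λ _ _ → refl }
  Lin-left (suc r) = record { add = λ { (s ∷ x) (t ∷ y) → cong (_ ∷_) (Lin.add (Lin-left r) x y) }
                            ; smul = λ { s (t ∷ x) → cong (_ ∷_) (Lin.smul (Lin-left r) s x) } }

  Lin-right : ∀ r {m} → Lin (right r {m})
  Lin-right zero = Lin-id
  Lin-right (suc r) = record { add = λ { (s ∷ x) (t ∷ y) → Lin.add (Lin-right r) x y }
                             ; smul = λ { s (t ∷ x) → Lin.smul (Lin-right r) s x } }

  split-zero : ∀ r {m} (x : V (r + m)) → left r x ≡ 𝟎 → right r x ≡ 𝟎 → x ≡ 𝟎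
  split-zero zero x _ e = e
  split-zero (suc r) (t ∷ x) e e′ = cong₂ _∷_ (VecP.∷-injectiveˡ e) (split-zero r x (VecP.∷-injectiveʳ e) e′)

  pad : ∀ r {m} → Tri m → Tri (r + m)
  pad zero A = A
  pad (suc r) A = 𝟎 , pad r A

  app-𝟎∷ : ∀ {m} (A : Tri m) t x → app (𝟎 , A) (t ∷ x) ≡ 0K ∷ app A x
  app-𝟎∷ A t x = cong (0K ∷_) (trans (cong (_⊕ app A x) (⊙𝟎 t)) (⊕-idˡ _))

  left-pad : ∀ r {m} (A : Tri m) x → left r (app (pad r A) x) ≡ 𝟎
  left-pad zero A x = refl
  left-pad (suc r) A (t ∷ x) = trans (cong (left (suc r)) (app-𝟎∷ (pad r A) t x)) (cong (0K ∷_) (left-pad r A x))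

  right-pad : ∀ r {m} (A : Tri m) x → right r (app (pad r A) x) ≡ app A (right r x)
  right-pad zero A x = refl
  right-pad (suc r) A (t ∷ x) = trans (cong (right (suc r)) (app-𝟎∷ (pad r A) t x)) (right-pad r A x)

  -- The value in dimension 0 lets `chain` treat its first column, which is empty, like all others.
  e₀ : ∀ {m} → V m
  e₀ {zero} = []
  e₀ {suc m} = 1K ∷ 𝟎

  chain : ∀ m → Tri m
  chain zero = tt
  chain (suc m) = e₀ , chain m

  shiftIn : ∀ {m} → K → V m → V m
  shiftIn s [] = []
  shiftIn s (c ∷ cs) = s ∷ shiftIn c cs

  shiftIn-e₀ : ∀ {m} t (y : V m) → t ⊙ e₀ ⊕ shiftIn 0K y ≡ shiftIn t y
  shiftIn-e₀ t [] = refl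
  shiftIn-e₀ t (c ∷ y) = cong₂ _∷_ (trans (KR.+-identityʳ _) (KR.*-identityʳ t))
                                   (trans (cong (_⊕ shiftIn c y) (⊙𝟎 t)) (⊕-idˡ _))

  app-chain : ∀ {m} (y : V m) → app (chain m) y ≡ shiftIn 0K y
  app-chain [] = refl
  app-chain (t ∷ y) = cong (0K ∷_) (trans (cong (t ⊙ e₀ ⊕_) (app-chain y)) (shiftIn-e₀ t y))

  -- The coefficient pushed out by the shift would belong to T^m w, which vanishes. So in the
  -- coordinates of the chain T is the shift, that is, a Jordan block.
  poly-shiftIn : ∀ {n m} {T : V n → V n} (L : Lin T) w s (cs : V m) → pow T m w ≡ 𝟎 →
                 poly T w (shiftIn s cs) ≡ s ⊙ w ⊕ poly T (T w) cs
  poly-shiftIn L w s [] refl = sym (trans (⊕-idʳ _) (⊙𝟎 s))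
  poly-shiftIn L w s (c ∷ cs) nil = cong (s ⊙ w ⊕_) (poly-shiftIn L _ c cs nil)

  -- Because the coordinates are reversed, the large Jordan block, which comes first in `Jordan`,
  -- stands behind the r zero columns.
  standardHook : ∀ r k → Tri (r + suc k)
  standardHook r k = pad r (chain (suc k))

  Hook-standardHook : ∀ r k → Hook k (app (standardHook r k))
  Hook-standardHook zero zero = record
    { nil = λ { (_ ∷ []) → refl } ; top = tt
    ; rank = card-resp (λ { v refl → 0K ∷ [] , refl }) (λ { v ((_ ∷ []) , e) → e }) (card-singleton (0K ∷ [])) }
  Hook-standardHook zero (suc k) = Step.Hook-grow e₀ (chain (suc k)) (Hook-standardHook zero k) (e₀-top k)
    where
    e₀-top : ∀ m → pow (app (chain (suc m))) m e₀ ≢ 𝟎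
    e₀-top zero e = 𝟎≢1∷ e
    e₀-top (suc m) e = e₀-top m (VecP.∷-injectiveʳ (trans (sym (Step.pow-0∷ e₀ (chain (suc m)) m e₀))
      (trans (cong (pow (app (chain (suc (suc m)))) m) (sym (Step.T⁺-1∷𝟎 e₀ (chain (suc m))))) e)))
  Hook-standardHook (suc r) k = Step.Hook-stay 𝟎 (standardHook r k) (Hook-standardHook r k)
    (𝟎 , sym (Lin.at-𝟎 (Lin-app (standardHook r k))))

  -- The end T^k w of a full chain lies in the kernel. It is completed to a basis of the kernel, and
  -- the r other vectors of this basis together with w, T w, ..., T^k w form a Jordan basis.
  hook-normal-form : ∀ r k (A : Tri (r + suc k)) → Hook k (app A) →
    ∃ λ g → ∃ λ h → Lin g × Lin h × (∀ x → g (h x) ≡ x) × (∀ x → h (g x) ≡ x) ×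
                    (∀ x → app A x ≡ g (app (standardHook r k) (h x)))
  hook-normal-form r k A hook with kernel-basis _ A k hook
  -- The nullity is r + 1: one dimension for T^k w, and r for the blocks of size one.
  ... | r₀ , r₀+k≡ , B with ℕP.+-cancelʳ-≡ k r₀ (suc r) (trans r₀+k≡ (ℕP.+-suc r k))
  ... | refl = g , proj₁ inv , G , proj₁ (proj₂ inv) , gh , proj₂ (proj₂ (proj₂ inv)) ,
               λ x → trans (cong T (sym (gh x))) (intertwine _)
    where
    open KernelBasis B
    T = app A
    L = Lin-app A
    -- For k = 0 `TopNonzero` supplies no vector; the kernel has positive dimension r + 1, and its
    -- first basis vector is taken.
    topVector : ∀ i → TopNonzero i T → PowNonzero i T
    topVector zero _ = Z (1K ∷ 𝟎) , λ e → 𝟎≢1∷ (indep _ e)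
    topVector (suc i) t = t
    w = proj₁ (topVector k (top hook))
    u≢𝟎 : pow T k w ≢ 𝟎
    u≢𝟎 = proj₂ (topVector k (top hook))
    u-spanned = spans (pow T k w) (trans (sym (pow-suc T k w)) (nil hook w))
    p = proj₁ u-spanned
    basis = basis-with-first r p (λ p≡𝟎 → u≢𝟎 (trans (proj₂ u-spanned) (trans (cong Z p≡𝟎) (Lin.at-𝟎 lin))))
    P = proj₁ basis
    Lin-P = proj₁ (proj₂ basis)
    Z′ : V (suc r) → V (r + suc k)
    Z′ x = Z (P x)
    lin′ : Lin Z′
    lin′ = Lin-∘ lin Lin-P
    Z′-first : Z′ (1K ∷ 𝟎) ≡ pow T k w
    Z′-first = trans (cong Z (proj₂ (proj₂ (proj₂ basis)))) (sym (proj₂ u-spanned))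
    g : V (r + suc k) → V (r + suc k)
    -- The first kernel coordinate is set to zero because it belongs to T^k w, which the chain
    -- already contains.
    g x = Z′ (0K ∷ left r x) ⊕ poly T w (right r x)
    G : Lin g
    G = Lin-⊕ (Lin-∘ lin′ (Lin-∘ Lin-0∷ (Lin-left r))) (Lin-∘ (Lin-poly T w) (Lin-right r))
    kernel : ∀ x → g x ≡ 𝟎 → x ≡ 𝟎
    kernel x e with poly-kernel L k w (right r x) (Z′ (0K ∷ left r x)) (nil hook w) u≢𝟎 (kills _) e
    ... | e₁ , f = split-zero r x (VecP.∷-injectiveʳ coeffs) (f (VecP.∷-injectiveˡ coeffs))
      where
      ℓ = last (right r x)
      -- By `poly-kernel` only the last chain coefficient ℓ survives; read as the coordinate of T^k
      -- w, it completes a relation between the independent vectors of the kernel basis.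
      coeffs : ℓ ∷ left r x ≡ 𝟎
      coeffs = proj₁ (proj₂ (proj₂ basis)) _ (indep _ (begin
        Z′ (ℓ ∷ left r x)                             ≡⟨ cong Z′ (cong₂ _∷_ (trans (KR.+-identityˡ _) (KR.*-identityʳ ℓ))
                                                          (trans (cong (left r x ⊕_) (⊙𝟎 ℓ)) (⊕-idʳ _))) ⟨
        Z′ ((0K ∷ left r x) ⊕ ℓ ⊙ (1K ∷ 𝟎))           ≡⟨ Lin.add lin′ _ _ ⟩
        Z′ (0K ∷ left r x) ⊕ Z′ (ℓ ⊙ (1K ∷ 𝟎))        ≡⟨ cong (Z′ (0K ∷ left r x) ⊕_) (trans (Lin.smul lin′ ℓ _) (cong (ℓ ⊙_) Z′-first)) ⟩
        Z′ (0K ∷ left r x) ⊕ ℓ ⊙ pow T k w            ≡⟨ e₁ ⟩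
        𝟎                                             ∎))
    inv = linear-bijective G kernel
    gh = proj₁ (proj₂ (proj₂ inv))
    intertwine : ∀ x → T (g x) ≡ g (app (standardHook r k) x)
    intertwine x = begin
      T (g x)                                                    ≡⟨ Lin.add L _ _ ⟩
      T (Z′ (0K ∷ left r x)) ⊕ T (poly T w (right r x))          ≡⟨ cong₂ _⊕_ (kills _) (poly-commute L w (right r x)) ⟩
      𝟎 ⊕ poly T (T w) (right r x)                               ≡⟨ cong₂ _⊕_ (Lin.at-𝟎 lin′) (trans (poly-shiftIn L w 0K (right r x) (nil hook w))
                                                                     (trans (cong (_⊕ poly T (T w) (right r x)) (0⊙ w)) (⊕-idˡ _))) ⟨
      Z′ 𝟎 ⊕ poly T w (shiftIn 0K (right r x))                   ≡⟨ cong₂ _⊕_ (cong (λ d → Z′ (0K ∷ d)) (left-pad r (chain (suc k)) x))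
                                                                     (cong (poly T w) (trans (right-pad r (chain (suc k)) x) (app-chain (right r x)))) ⟨
      g (app (standardHook r k) x)                               ∎

-- Matrices and linear maps

if-unless : ∀ {X : Set} (c : Bool) {x y : X} → (Bool.T c → ⊥) → (if c then x else y) ≡ y
if-unless false _ = refl
if-unless true ¬c = ⊥-elim (¬c tt)

Bool-ext : ∀ {a b} → (Bool.T a → Bool.T b) → (Bool.T b → Bool.T a) → a ≡ b
Bool-ext {false} {false} f g = refl
Bool-ext {false} {true} f g = ⊥-elim (g tt)
Bool-ext {true} {false} f g = ⊥-elim (f tt)
Bool-ext {true} {true} f g = refl

≤ᵇ-suc : ∀ m n → (suc m ≤ᵇ suc n) ≡ (m ≤ᵇ n)
≤ᵇ-suc zero n = refl
≤ᵇ-suc (suc m) n = refl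

≡ᵇ-+ : ∀ x m n → (x ℕ.+ m ≡ᵇ x ℕ.+ n) ≡ (m ≡ᵇ n)
≡ᵇ-+ zero m n = refl
≡ᵇ-+ (suc x) m n = ≡ᵇ-+ x m n

elemᵇ-map-+ : ∀ x m ys → elemᵇ (x ℕ.+ m) (map (x ℕ.+_) ys) ≡ elemᵇ m ys
elemᵇ-map-+ x m [] = refl
elemᵇ-map-+ x m (y ∷ ys) rewrite ≡ᵇ-+ x m y | elemᵇ-map-+ x m ys = refl

elemᵇ-map-< : ∀ x m ys → m < x → elemᵇ m (map (x ℕ.+_) ys) ≡ false
elemᵇ-map-< x m [] m<x = refl
elemᵇ-map-< x m (y ∷ ys) m<x = trans
  (if-unless (m ≡ᵇ x ℕ.+ y) (λ t → ℕP.<⇒≢ (ℕP.<-≤-trans m<x (ℕP.m≤m+n x y)) (ℕP.≡ᵇ⇒≡ m (x ℕ.+ y) t)))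
  (elemᵇ-map-< x m ys m<x)

-- The partial sums of a hook fill the interval from x to x + r.
elemᵇ-hook-≥ : ∀ x r d → d ≤ r → elemᵇ (x ℕ.+ d) (partialSums (x ∷ List.replicate r 1)) ≡ true
elemᵇ-hook-≥ x r d d≤r with x ℕ.+ d ≡ᵇ x in eq
elemᵇ-hook-≥ x r d d≤r | true = refl
elemᵇ-hook-≥ x r zero d≤r | false = ⊥-elim (subst Bool.T eq (ℕP.≡⇒≡ᵇ (x ℕ.+ 0) x (ℕP.+-identityʳ x)))
elemᵇ-hook-≥ x (suc r) (suc d) (s≤s d≤r) | false =
  trans (elemᵇ-map-+ x (suc d) (partialSums (List.replicate (suc r) 1))) (elemᵇ-hook-≥ 1 r d d≤r)

elemᵇ-hook-< : ∀ x r m → m < x → elemᵇ m (partialSums (x ∷ List.replicate r 1)) ≡ false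
elemᵇ-hook-< x r m m<x = trans
  (if-unless (m ≡ᵇ x) (λ t → ℕP.<⇒≢ m<x (ℕP.≡ᵇ⇒≡ m x t)))
  (elemᵇ-map-< x m (partialSums (List.replicate r 1)) m<x)

module Matrices (F : FiniteField) where

  open NormalForm F public
  open import Data.Nat using (_+_; _*_; _^_)

  private
    M : ℕ → Set
    M = Mat F

  e : ∀ {n} → Fin n → V n
  e zero = 1K ∷ 𝟎
  e (suc j) = 0K ∷ e j

  lookup-ext : ∀ {A : Set} {n} {x y : Vec A n} → (∀ i → lookup x i ≡ lookup y i) → x ≡ y
  lookup-ext {x = x} {y} h = trans (sym (VecP.tabulate∘lookup x)) (trans (VecP.tabulate-cong h) (VecP.tabulate∘lookup y))

  lookup-e : ∀ {n} (j i : Fin n) → lookup (e j) i ≡ (if toℕ i ≡ᵇ toℕ j then 1K else 0K)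
  lookup-e zero zero = refl
  lookup-e zero (suc i) = VecP.lookup-replicate i 0K
  lookup-e (suc j) zero = refl
  lookup-e (suc j) (suc i) = lookup-e j i

  linear-ext : ∀ {m n} {f g : V m → V n} → Lin f → Lin g → (∀ j → f (e j) ≡ g (e j)) → ∀ x → f x ≡ g x
  linear-ext {zero} L L′ h [] = trans (Lin.at-𝟎 L) (sym (Lin.at-𝟎 L′))
  linear-ext {suc m} {f = f} {g} L L′ h (t ∷ x) = begin
    f (t ∷ x)                         ≡⟨ cong f split ⟩
    f (t ⊙ e zero ⊕ (0K ∷ x))         ≡⟨ trans (Lin.add L _ _) (cong (_⊕ _) (Lin.smul L _ _)) ⟩
    t ⊙ f (e zero) ⊕ f (0K ∷ x)       ≡⟨ cong₂ _⊕_ (cong (t ⊙_) (h zero))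
                                          (linear-ext (Lin-∘ L Lin-0∷) (Lin-∘ L′ Lin-0∷) (λ j → h (suc j)) x) ⟩
    t ⊙ g (e zero) ⊕ g (0K ∷ x)       ≡⟨ trans (Lin.add L′ _ _) (cong (_⊕ _) (Lin.smul L′ _ _)) ⟨
    g (t ⊙ e zero ⊕ (0K ∷ x))         ≡⟨ cong g split ⟨
    g (t ∷ x)                         ∎
    where
    split : t ∷ x ≡ t ⊙ e zero ⊕ (0K ∷ x)
    split = cong₂ _∷_ (sym (trans (KR.+-identityʳ _) (KR.*-identityʳ t)))
                      (sym (trans (cong (_⊕ x) (⊙𝟎 t)) (⊕-idˡ x)))

  dot : ∀ {n} → V n → V n → K
  dot [] [] = 0K
  dot (a ∷ r) (t ∷ x) = (a *K t) +K dot r x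

  dot-⊕ : ∀ {n} (r x y : V n) → dot r (x ⊕ y) ≡ dot r x +K dot r y
  dot-⊕ [] [] [] = sym (KR.+-identityˡ 0K)
  dot-⊕ (a ∷ r) (s ∷ x) (t ∷ y) = trans (cong₂ _+K_ (KR.distribˡ a s t) (dot-⊕ r x y)) (interchange _ _ _ _)
    where open import Algebra.Properties.CommutativeSemigroup KR.+-commutativeSemigroup using (interchange)

  dot-⊙ : ∀ {n} t (r x : V n) → dot r (t ⊙ x) ≡ t *K dot r x
  dot-⊙ t [] [] = sym (KR.zeroʳ t)
  dot-⊙ t (a ∷ r) (s ∷ x) = trans (cong₂ _+K_ (x∙yz≈y∙xz a t s) (dot-⊙ t r x)) (sym (KR.distribˡ t _ _))
    where open import Algebra.Properties.CommutativeSemigroup KR.*-commutativeSemigroup using (x∙yz≈y∙xz)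

  dot-𝟎 : ∀ {n} (r : V n) → dot r 𝟎 ≡ 0K
  dot-𝟎 r = trans (cong (dot r) (sym (0⊙ 𝟎))) (trans (dot-⊙ 0K r 𝟎) (KR.zeroˡ _))

  dot-e : ∀ {n} (r : V n) j → dot r (e j) ≡ lookup r j
  dot-e (a ∷ r) zero = trans (cong₂ _+K_ (KR.*-identityʳ a) (dot-𝟎 r)) (KR.+-identityʳ a)
  dot-e (a ∷ r) (suc j) = trans (cong₂ _+K_ (KR.zeroʳ a) (dot-e r j)) (KR.+-identityˡ _)

  -- The index map ι is arbitrary because the tail of `allFin` is a tabulation of shifted indices.
  foldr-dot : ∀ {m n} (r x : V n) (c : Fin m → K) (ι : Fin n → Fin m) →
    (∀ l → c (ι l) ≡ lookup r l *K lookup x l) →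
    foldr (λ l acc → c l +K acc) 0K (List.tabulate ι) ≡ dot r x
  foldr-dot [] [] c ι h = refl
  foldr-dot (a ∷ r) (t ∷ x) c ι h = cong₂ _+K_ (h zero) (foldr-dot r x c (λ l → ι (suc l)) (λ l → h (suc l)))

  op : ∀ {n} → M n → V n → V n
  op A x = Vec.map (λ r → dot r x) A

  lookup-op : ∀ {n} (A : M n) x i → lookup (op A x) i ≡ dot (lookup A i) x
  lookup-op A x i = VecP.lookup-map i (λ r → dot r x) A

  lookup-op-e : ∀ {n} (A : M n) i j → lookup (op A (e j)) i ≡ entry F A i j
  lookup-op-e A i j = trans (lookup-op A (e j) i) (dot-e (lookup A i) j)

  Lin-op : ∀ {n} (A : M n) → Lin (op A)
  Lin-op A = record
    { add = λ x y → lookup-ext λ i → trans (lookup-op A _ i) (trans (dot-⊕ (lookup A i) x y)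
        (sym (trans (VecP.lookup-zipWith _+K_ i (op A x) (op A y)) (cong₂ _+K_ (lookup-op A x i) (lookup-op A y i)))))
    ; smul = λ t x → lookup-ext λ i → trans (lookup-op A _ i) (trans (dot-⊙ t (lookup A i) x)
        (sym (trans (VecP.lookup-map i (t *K_) (op A x)) (cong (t *K_) (lookup-op A x i))))) }

  entry-mkMat : ∀ {n} (f : Fin n → Fin n → K) i j → entry F (mkMat F f) i j ≡ f i j
  entry-mkMat f i j = trans (cong (λ r → lookup r j) (VecP.lookup∘tabulate (λ i → tabulate (f i)) i))
                            (VecP.lookup∘tabulate (f i) j)

  entry-ext : ∀ {n} {A B : M n} → (∀ i j → entry F A i j ≡ entry F B i j) → A ≡ B
  entry-ext h = lookup-ext λ i → lookup-ext (h i)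

  op-injective : ∀ {n} {A B : M n} → (∀ x → op A x ≡ op B x) → A ≡ B
  op-injective {A = A} {B} h = entry-ext λ i j →
    trans (sym (lookup-op-e A i j)) (trans (cong (λ x → lookup x i) (h (e j))) (lookup-op-e B i j))

  entry-· : ∀ {n} (A B : M n) i j → entry F (_·_ F A B) i j ≡ dot (lookup A i) (op B (e j))
  entry-· A B i j = trans (entry-mkMat _ i j) (foldr-dot (lookup A i) (op B (e j)) _ (λ l → l)
    (λ l → cong (entry F A i l *K_) (sym (lookup-op-e B l j))))

  op-· : ∀ {n} (A B : M n) x → op (_·_ F A B) x ≡ op A (op B x)
  op-· A B = linear-ext (Lin-op (_·_ F A B)) (Lin-∘ (Lin-op A) (Lin-op B)) λ j → lookup-ext λ i →
    trans (lookup-op-e (_·_ F A B) i j) (trans (entry-· A B i j) (sym (lookup-op A (op B (e j)) i)))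

  op-Id : ∀ {n} x → op (Id F n) x ≡ x
  op-Id {n} = linear-ext (Lin-op (Id F n)) Lin-id λ j → lookup-ext λ i →
    trans (lookup-op-e (Id F n) i j) (trans (entry-mkMat _ i j) (sym (lookup-e j i)))

  mat : ∀ {n} → (V n → V n) → M n
  mat f = mkMat F λ i j → lookup (f (e j)) i

  op-mat : ∀ {n} {f : V n → V n} → Lin f → ∀ x → op (mat f) x ≡ f x
  op-mat {f = f} L = linear-ext (Lin-op (mat f)) L λ j → lookup-ext λ i →
    trans (lookup-op-e (mat f) i j) (entry-mkMat _ i j)

  -- Conjugation by this reversal of the coordinates translates between strictly upper triangular
  -- matrices and `Tri`.
  R : ∀ {n} → V n → V n
  R x = tabulate λ i → lookup x (opposite i)

  lookup-R : ∀ {n} (x : V n) i → lookup (R x) i ≡ lookup x (opposite i)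
  lookup-R x i = VecP.lookup∘tabulate _ i

  R-involutive : ∀ {n} (x : V n) → R (R x) ≡ x
  R-involutive x = lookup-ext λ i →
    trans (lookup-R (R x) i) (trans (lookup-R x (opposite i)) (cong (lookup x) (FinP.opposite-involutive i)))

  Lin-R : ∀ {n} → Lin (R {n})
  Lin-R = record
    { add = λ x y → lookup-ext λ i → trans (lookup-R (x ⊕ y) i) (trans (VecP.lookup-zipWith _+K_ (opposite i) x y)
        (sym (trans (VecP.lookup-zipWith _+K_ i (R x) (R y)) (cong₂ _+K_ (lookup-R x i) (lookup-R y i)))))
    ; smul = λ t x → lookup-ext λ i → trans (lookup-R (t ⊙ x) i) (trans (VecP.lookup-map (opposite i) (t *K_) x)
        (sym (trans (VecP.lookup-map i (t *K_) (R x)) (cong (t *K_) (lookup-R x i))))) }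

  R-e : ∀ {n} (j : Fin n) → R (e j) ≡ e (opposite j)
  R-e j = lookup-ext λ i → trans (lookup-R (e j) i) (trans (lookup-e j (opposite i))
    (trans (cong (if_then 1K else 0K) (Bool-ext (to i) (from i))) (sym (lookup-e (opposite j) i))))
    where
    to : ∀ i → Bool.T (toℕ (opposite i) ≡ᵇ toℕ j) → Bool.T (toℕ i ≡ᵇ toℕ (opposite j))
    to i t = ℕP.≡⇒≡ᵇ _ _ (cong toℕ (trans (sym (FinP.opposite-involutive i))
                     (cong opposite (FinP.toℕ-injective (ℕP.≡ᵇ⇒≡ (toℕ (opposite i)) (toℕ j) t)))))
    from : ∀ i → Bool.T (toℕ i ≡ᵇ toℕ (opposite j)) → Bool.T (toℕ (opposite i) ≡ᵇ toℕ j)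
    from i t = ℕP.≡⇒≡ᵇ _ _ (cong toℕ (trans (cong opposite (FinP.toℕ-injective (ℕP.≡ᵇ⇒≡ (toℕ i) (toℕ (opposite j)) t)))
                                       (FinP.opposite-involutive j)))

  toMat : ∀ {n} → Tri n → M n
  toMat A = mat λ x → R (app A (R x))

  op-toMat : ∀ {n} (A : Tri n) x → op (toMat A) x ≡ R (app A (R x))
  op-toMat A = op-mat (Lin-∘ Lin-R (Lin-∘ (Lin-app A) Lin-R))

  low : ∀ {n} → Tri n → Fin n → Fin n → K
  low A i j = lookup (app A (e j)) i

  entry-toMat : ∀ {n} (A : Tri n) i j → entry F (toMat A) i j ≡ low A (opposite i) (opposite j)
  entry-toMat A i j = trans (entry-mkMat _ i j) (trans (lookup-R (app A (R (e j))) i)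
    (cong (λ x → lookup (app A x) (opposite i)) (R-e j)))

  module _ {c} (b : V c) (A : Tri c) where

    low-zero : ∀ j → low (b , A) zero j ≡ 0K
    low-zero zero = refl
    low-zero (suc j) = refl

    low-first : ∀ i → low (b , A) (suc i) zero ≡ lookup b i
    low-first i = cong (λ x → lookup x (suc i)) (Step.T⁺-1∷𝟎 b A)

    low-suc : ∀ i j → low (b , A) (suc i) (suc j) ≡ low A i j
    low-suc i j = cong (λ x → lookup x (suc i)) (Step.T⁺-0∷ b A (e j))

  low-injective : ∀ {n} (A B : Tri n) → (∀ i j → low A i j ≡ low B i j) → A ≡ B
  low-injective {zero} _ _ _ = refl
  low-injective {suc n} (a , A) (b , B) h = cong₂ _,_
    (lookup-ext λ i → trans (sym (low-first a A i)) (trans (h (suc i) zero) (low-first b B i)))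
    (low-injective A B λ i j → trans (sym (low-suc a A i j)) (trans (h (suc i) (suc j)) (low-suc b B i j)))

  toMat-injective : ∀ {n} (A B : Tri n) → toMat A ≡ toMat B → A ≡ B
  toMat-injective A B eq = low-injective A B λ i j → begin
    low A i j                                      ≡⟨ cong₂ (low A) (FinP.opposite-involutive i) (FinP.opposite-involutive j) ⟨
    low A (opposite (opposite i)) (opposite (opposite j)) ≡⟨ entry-toMat A (opposite i) (opposite j) ⟨
    entry F (toMat A) (opposite i) (opposite j)    ≡⟨ cong (λ X → entry F X (opposite i) (opposite j)) eq ⟩
    entry F (toMat B) (opposite i) (opposite j)    ≡⟨ entry-toMat B (opposite i) (opposite j) ⟩
    low B (opposite (opposite i)) (opposite (opposite j)) ≡⟨ cong₂ (low B) (FinP.opposite-involutive i) (FinP.opposite-involutive j) ⟩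
    low B i j                                      ∎

  fromLow : ∀ {n} → (Fin n → Fin n → K) → Tri n
  fromLow {zero} f = tt
  fromLow {suc n} f = tabulate (λ i → f (suc i) zero) , fromLow (λ i j → f (suc i) (suc j))

  low-fromLow : ∀ {n} (f : Fin n → Fin n → K) → (∀ i j → toℕ i ≤ toℕ j → f i j ≡ 0K) →
                ∀ i j → low (fromLow f) i j ≡ f i j
  low-fromLow {suc n} f h zero j = trans (low-zero (tabulate (λ i → f (suc i) zero)) (fromLow (λ i j → f (suc i) (suc j))) j) (sym (h zero j z≤n))
  low-fromLow {suc n} f h (suc i) zero = trans (low-first (tabulate (λ i → f (suc i) zero)) (fromLow (λ i j → f (suc i) (suc j))) i) (VecP.lookup∘tabulate (λ i → f (suc i) zero) i)
  low-fromLow {suc n} f h (suc i) (suc j) = trans (low-suc (tabulate (λ i → f (suc i) zero)) (fromLow (λ i j → f (suc i) (suc j))) i j)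
    (low-fromLow (λ i j → f (suc i) (suc j)) (λ i j i≤j → h (suc i) (suc j) (s≤s i≤j)) i j)

  low-standardHook : ∀ r m i j → low (pad r (chain m)) i j ≡
                     (if (toℕ i ≡ᵇ suc (toℕ j)) ∧ (r ≤ᵇ toℕ j) then 1K else 0K)
  low-standardHook (suc r) m zero j = low-zero 𝟎 (pad r (chain m)) j
  low-standardHook (suc r) m (suc i) zero = trans (low-first 𝟎 (pad r (chain m)) i)
    (trans (VecP.lookup-replicate i 0K) (cong (if_then 1K else 0K) (sym (BoolP.∧-zeroʳ (toℕ i ≡ᵇ 0)))))
  low-standardHook (suc r) m (suc i) (suc j) = trans (low-suc 𝟎 (pad r (chain m)) i j)
    (trans (low-standardHook r m i j)
      (cong (λ b → if (toℕ i ≡ᵇ suc (toℕ j)) ∧ b then 1K else 0K) (sym (≤ᵇ-suc r (toℕ j)))))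
  low-standardHook zero (suc m) zero j = low-zero e₀ (chain m) j
  low-standardHook zero (suc (suc m)) (suc zero) zero = low-first e₀ (chain (suc m)) zero
  low-standardHook zero (suc (suc m)) (suc (suc i)) zero =
    trans (low-first e₀ (chain (suc m)) (suc i)) (VecP.lookup-replicate i 0K)
  low-standardHook zero (suc m) (suc i) (suc j) = trans (low-suc e₀ (chain m) i j) (low-standardHook zero m i j)

  -- Under j ↦ n - 1 - j the superdiagonal becomes the subdiagonal, and since n = r + k + 1 the
  -- bound j ≤ k of the large block becomes r ≤ n - 1 - j.
  Jordan-hook : ∀ r k → Jordan F (r + suc k) (hook (r + suc k) k) ≡ toMat (standardHook r k)
  Jordan-hook r k rewrite ℕP.m+n∸n≡m r (suc k) = entry-ext λ i j → begin
    entry F (Jordan F (r + suc k) μ) i j                         ≡⟨ entry-mkMat _ i j ⟩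
    (if (toℕ j ≡ᵇ suc (toℕ i)) ∧ not (elemᵇ (suc (toℕ i)) (partialSums μ)) then 1K else 0K)
                                                               ≡⟨ cong (if_then 1K else 0K) (Bool-ext (to i j) (from i j)) ⟩
    (if (toℕ (opposite i) ≡ᵇ suc (toℕ (opposite j))) ∧ (r ≤ᵇ toℕ (opposite j)) then 1K else 0K)
                                                               ≡⟨ low-standardHook r (suc k) (opposite i) (opposite j) ⟨
    low (standardHook r k) (opposite i) (opposite j)           ≡⟨ entry-toMat (standardHook r k) i j ⟨
    entry F (toMat (standardHook r k)) i j                     ∎
    where
    n = r + suc k
    μ = suc k ∷ List.replicate r 1
    opp+ : ∀ (i : Fin n) → toℕ (opposite i) + suc (toℕ i) ≡ n
    opp+ i = trans (cong (_+ suc (toℕ i)) (FinP.opposite-prop i)) (ℕP.m∸n+n≡m (FinP.toℕ<n i))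
    elem< : ∀ m → m ≤ n → Bool.T (not (elemᵇ m (partialSums μ))) → m ≤ k
    elem< m m≤n t with m ℕP.≤? k
    ... | yes m≤k = m≤k
    ... | no m≰k with ℕP.m≤n⇒∃[o]m+o≡n (ℕP.≰⇒> m≰k)
    ... | d , refl = ⊥-elim (subst (λ b → Bool.T (not b)) (elemᵇ-hook-≥ (suc k) r d
                       (ℕP.+-cancelˡ-≤ (suc k) d r (subst (suc k + d ≤_) (ℕP.+-comm r (suc k)) m≤n))) t)
    to : ∀ i j → Bool.T ((toℕ j ≡ᵇ suc (toℕ i)) ∧ not (elemᵇ (suc (toℕ i)) (partialSums μ))) →
         Bool.T ((toℕ (opposite i) ≡ᵇ suc (toℕ (opposite j))) ∧ (r ≤ᵇ toℕ (opposite j)))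
    to i j t with Equivalence.to BoolP.T-∧ t
    ... | t₁ , t₂ = Equivalence.from BoolP.T-∧ (ℕP.≡⇒≡ᵇ _ _ (ℕP.+-cancelʳ-≡ (suc (toℕ i)) _ _ (begin
        toℕ (opposite i) + suc (toℕ i)          ≡⟨ opp+ i ⟩
        n                                       ≡⟨ opp+ j ⟨
        toℕ (opposite j) + suc (toℕ j)          ≡⟨ ℕP.+-suc _ _ ⟩
        suc (toℕ (opposite j) + toℕ j)          ≡⟨ cong (λ l → suc (toℕ (opposite j) + l)) j≡ ⟩
        suc (toℕ (opposite j)) + suc (toℕ i)    ∎))
      , ℕP.≤⇒≤ᵇ (ℕP.+-cancelʳ-≤ (suc (toℕ j)) r _ (subst (r + suc (toℕ j) ≤_) (sym (opp+ j))
          (ℕP.+-monoʳ-≤ r (s≤s (subst (_≤ k) (sym j≡) (elem< (suc (toℕ i)) (FinP.toℕ<n i) t₂)))))))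
      where
      j≡ : toℕ j ≡ suc (toℕ i)
      j≡ = ℕP.≡ᵇ⇒≡ _ _ t₁
    from : ∀ i j → Bool.T ((toℕ (opposite i) ≡ᵇ suc (toℕ (opposite j))) ∧ (r ≤ᵇ toℕ (opposite j))) →
           Bool.T ((toℕ j ≡ᵇ suc (toℕ i)) ∧ not (elemᵇ (suc (toℕ i)) (partialSums μ)))
    from i j t with Equivalence.to BoolP.T-∧ t
    ... | t₁ , t₂ = Equivalence.from BoolP.T-∧ (ℕP.≡⇒≡ᵇ _ _ j≡ ,
            subst (λ b → Bool.T (not b)) (sym (elemᵇ-hook-< (suc k) r (suc (toℕ i)) (s≤s i<k))) tt)
      where
      i≡ : toℕ (opposite i) ≡ suc (toℕ (opposite j))
      i≡ = ℕP.≡ᵇ⇒≡ _ _ t₁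
      j≡ : toℕ j ≡ suc (toℕ i)
      j≡ = ℕP.+-cancelˡ-≡ (suc (toℕ (opposite j))) _ _ (begin
        suc (toℕ (opposite j)) + toℕ j          ≡⟨ ℕP.+-suc _ _ ⟨
        toℕ (opposite j) + suc (toℕ j)          ≡⟨ opp+ j ⟩
        n                                       ≡⟨ opp+ i ⟨
        toℕ (opposite i) + suc (toℕ i)          ≡⟨ cong (_+ suc (toℕ i)) i≡ ⟩
        suc (toℕ (opposite j)) + suc (toℕ i)    ∎)
      i<k : toℕ i < k
      i<k = ℕP.≤-pred (subst (_≤ suc k) (cong suc j≡) (ℕP.+-cancelˡ-≤ r _ _
              (ℕP.≤-trans (ℕP.+-monoˡ-≤ (suc (toℕ j)) (ℕP.≤ᵇ⇒≤ r _ t₂)) (ℕP.≤-reflexive (opp+ j)))))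

  module _ (r k : ℕ) (A : Tri (r + suc k)) where
    private
      n = r + suc k
      N = standardHook r k
      J = Jordan F n (hook n k)

    op-J : ∀ x → op J x ≡ R (app N (R x))
    op-J x = trans (cong (λ B → op B x) (Jordan-hook r k)) (op-toMat N x)

    Conj⇒Hook : Conj F (toMat A) J → Hook k (app A)
    Conj⇒Hook (G , H , GH , HG , A≡) =
      Hook-conjugate {g = λ x → R (op G (R x))} {h = λ x → R (op H (R x))}
        (Lin-∘ Lin-R (Lin-∘ (Lin-op G) Lin-R)) (Lin-∘ Lin-R (Lin-∘ (Lin-op H) Lin-R))
        (inv G H GH) (inv H G HG) app≡ (Hook-standardHook r k)
      where
      inv : ∀ G H → _·_ F G H ≡ Id F n → ∀ x → R (op G (R (R (op H (R x))))) ≡ x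
      inv G H GH x = begin
        R (op G (R (R (op H (R x)))))  ≡⟨ cong (λ y → R (op G y)) (R-involutive _) ⟩
        R (op G (op H (R x)))          ≡⟨ cong R (op-· G H (R x)) ⟨
        R (op (_·_ F G H) (R x))       ≡⟨ cong (λ B → R (op B (R x))) GH ⟩
        R (op (Id F n) (R x))          ≡⟨ cong R (op-Id (R x)) ⟩
        R (R x)                        ≡⟨ R-involutive x ⟩
        x                              ∎
      app≡ : ∀ x → app A x ≡ R (op G (R (app N (R (op H (R x))))))
      app≡ x = begin
        app A x                                   ≡⟨ trans (R-involutive _) (cong (app A) (R-involutive x)) ⟨
        R (R (app A (R (R x))))                   ≡⟨ cong R (op-toMat A (R x)) ⟨
        R (op (toMat A) (R x))                    ≡⟨ cong (λ B → R (op B (R x))) A≡ ⟩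
        R (op (_·_ F (_·_ F G J) H) (R x))        ≡⟨ cong R (trans (op-· (_·_ F G J) H (R x)) (op-· G J _)) ⟩
        R (op G (op J (op H (R x))))              ≡⟨ cong (λ y → R (op G y)) (op-J _) ⟩
        R (op G (R (app N (R (op H (R x))))))     ∎

    Hook⇒Conj : Hook k (app A) → Conj F (toMat A) J
    Hook⇒Conj hook with hook-normal-form r k A hook
    ... | g , h , G , H , gh , hg , app≡ =
      mat g′ , mat h′ , inv G′ H′ (conj {g} {h} gh) , inv H′ G′ (conj {h} {g} hg) , op-injective λ x → begin
        op (toMat A) x                                   ≡⟨ op-toMat A x ⟩
        R (app A (R x))                                  ≡⟨ cong R (app≡ (R x)) ⟩
        R (g (app N (h (R x))))                          ≡⟨ cong (λ y → R (g y)) (R-involutive _) ⟨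
        g′ (R (app N (h (R x))))                         ≡⟨ cong (λ y → g′ (R (app N y))) (R-involutive _) ⟨
        g′ (R (app N (R (h′ x))))                        ≡⟨ cong g′ (op-J (h′ x)) ⟨
        g′ (op J (h′ x))                                 ≡⟨ op-mat G′ _ ⟨
        op (mat g′) (op J (h′ x))                        ≡⟨ op-· (mat g′) J _ ⟨
        op (_·_ F (mat g′) J) (h′ x)                     ≡⟨ cong (op (_·_ F (mat g′) J)) (op-mat H′ x) ⟨
        op (_·_ F (mat g′) J) (op (mat h′) x)            ≡⟨ op-· (_·_ F (mat g′) J) (mat h′) x ⟨
        op (_·_ F (_·_ F (mat g′) J) (mat h′)) x         ∎
      where
      g′ h′ : V n → V n
      g′ x = R (g (R x))
      h′ x = R (h (R x))
      G′ : Lin g′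
      G′ = Lin-∘ Lin-R (Lin-∘ G Lin-R)
      H′ : Lin h′
      H′ = Lin-∘ Lin-R (Lin-∘ H Lin-R)
      conj : ∀ {a b : V n → V n} → (∀ x → a (b x) ≡ x) → ∀ x → R (a (R (R (b (R x))))) ≡ x
      conj {a} ab x = trans (cong (λ y → R (a y)) (R-involutive _)) (trans (cong R (ab _)) (R-involutive x))
      inv : ∀ {a b : V n → V n} → Lin a → Lin b → (∀ x → a (b x) ≡ x) → _·_ F (mat a) (mat b) ≡ Id F n
      inv {a} {b} La Lb ab = op-injective λ x →
        trans (op-· (mat a) (mat b) x) (trans (op-mat La _) (trans (cong a (op-mat Lb x)) (trans (ab x) (sym (op-Id x)))))

-- Counting block by block

offKernel : (q m k : ℕ) → ℕ
offKernel q m zero    = q ℕ.^ m ∸ 1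
offKernel q m (suc k) = q ℕ.^ m ∸ q ℕ.^ (m ∸ 1)

-- N k counts the matrices of index k before the block. The last column either follows the growth,
-- with q^(k+1) choices, or is the growing column itself, preceded by l columns with q^k choices
-- each.
grownCount : (q m : ℕ) → (ℕ → ℕ) → (k l : ℕ) → ℕ
grownCount q m N zero    l       = 0
grownCount q m N (suc k) zero    = 0
grownCount q m N (suc k) (suc l) =
  grownCount q m N (suc k) l ℕ.* q ℕ.^ suc k ℕ.+ (N k ℕ.* (q ℕ.^ k) ℕ.^ l) ℕ.* offKernel q m k

module Counting (F : FiniteField) (B : ℕ → ℕ) where

  open Matrices F public
  open import Data.Nat using (_+_; _*_; _^_)

  -- The nilradical condition on column c: b is the part of that column above the diagonal, and in
  -- reversed coordinates its entry i stands in row `toℕ (opposite i)`.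
  Column : ∀ {c} → V c → Set
  Column {c} b = ∀ i → B c ≤ B (toℕ (opposite i)) → lookup b i ≡ 0K

  Columns : ∀ {c} → Tri c → Set
  Columns {zero} _ = ⊤
  Columns {suc c} (b , A) = Column b × Columns A

  BlockZero : ∀ {c} → Tri c → Set
  BlockZero A = ∀ i j → B (toℕ (opposite j)) ≤ B (toℕ (opposite i)) → low A i j ≡ 0K

  Columns⇒BlockZero : ∀ {c} (A : Tri c) → Columns A → BlockZero A
  Columns⇒BlockZero {suc c} (b , A) _ zero j _ = low-zero b A j
  Columns⇒BlockZero {suc c} (b , A) (col , _) (suc i) zero le = trans (low-first b A i)
    (col i (subst₂ (λ x y → B x ≤ B y) (FinP.toℕ-fromℕ c) (FinP.toℕ-inject₁ (opposite i)) le))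
  Columns⇒BlockZero {suc c} (b , A) (_ , cols) (suc i) (suc j) le = trans (low-suc b A i j)
    (Columns⇒BlockZero A cols i j
      (subst₂ (λ x y → B x ≤ B y) (FinP.toℕ-inject₁ (opposite j)) (FinP.toℕ-inject₁ (opposite i)) le))

  BlockZero⇒Columns : ∀ {c} (A : Tri c) → BlockZero A → Columns A
  BlockZero⇒Columns {zero} _ _ = tt
  BlockZero⇒Columns {suc c} (b , A) h =
    (λ i le → trans (sym (low-first b A i)) (h (suc i) zero
      (subst₂ (λ x y → B x ≤ B y) (sym (FinP.toℕ-fromℕ c)) (sym (FinP.toℕ-inject₁ (opposite i))) le))) ,
    BlockZero⇒Columns A λ i j le → trans (sym (low-suc b A i j)) (h (suc i) (suc j)
      (subst₂ (λ x y → B x ≤ B y) (sym (FinP.toℕ-inject₁ (opposite j))) (sym (FinP.toℕ-inject₁ (opposite i))) le))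

  HookIn : ∀ k {c} → Tri c → Set
  HookIn k A = Hook k (app A) × Columns A

  module _ {m : ℕ} where

    -- The i coordinates from m on, those of the current block, come first after the reversal.
    Supported : ∀ i → V (i + m) → Set
    Supported i b = left i b ≡ 𝟎

    inr : ∀ i → V m → V (i + m)
    inr zero x = x
    inr (suc i) x = 0K ∷ inr i x

    inr-injective : ∀ i x y → inr i x ≡ inr i y → x ≡ y
    inr-injective zero x y e = e
    inr-injective (suc i) x y e = inr-injective i x y (VecP.∷-injectiveʳ e)

    Supported-inr : ∀ i x → Supported i (inr i x)
    Supported-inr zero x = refl
    Supported-inr (suc i) x = cong (0K ∷_) (Supported-inr i x)

    inr-right : ∀ i b → Supported i b → b ≡ inr i (right i b)
    inr-right zero b _ = refl
    inr-right (suc i) (t ∷ b) e = cong₂ _∷_ (VecP.∷-injectiveˡ e) (inr-right i b (VecP.∷-injectiveʳ e))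

    card-Supported : ∀ i → HasCard (Supported i) (q ^ m)
    card-Supported i = card-resp (λ { b (x , _ , refl) → Supported-inr i x })
      (λ b s → right i b , tt , inr-right i b s) (card-image (inr i) (λ x y _ _ → inr-injective i x y) (card-V m))

    Supported-combination : ∀ i t b z → Supported i b → Supported i z → Supported i (b ⊕ t ⊙ z)
    Supported-combination i t b z sb sz = trans (Lin.add (Lin-left i) b _)
      (trans (cong₂ _⊕_ sb (trans (Lin.smul (Lin-left i) t z) (trans (cong (t ⊙_) sz) (⊙𝟎 t)))) (⊕-idˡ _))

    Supported⇒zero : ∀ i b → Supported i b → ∀ j → m ≤ toℕ (opposite j) → lookup b j ≡ 0K
    Supported⇒zero zero b _ j m≤ = ⊥-elim (ℕP.<⇒≱ (FinP.toℕ<n (opposite j)) m≤)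
    Supported⇒zero (suc i) (t ∷ b) s zero _ = VecP.∷-injectiveˡ s
    Supported⇒zero (suc i) (t ∷ b) s (suc j) m≤ = Supported⇒zero i b (VecP.∷-injectiveʳ s) j
      (subst (m ≤_) (FinP.toℕ-inject₁ (opposite j)) m≤)

    zero⇒Supported : ∀ i b → (∀ j → m ≤ toℕ (opposite j) → lookup b j ≡ 0K) → Supported i b
    zero⇒Supported zero b _ = refl
    zero⇒Supported (suc i) (t ∷ b) h = cong₂ _∷_
      (h zero (subst (m ≤_) (sym (FinP.toℕ-fromℕ (i + m))) (ℕP.m≤n+m m i)))
      (zero⇒Supported i b λ j m≤ → h (suc j) (subst (m ≤_) (sym (FinP.toℕ-inject₁ (opposite j))) m≤))

    module _ (i : ℕ) {T : V (i + m) → V (i + m)} (L : Lin T) (k : ℕ) where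

      card-offKernel-from : ∀ {N} → HasCard (λ b → Supported i b × pow T k b ≡ 𝟎) N →
                            HasCard (λ b → Supported i b × pow T k b ≢ 𝟎) (q ^ m ∸ N)
      card-offKernel-from {N} ker with card-filter (card-Supported i) (λ b → ¬? (pow T k b ≟V 𝟎))
      ... | M , off = subst (HasCard _) (trans (sym (ℕP.m+n∸m≡n N M)) (cong (_∸ N) total)) off
        where
        split : ∀ b → Supported i b → (Supported i b × pow T k b ≡ 𝟎) ⊎ (Supported i b × pow T k b ≢ 𝟎)
        split b s with pow T k b ≟V 𝟎
        ... | yes z = inj₁ (s , z)
        ... | no nz = inj₂ (s , nz)
        total : N + M ≡ q ^ m
        total = card-unique (λ b → [ proj₁ , proj₁ ]′) split
          (card-⊎ (λ { b (_ , z) (_ , nz) → nz z }) ker off) (card-Supported i)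

      -- Every supported b is y + t z for exactly one scalar t and one supported y in the kernel: t
      -- is the ratio of T^k b to T^k z, which exists because T^k takes values on a line.
      card-kernel : (∀ x y → pow T k y ≢ 𝟎 → ∃ λ t → pow T k x ≡ t ⊙ pow T k y) →
        ∀ z → Supported i z → pow T k z ≢ 𝟎 → ∃ λ N → HasCard (λ b → Supported i b × pow T k b ≡ 𝟎) N × N * q ≡ q ^ m
      card-kernel line z sz nz with card-filter (card-Supported i) (λ b → pow T k b ≟V 𝟎)
      ... | N , ker = N , ker , card-unique
              (λ { b ((t , y) , ((sy , _) , _) , refl) → Supported-combination i t y z sy sz })
              onto
              (card-image (λ { (t , y) → y ⊕ t ⊙ z }) inj (card-fibres ker (λ _ _ → card-K)))
              (card-Supported i)
        where
        L^k = Lin-pow L k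
        value : ∀ t y → pow T k y ≡ 𝟎 → pow T k (y ⊕ t ⊙ z) ≡ t ⊙ pow T k z
        value t y e = trans (Lin.add L^k _ _) (trans (cong₂ _⊕_ e (Lin.smul L^k t z)) (⊕-idˡ _))
        inj : ∀ u v → (Supported i (proj₂ u) × pow T k (proj₂ u) ≡ 𝟎) × ⊤ →
              (Supported i (proj₂ v) × pow T k (proj₂ v) ≡ 𝟎) × ⊤ →
              proj₂ u ⊕ proj₁ u ⊙ z ≡ proj₂ v ⊕ proj₁ v ⊙ z → u ≡ v
        inj (t , y) (t′ , y′) ((_ , e) , _) ((_ , e′) , _) eq
          with ⊙-injective t t′ nz (trans (sym (value t y e)) (trans (cong (pow T k) eq) (value t′ y′ e′)))
        ... | refl = cong (t ,_) (trans (sym (⊕-cancelʳ t z y)) (trans (cong (_⊕ (-K t) ⊙ z) eq) (⊕-cancelʳ t z y′)))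
        onto : ∀ b → Supported i b → ∃ λ u → ((Supported i (proj₂ u) × pow T k (proj₂ u) ≡ 𝟎) × ⊤) × b ≡ proj₂ u ⊕ proj₁ u ⊙ z
        onto b sb with line b z nz
        ... | s , e = (s , b ⊕ (-K s) ⊙ z) , ((Supported-combination i (-K s) b z sb sz ,
                trans (Lin.add L^k _ _) (trans (cong₂ _⊕_ e (Lin.smul L^k _ _)) (⊕-invʳ s _))) , tt) ,
              sym (⊕-cancelʳ′ s z b)

    -- T^0 is the identity, whose kernel is {0} for every m. For k > 0 the kernel is a hyperplane of
    -- the first m coordinates only if some vector there escapes it.
    Reaches : ∀ (k i : ℕ) → (V (i + m) → V (i + m)) → Set
    Reaches zero i T = ⊤
    Reaches (suc k) i T = ∃ λ z → Supported i z × pow T (suc k) z ≢ 𝟎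

    card-offKernel : ∀ (k i : ℕ) {T : V (i + m) → V (i + m)} → Lin T → Hook k T → Reaches k i T →
                     HasCard (λ b → Supported i b × pow T k b ≢ 𝟎) (offKernel q m k)
    card-offKernel zero i L hook _ = card-offKernel-from i L 0
      (card-resp (λ { b refl → Lin.at-𝟎 (Lin-left i) , refl }) (λ b → proj₂) (card-singleton 𝟎))
    card-offKernel (suc k) i {T} L hook (z , sz , nz) =
      card-offKernel-from i L (suc k) (subst (HasCard _) (N≡ m z L sz nz (proj₂ (proj₂ kernel))) (proj₁ (proj₂ kernel)))
      where
      line : ∀ x y → pow T (suc k) y ≢ 𝟎 → ∃ λ t → pow T (suc k) x ≡ t ⊙ pow T (suc k) y
      line x y nz = pow-line {k = k} L (nil hook) y nz (rank hook) x
      kernel : ∃ λ N → HasCard (λ b → Supported i b × pow T (suc k) b ≡ 𝟎) N × N * q ≡ q ^ m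
      kernel = card-kernel i L (suc k) line z sz nz
      N≡ : ∀ {N} m (z : V (i + m)) {T : V (i + m) → V (i + m)} → Lin T → left i z ≡ 𝟎 → pow T (suc k) z ≢ 𝟎 →
           N * q ≡ q ^ m → N ≡ q ^ (m ∸ 1)
      -- For m = 0 the supported vector z would be zero, so the exponent m - 1 occurs for positive m
      -- only.
      N≡ zero z {T} L sz nz _ = ⊥-elim (nz (trans (cong (pow T (suc k)) (split-zero i z sz (nil-vec (right i z))))
                                                (Lin.at-𝟎 (Lin-pow L (suc k)))))
        where
        nil-vec : (v : V 0) → v ≡ []
        nil-vec [] = refl
      N≡ {N} (suc m) z _ _ _ e = ℕP.*-cancelʳ-≡ N (q ^ m) q {{card-nonzero F}} (trans e (ℕP.*-comm q (q ^ m)))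

    -- Matrices whose last i columns belong to the block starting at m: in Stays the index k is
    -- already reached by the leading m × m part, in Grows it increases within the block.
    Stays : ∀ (k i : ℕ) → Tri (i + m) → Set
    Stays k zero A = HookIn k A
    Stays k (suc i) (b , A) = Stays k i A × Image (app A) b

    Grows : ∀ (k i : ℕ) → Tri (i + m) → Set
    GrowsNow : ∀ (k i : ℕ) → Tri (suc i + m) → Set

    Grows k zero A = ⊥
    Grows k (suc i) (b , A) = (Grows k i A × Image (app A) b) ⊎ GrowsNow k i (b , A)

    GrowsNow zero i _ = ⊥
    GrowsNow (suc k) i (b , A) = Stays k i A × (Supported i b × pow (app A) k b ≢ 𝟎)

    -- With this invariant a column in the image of A satisfies the block condition automatically.
    -- That is why all q^k elements of the image are admissible.
    Supports : ∀ i → Tri (i + m) → Set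
    Supports i A = ∀ x → Supported i (app A x)

    Supports-∷ : ∀ i b A → Supported i b → Supports i A → Supports (suc i) (b , A)
    Supports-∷ i b A sb sA (t ∷ y) = cong (0K ∷_)
      (trans (cong (left i) (⊕-comm (t ⊙ b) _)) (Supported-combination i t (app A y) b (sA y) sb))

    module _ (l : ℕ) (start : ∀ i → i < l → ∀ t → (B (i + m) ≤ B t) ⇔ (m ≤ t)) where

      Supported⇒Column : ∀ i → i < l → ∀ b → Supported i b → Column b
      Supported⇒Column i i<l b s j le = Supported⇒zero i b s j (Equivalence.to (start i i<l _) le)

      Column⇒Supported : ∀ i → i < l → ∀ b → Column b → Supported i b
      Column⇒Supported i i<l b col = zero⇒Supported i b λ j m≤ → col j (Equivalence.from (start i i<l _) m≤)

      stays-facts : ∀ (k i : ℕ) → i ≤ l → ∀ A → Stays k i A →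
        HookIn k A × Supports i A
      stays-facts k zero _ A h = h , (λ _ → refl)
      stays-facts k (suc i) i<l (b , A) (st , x , b≡) with stays-facts k i (ℕP.<⇒≤ i<l) A st
      ... | (hook , cols) , sA =
        (Step.Hook-stay b A hook (x , b≡) , Supported⇒Column i i<l b sb , cols) , Supports-∷ i b A sb sA
        where
        sb : Supported i b
        sb = trans (cong (left i) b≡) (sA x)

      -- Appended columns do not change the action on the first m coordinates, so a witness from the
      -- leading m × m part survives.
      stays-reaches : ∀ (k i : ℕ) A → Stays k i A → Reaches k i (app A)
      stays-reaches zero i A st = tt
      stays-reaches (suc k) zero A (hook , _) = proj₁ (top hook) , refl , proj₂ (top hook)
      stays-reaches (suc k) (suc i) (b , A) (st , _) with stays-reaches (suc k) i A st
      ... | z , sz , nz = 0K ∷ z , cong (0K ∷_) sz ,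
                          λ e → nz (VecP.∷-injectiveʳ (trans (sym (Step.pow-0∷ b A (suc k) z)) e))

      -- The last component forbids a second growth in the block: when the index rises to k + 1, the
      -- new power k + 1 acts on the first m coordinates as the old T^(k+1), which is zero.
      grows-facts : ∀ (k i : ℕ) → i ≤ l → ∀ A → Grows k i A →
        HookIn k A × Supports i A × (∀ x → Supported i x → pow (app A) k x ≡ 𝟎)
      grows-facts k (suc i) i<l (b , A) (inj₁ (gr , x , b≡)) with grows-facts k i (ℕP.<⇒≤ i<l) A gr
      ... | (hook , cols) , sA , dead =
        (Step.Hook-stay b A hook (x , b≡) , Supported⇒Column i i<l b sb , cols) , Supports-∷ i b A sb sA ,
        λ { (t ∷ y) s → trans (cong (λ t → pow (app (b , A)) k (t ∷ y)) (VecP.∷-injectiveˡ s))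
                          (trans (Step.pow-0∷ b A k y) (cong (0K ∷_) (dead y (VecP.∷-injectiveʳ s)))) }
        where
        sb : Supported i b
        sb = trans (cong (left i) b≡) (sA x)
      grows-facts (suc k) (suc i) i<l (b , A) (inj₂ (st , sb , nz)) with stays-facts k i (ℕP.<⇒≤ i<l) A st
      ... | (hook , cols) , sA =
        (Step.Hook-grow b A hook nz , Supported⇒Column i i<l b sb , cols) , Supports-∷ i b A sb sA ,
        λ { (t ∷ y) s → trans (cong (λ t → pow (app (b , A)) (suc k) (t ∷ y)) (VecP.∷-injectiveˡ s))
                          (trans (Step.pow-0∷ b A (suc k) y) (cong (0K ∷_) (nil hook y))) }

      classify : ∀ (k i : ℕ) → i ≤ l → ∀ A → HookIn k A → Stays k i A ⊎ Grows k i A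
      classify k zero _ A h = inj₁ h
      classify k (suc i) i<l (b , A) (hook , col , cols) with Step.Hook-shrink b A k hook
      ... | inj₁ (hook′ , im) with classify k i (ℕP.<⇒≤ i<l) A (hook′ , cols)
      ...   | inj₁ st = inj₁ (st , im)
      ...   | inj₂ gr = inj₂ (inj₁ (gr , im))
      classify k (suc i) i<l (b , A) (hook , col , cols) | inj₂ (k′ , refl , hook′ , nz)
        with classify k′ i (ℕP.<⇒≤ i<l) A (hook′ , cols)
      ...   | inj₁ st = inj₂ (inj₂ (st , Column⇒Supported i i<l b col , nz))
      -- A second growth in the same block would need a supported b that the power does not kill.
      ...   | inj₂ gr = ⊥-elim (nz (proj₂ (proj₂ (grows-facts k′ i (ℕP.<⇒≤ i<l) A gr)) b (Column⇒Supported i i<l b col)))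

      index-unique : ∀ {k c} (A : Tri c) → Hook k (app A) → Hook (suc k) (app A) → ⊥
      index-unique A h h⁺ = proj₂ (top h⁺) (nil h _)

      disjoint : ∀ (k i : ℕ) → i ≤ l → ∀ A → Stays k i A → Grows k i A → ⊥
      disjoint k (suc i) i<l (b , A) (st , _) (inj₁ (gr , _)) = disjoint k i (ℕP.<⇒≤ i<l) A st gr
      disjoint (suc k) (suc i) i<l (b , A) (st , _) (inj₂ (st′ , _)) = index-unique A
        (proj₁ (proj₁ (stays-facts k i (ℕP.<⇒≤ i<l) A st′)))
        (proj₁ (proj₁ (stays-facts (suc k) i (ℕP.<⇒≤ i<l) A st)))

      module _ (N : ℕ → ℕ) (card-N : ∀ k → HasCard (HookIn k {m}) (N k)) where

        card-stays : ∀ (k i : ℕ) → i ≤ l → HasCard (Stays k i) (N k * (q ^ k) ^ i)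
        card-stays k zero _ = subst (HasCard _) (sym (ℕP.*-identityʳ (N k))) (card-N k)
        card-stays k (suc i) i<l = subst (HasCard _)
          (trans (ℕP.*-assoc (N k) _ _) (cong (N k *_) (ℕP.*-comm ((q ^ k) ^ i) (q ^ k))))
          (card-fibres (card-stays k i (ℕP.<⇒≤ i<l))
            λ A st → rank (proj₁ (proj₁ (stays-facts k i (ℕP.<⇒≤ i<l) A st))))

        card-grows : ∀ (k i : ℕ) → i ≤ l → HasCard (Grows k i) (grownCount q m N k i)
        card-grows zero i i≤l = card-resp (λ _ ()) (never i) card-∅
          where
          never : ∀ i A → Grows zero i A → ⊥
          never (suc i) (b , A) (inj₁ (gr , _)) = never i A gr
        card-grows (suc k) zero _ = card-∅
        card-grows (suc k) (suc i) i<l = card-⊎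
          (λ { (b , A) (gr , _) (st , _) → index-unique A
                 (proj₁ (proj₁ (stays-facts k i i≤l A st))) (proj₁ (proj₁ (grows-facts (suc k) i i≤l A gr))) })
          (card-fibres (card-grows (suc k) i i≤l) λ A gr → rank (proj₁ (proj₁ (grows-facts (suc k) i i≤l A gr))))
          (card-fibres (card-stays k i i≤l) λ A st →
            card-offKernel k i (Lin-app A) (proj₁ (proj₁ (stays-facts k i i≤l A st))) (stays-reaches k i A st))
          where
          i≤l : i ≤ l
          i≤l = ℕP.<⇒≤ i<l

        card-block : ∀ k → HasCard (HookIn k {l + m}) (N k * (q ^ k) ^ l + grownCount q m N k l)
        card-block k = card-resp
          (λ A → [ (λ st → proj₁ (stays-facts k l ℕP.≤-refl A st)) , (λ gr → proj₁ (grows-facts k l ℕP.≤-refl A gr)) ]′)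
          (classify k l ℕP.≤-refl)
          (card-⊎ (disjoint k l ℕP.≤-refl) (card-stays k l ℕP.≤-refl) (card-grows k l ℕP.≤-refl))

-- Powers of q and q-integers

open import Data.Rational using (ℚ; 0ℚ; 1ℚ; _+_; _*_; _-_)
open Algebra.Properties.CommutativeSemiring.Exp (CommutativeRing.commutativeSemiring ℚP.+-*-commutativeRing)
  public using (^-homo-*; ^-distrib-*) renaming (_^_ to infixr 8 _^ℚ_)
module *-Solver = Algebra.Solver.CommutativeMonoid ℚP.*-1-commutativeMonoid

ℕ→ℚ-toℚᵘ : ∀ a → ℚ.toℚᵘ (ℕ→ℚ a) ℚᵘ.≃ ℚᵘ.mkℚᵘ (ℤ.+ a) 0
ℕ→ℚ-toℚᵘ a = ℚP.toℚᵘ-fromℚᵘ (ℚᵘ.mkℚᵘ (ℤ.+ a) 0)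

ℕ→ℚ-+ : ∀ a b → ℕ→ℚ (a ℕ.+ b) ≡ ℕ→ℚ a + ℕ→ℚ b
ℕ→ℚ-+ a b = ℚP.toℚᵘ-injective (ℚᵘP.≃-trans (ℕ→ℚ-toℚᵘ (a ℕ.+ b)) (ℚᵘP.≃-trans
  (ℚᵘ.*≡* (cong (ℤ._* (ℤ.+ 1)) (sym (cong₂ ℤ._+_ (ℤP.*-identityʳ (ℤ.+ a)) (ℤP.*-identityʳ (ℤ.+ b))))))
  (ℚᵘP.≃-sym (ℚᵘP.≃-trans (ℚP.toℚᵘ-homo-+ (ℕ→ℚ a) (ℕ→ℚ b)) (ℚᵘP.+-cong (ℕ→ℚ-toℚᵘ a) (ℕ→ℚ-toℚᵘ b))))))

ℕ→ℚ-* : ∀ a b → ℕ→ℚ (a ℕ.* b) ≡ ℕ→ℚ a * ℕ→ℚ b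
ℕ→ℚ-* a b = ℚP.toℚᵘ-injective (ℚᵘP.≃-trans (ℕ→ℚ-toℚᵘ (a ℕ.* b)) (ℚᵘP.≃-trans
  (ℚᵘ.*≡* (cong (ℤ._* (ℤ.+ 1)) (ℤP.pos-* a b)))
  (ℚᵘP.≃-sym (ℚᵘP.≃-trans (ℚP.toℚᵘ-homo-* (ℕ→ℚ a) (ℕ→ℚ b)) (ℚᵘP.*-cong (ℕ→ℚ-toℚᵘ a) (ℕ→ℚ-toℚᵘ b))))))

ℕ→ℚ-^ : ∀ a k → ℕ→ℚ (a ℕ.^ k) ≡ ℕ→ℚ a ^ℚ k
ℕ→ℚ-^ a zero = refl
ℕ→ℚ-^ a (suc k) = trans (ℕ→ℚ-* a (a ℕ.^ k)) (cong (ℕ→ℚ a *_) (ℕ→ℚ-^ a k))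

ℕ→ℚ-∸ : ∀ a b → b ≤ a → ℕ→ℚ (a ∸ b) ≡ ℕ→ℚ a - ℕ→ℚ b
ℕ→ℚ-∸ a b b≤a = begin
  x                       ≡⟨ solve 2 (λ x y → x := (x :+ y) :- y) refl x y ⟩
  (x + y) - y             ≡⟨ cong (_- y) (trans (sym (ℕ→ℚ-+ (a ∸ b) b)) (cong ℕ→ℚ (ℕP.m∸n+n≡m b≤a))) ⟩
  ℕ→ℚ a - y               ∎
  where
  open ℚSolver.+-*-Solver
  x = ℕ→ℚ (a ∸ b)
  y = ℕ→ℚ b

1/ℕ-inverse : ∀ n .{{_ : NonZero n}} → (ℤ.+ 1 ℚ./ n) * ℕ→ℚ n ≡ 1ℚ
1/ℕ-inverse (suc n) = ℚP.toℚᵘ-injective (ℚᵘP.≃-trans (ℚP.toℚᵘ-homo-* (ℤ.+ 1 ℚ./ suc n) (ℕ→ℚ (suc n)))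
  (ℚᵘP.≃-trans (ℚᵘP.*-cong (ℚP.toℚᵘ-fromℚᵘ (ℚᵘ.mkℚᵘ (ℤ.+ 1) n)) (ℕ→ℚ-toℚᵘ (suc n)))
    (ℚᵘ.*≡* (trans (ℤP.*-identityʳ (ℤ.+ 1 ℤ.* ℤ.+ suc n)) (cong ℤ.+_ (cong suc (sym (cong (ℕ._+ 0) (ℕP.*-identityʳ n)))))))))

sumℚ-∷ʳ : ∀ f n → sumℚ (applyUpTo f (suc n)) ≡ sumℚ (applyUpTo f n) + f n
sumℚ-∷ʳ f zero = ℚP.+-comm (f 0) 0ℚ
sumℚ-∷ʳ f (suc n) = trans (cong (f 0 +_) (sumℚ-∷ʳ (λ i → f (suc i)) n)) (sym (ℚP.+-assoc (f 0) _ _))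

-- The binomial coefficient k(k-1)/2.
tri : ℕ → ℕ
tri zero    = 0
tri (suc k) = k ℕ.+ tri k

-- The loss k(k+3)/2 in the exponent of q.
loss : ℕ → ℕ
loss zero    = 0
loss (suc k) = suc (suc k) ℕ.+ loss k

-- For n = k + r + 1 this exhibits C(n,2) as C(n-k,2) plus a sum containing k, so the truncated
-- subtractions in the exponent of the theorem lose nothing.
choose-two-+ : ∀ k r → (k ℕ.+ suc r) C 2 ≡ suc r C 2 ℕ.+ (k ℕ.* r ℕ.+ tri k ℕ.+ k)
choose-two-+ zero r = sym (ℕP.+-identityʳ _)
choose-two-+ (suc k) r = begin
  (suc k ℕ.+ suc r) C 2                                   ≡⟨ nCk+nC[k+1]≡[n+1]C[k+1] (k ℕ.+ suc r) 1 ⟨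
  (k ℕ.+ suc r) C 1 ℕ.+ (k ℕ.+ suc r) C 2                 ≡⟨ cong₂ ℕ._+_ (nC1≡n (k ℕ.+ suc r)) (choose-two-+ k r) ⟩
  (k ℕ.+ suc r) ℕ.+ (c ℕ.+ (k ℕ.* r ℕ.+ tri k ℕ.+ k))
    ≡⟨ solve 5 (λ k r c t kr → (k :+ (con 1 :+ r)) :+ (c :+ (kr :+ t :+ k)) := c :+ ((r :+ kr) :+ (k :+ t) :+ (con 1 :+ k)))
         refl k r c (tri k) (k ℕ.* r) ⟩
  c ℕ.+ (suc k ℕ.* r ℕ.+ tri (suc k) ℕ.+ suc k)           ∎
  where
  open ℕSolver.+-*-Solver
  c = suc r C 2

exponent : ∀ r k → ((r ℕ.+ suc k) C 2) ∸ (((r ℕ.+ suc k) ∸ k) C 2) ∸ k ≡ k ℕ.* r ℕ.+ tri k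
exponent r k = begin
  ((r ℕ.+ suc k) C 2) ∸ (((r ℕ.+ suc k) ∸ k) C 2) ∸ k  ≡⟨ cong (λ n → (n C 2) ∸ ((n ∸ k) C 2) ∸ k) (trans (ℕP.+-suc r k) (ℕP.+-comm (suc r) k)) ⟩
  ((k ℕ.+ suc r) C 2) ∸ (((k ℕ.+ suc r) ∸ k) C 2) ∸ k  ≡⟨ cong (λ n → ((k ℕ.+ suc r) C 2) ∸ (n C 2) ∸ k) (ℕP.m+n∸m≡n k (suc r)) ⟩
  ((k ℕ.+ suc r) C 2) ∸ (suc r C 2) ∸ k                ≡⟨ cong (λ n → n ∸ (suc r C 2) ∸ k) (choose-two-+ k r) ⟩
  (suc r C 2 ℕ.+ (k ℕ.* r ℕ.+ tri k ℕ.+ k)) ∸ (suc r C 2) ∸ k ≡⟨ cong (_∸ k) (ℕP.m+n∸m≡n (suc r C 2) _) ⟩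
  (k ℕ.* r ℕ.+ tri k ℕ.+ k) ∸ k                        ≡⟨ ℕP.m+n∸n≡m _ k ⟩
  k ℕ.* r ℕ.+ tri k                                    ∎

exponent+loss : ∀ r k → (k ℕ.* r ℕ.+ tri k) ℕ.+ loss k ≡ k ℕ.* (r ℕ.+ suc k)
exponent+loss r zero = refl
exponent+loss r (suc k) = begin
  (r ℕ.+ k ℕ.* r ℕ.+ (k ℕ.+ tri k)) ℕ.+ (suc (suc k) ℕ.+ loss k)
    ≡⟨ solve 5 (λ r k kr t l → (r :+ kr :+ (k :+ t)) :+ (con 2 :+ k :+ l) := (kr :+ t :+ l) :+ (r :+ (con 2 :+ k) :+ k))
         refl r k (k ℕ.* r) (tri k) (loss k) ⟩
  ((k ℕ.* r ℕ.+ tri k) ℕ.+ loss k) ℕ.+ (r ℕ.+ suc (suc k) ℕ.+ k) ≡⟨ cong (ℕ._+ (r ℕ.+ suc (suc k) ℕ.+ k)) (exponent+loss r k) ⟩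
  k ℕ.* (r ℕ.+ suc k) ℕ.+ (r ℕ.+ suc (suc k) ℕ.+ k)
    ≡⟨ solve 2 (λ r k → k :* (r :+ (con 1 :+ k)) :+ (r :+ (con 2 :+ k) :+ k) := (con 1 :+ k) :* (r :+ (con 2 :+ k))) refl r k ⟩
  suc k ℕ.* (r ℕ.+ suc (suc k))                            ∎
  where open ℕSolver.+-*-Solver

module Formula (q : ℕ) .{{_ : NonZero q}} where

  Q p : ℚ
  Q = ℕ→ℚ q
  p = ℤ.+ 1 ℚ./ q

  pQ≡1 : p * Q ≡ 1ℚ
  pQ≡1 = 1/ℕ-inverse q

  p^Q^≡1 : ∀ i → p ^ℚ i * Q ^ℚ i ≡ 1ℚ
  p^Q^≡1 i = trans (sym (^-distrib-* p Q i)) (trans (cong (_^ℚ i) pQ≡1) (one i))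
    where
    one : ∀ i → 1ℚ ^ℚ i ≡ 1ℚ
    one zero = refl
    one (suc i) = trans (ℚP.*-identityˡ _) (one i)

  [_] : ℕ → ℚ
  [ m ] = qint q m

  1/q^ : ∀ i → ℚ._/_ (ℤ.+ 1) (q ℕ.^ i) {{ℕP.m^n≢0 q i}} ≡ p ^ℚ i
  1/q^ i = begin
    u                              ≡⟨ ℚP.*-identityʳ u ⟨
    u * 1ℚ                         ≡⟨ cong (u *_) (trans (sym (p^Q^≡1 i)) (ℚP.*-comm (p ^ℚ i) _)) ⟩
    u * (Q ^ℚ i * p ^ℚ i)          ≡⟨ ℚP.*-assoc u _ _ ⟨
    (u * Q ^ℚ i) * p ^ℚ i          ≡⟨ cong (_* p ^ℚ i) (trans (cong (u *_) (sym (ℕ→ℚ-^ q i))) (1/ℕ-inverse (q ℕ.^ i) {{ℕP.m^n≢0 q i}})) ⟩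
    1ℚ * p ^ℚ i                    ≡⟨ ℚP.*-identityˡ _ ⟩
    p ^ℚ i                         ∎
    where u = ℚ._/_ (ℤ.+ 1) (q ℕ.^ i) {{ℕP.m^n≢0 q i}}

  [suc] : ∀ m → [ suc m ] ≡ [ m ] + p ^ℚ m
  [suc] m = trans (sumℚ-∷ʳ (λ i → ℚ._/_ (ℤ.+ 1) (q ℕ.^ i) {{ℕP.m^n≢0 q i}}) m) (cong ([ m ] +_) (1/q^ m))

  geometric : ∀ m → (Q - 1ℚ) * p * [ m ] ≡ 1ℚ - p ^ℚ m
  geometric zero = ℚP.*-zeroʳ ((Q - 1ℚ) * p)
  geometric (suc m) = begin
    (Q - 1ℚ) * p * [ suc m ]                              ≡⟨ cong ((Q - 1ℚ) * p *_) ([suc] m) ⟩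
    (Q - 1ℚ) * p * ([ m ] + p ^ℚ m)
      ≡⟨ solve 4 (λ Q p x u → (Q :- con 1ℚ) :* p :* (x :+ u) := (Q :- con 1ℚ) :* p :* x :+ ((p :* Q) :* u :- p :* u)) refl Q p [ m ] (p ^ℚ m) ⟩
    (Q - 1ℚ) * p * [ m ] + ((p * Q) * p ^ℚ m - p * p ^ℚ m)
      ≡⟨ cong₂ (λ x y → x + (y * p ^ℚ m - p * p ^ℚ m)) (geometric m) pQ≡1 ⟩
    (1ℚ - p ^ℚ m) + (1ℚ * p ^ℚ m - p * p ^ℚ m)            ≡⟨ solve 2 (λ p u → (con 1ℚ :- u) :+ (con 1ℚ :* u :- p :* u) := con 1ℚ :- p :* u) refl p (p ^ℚ m) ⟩
    1ℚ - p ^ℚ (suc m)                                     ∎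
    where open ℚSolver.+-*-Solver

  -- The right-hand side of the theorem for n = m, with h for the sum. Writing the power of q as
  -- q^(km) / q^(loss k) keeps it meaningful when m ≤ k, which happens in the first blocks, and
  -- makes its dependence on m multiplicative.
  value : ℕ → ℕ → ℚ → ℚ
  value k m h = (Q - 1ℚ) ^ℚ k * Q ^ℚ (k ℕ.* m) * p ^ℚ loss k * h

  value-+ : ∀ k m x y → value k m x + value k m y ≡ value k m (x + y)
  value-+ k m x y = sym (ℚP.*-distribˡ-+ ((Q - 1ℚ) ^ℚ k * Q ^ℚ (k ℕ.* m) * p ^ℚ loss k) x y)

  value-zero : ∀ k m → value k m 0ℚ ≡ 0ℚ
  value-zero k m = ℚP.*-zeroʳ ((Q - 1ℚ) ^ℚ k * Q ^ℚ (k ℕ.* m) * p ^ℚ loss k)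

  value-stay : ∀ k m l x → value k m x * Q ^ℚ (k ℕ.* l) ≡ value k (l ℕ.+ m) x
  value-stay k m l x = begin
    value k m x * Q ^ℚ (k ℕ.* l)
      ≡⟨ solve 5 (λ D a t x b → (((D ⊕ a) ⊕ t) ⊕ x) ⊕ b ⊜ ((D ⊕ (b ⊕ a)) ⊕ t) ⊕ x) refl
           ((Q - 1ℚ) ^ℚ k) (Q ^ℚ (k ℕ.* m)) (p ^ℚ loss k) x (Q ^ℚ (k ℕ.* l)) ⟩
    (Q - 1ℚ) ^ℚ k * (Q ^ℚ (k ℕ.* l) * Q ^ℚ (k ℕ.* m)) * p ^ℚ loss k * x
      ≡⟨ cong (λ y → (Q - 1ℚ) ^ℚ k * y * p ^ℚ loss k * x) (trans (cong (Q ^ℚ_) (ℕP.*-distribˡ-+ k l m)) (^-homo-* Q (k ℕ.* l) (k ℕ.* m))) ⟨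
    value k (l ℕ.+ m) x                                           ∎
    where open *-Solver

  -- Compared with q^((k+1)(i+1+m)), the i columns before the growth lack a factor q each, which
  -- gives p^i. The growing column lacks q^(k+1), and its own count brings one more p; these k + 2
  -- powers are the increment of `loss`.
  value-grow : ∀ k m i h off g → off * h ≡ (Q - 1ℚ) * p * Q ^ℚ m * g →
    value k m h * Q ^ℚ (k ℕ.* i) * off ≡ value (suc k) (suc i ℕ.+ m) (p ^ℚ i * g)
  value-grow k m i h off g e = begin
    (((D * a) * t) * h) * b * off                 ≡⟨ solve 6 (λ D a t h b off → (((((D ⊕ a) ⊕ t) ⊕ h) ⊕ b) ⊕ off) ⊜ (D ⊕ (a ⊕ (t ⊕ (b ⊕ (off ⊕ h)))))) refl D a t h b off ⟩
    D * (a * (t * (b * (off * h))))               ≡⟨ cong (λ y → D * (a * (t * (b * y)))) e ⟩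
    D * (a * (t * (b * (D₁ * p * c * g))))        ≡⟨ solve 8 (λ D a t b D₁ p c g → (D ⊕ (a ⊕ (t ⊕ (b ⊕ (((D₁ ⊕ p) ⊕ c) ⊕ g))))) ⊜ ((D₁ ⊕ D) ⊕ ((((b ⊕ a) ⊕ c) ⊕ (p ⊕ t)) ⊕ g))) refl D a t b D₁ p c g ⟩
    (D₁ * D) * ((((b * a) * c) * (p * t)) * g)    ≡⟨ trans (cong₂ (λ x y → (D₁ * D) * ((((b * a) * c) * (p * t)) * g) * (x * y)) (p^Q^≡1 (suc k)) (p^Q^≡1 i)) (ℚP.*-identityʳ _) ⟨
    (D₁ * D) * ((((b * a) * c) * (p * t)) * g) * ((u * w) * (v * d))
      ≡⟨ solve 12 (λ D₁ D b a c p t g u w v → λ d → (((D₁ ⊕ D) ⊕ ((((b ⊕ a) ⊕ c) ⊕ (p ⊕ t)) ⊕ g)) ⊕ ((u ⊕ w) ⊕ (v ⊕ d)))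
           ⊜ ((((D₁ ⊕ D) ⊕ (w ⊕ ((d ⊕ b) ⊕ (c ⊕ a)))) ⊕ ((p ⊕ u) ⊕ t)) ⊕ (v ⊕ g))) refl D₁ D b a c p t g u w v d ⟩
    ((D₁ * D) * (w * ((d * b) * (c * a)))) * ((p * u) * t) * (v * g)
      ≡⟨ cong₂ (λ x y → (D₁ * D) * x * y * (v * g)) Q-power (^-homo-* p (suc (suc k)) (loss k)) ⟨
    value (suc k) (suc i ℕ.+ m) (p ^ℚ i * g)      ∎
    where
    open *-Solver
    D₁ = Q - 1ℚ
    D = (Q - 1ℚ) ^ℚ k
    a = Q ^ℚ (k ℕ.* m)
    b = Q ^ℚ (k ℕ.* i)
    c = Q ^ℚ m
    d = Q ^ℚ i
    t = p ^ℚ loss k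
    u = p ^ℚ suc k
    w = Q ^ℚ suc k
    v = p ^ℚ i
    Q-power : Q ^ℚ (suc k ℕ.* (suc i ℕ.+ m)) ≡ w * ((d * b) * (c * a))
    Q-power = begin
      Q ^ℚ (suc k ℕ.* (suc i ℕ.+ m))                         ≡⟨ cong (Q ^ℚ_) (trans (ℕP.*-suc (suc k) (i ℕ.+ m)) (cong (suc k ℕ.+_) (ℕP.*-distribˡ-+ (suc k) i m))) ⟩
      Q ^ℚ (suc k ℕ.+ (suc k ℕ.* i ℕ.+ suc k ℕ.* m))         ≡⟨ ^-homo-* Q (suc k) _ ⟩
      w * Q ^ℚ (suc k ℕ.* i ℕ.+ suc k ℕ.* m)                 ≡⟨ cong (w *_) (^-homo-* Q (suc k ℕ.* i) (suc k ℕ.* m)) ⟩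
      w * (Q ^ℚ (suc k ℕ.* i) * Q ^ℚ (suc k ℕ.* m))          ≡⟨ cong (w *_) (cong₂ _*_ (^-homo-* Q i (k ℕ.* i)) (^-homo-* Q m (k ℕ.* m))) ⟩
      w * ((d * b) * (c * a))                                ∎

  value-prefactor : ∀ r k h → value k (r ℕ.+ suc k) h ≡
    ℕ→ℚ ((q ∸ 1) ℕ.^ k ℕ.* q ℕ.^ ((r ℕ.+ suc k) C 2 ∸ ((r ℕ.+ suc k) ∸ k) C 2 ∸ k)) * h
  value-prefactor r k h = cong (_* h) (sym (begin
    ℕ→ℚ ((q ∸ 1) ℕ.^ k ℕ.* q ℕ.^ ((r ℕ.+ suc k) C 2 ∸ ((r ℕ.+ suc k) ∸ k) C 2 ∸ k))
      ≡⟨ cong (λ x → ℕ→ℚ ((q ∸ 1) ℕ.^ k ℕ.* q ℕ.^ x)) (exponent r k) ⟩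
    ℕ→ℚ ((q ∸ 1) ℕ.^ k ℕ.* q ℕ.^ E)                        ≡⟨ ℕ→ℚ-* ((q ∸ 1) ℕ.^ k) (q ℕ.^ E) ⟩
    ℕ→ℚ ((q ∸ 1) ℕ.^ k) * ℕ→ℚ (q ℕ.^ E)                    ≡⟨ cong₂ _*_ (trans (ℕ→ℚ-^ (q ∸ 1) k) (cong (_^ℚ k) (ℕ→ℚ-∸ q 1 (ℕ.>-nonZero⁻¹ q)))) (ℕ→ℚ-^ q E) ⟩
    (Q - 1ℚ) ^ℚ k * Q ^ℚ E                                 ≡⟨ cong ((Q - 1ℚ) ^ℚ k *_) (trans (cong (Q ^ℚ E *_) (trans (ℚP.*-comm (Q ^ℚ loss k) _) (p^Q^≡1 (loss k)))) (ℚP.*-identityʳ _)) ⟨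
    (Q - 1ℚ) ^ℚ k * (Q ^ℚ E * (Q ^ℚ loss k * p ^ℚ loss k))  ≡⟨ solve 4 (λ D x y t → (D ⊕ (x ⊕ (y ⊕ t))) ⊜ ((D ⊕ (x ⊕ y)) ⊕ t)) refl ((Q - 1ℚ) ^ℚ k) (Q ^ℚ E) (Q ^ℚ loss k) (p ^ℚ loss k) ⟩
    (Q - 1ℚ) ^ℚ k * (Q ^ℚ E * Q ^ℚ loss k) * p ^ℚ loss k    ≡⟨ cong (λ y → (Q - 1ℚ) ^ℚ k * y * p ^ℚ loss k) (trans (sym (^-homo-* Q E (loss k))) (cong (Q ^ℚ_) (exponent+loss r k))) ⟩
    (Q - 1ℚ) ^ℚ k * Q ^ℚ (k ℕ.* (r ℕ.+ suc k)) * p ^ℚ loss k ∎))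
    where
    open *-Solver
    E = k ℕ.* r ℕ.+ tri k

-- The recursion in the parts

blockOf-first : ∀ x xs i → i < x → blockOf (x ∷ xs) i ≡ 0
blockOf-first x xs i i<x = none (x ∷ map (x ℕ.+_) (partialSums xs))
  (ℕP.≤-refl ∷ AllP.map⁺ (All.universal (λ c → ℕP.m≤m+n x c) (partialSums xs)))
  where
  none : ∀ cs → All (x ≤_) cs → length (filterᵇ (_≤ᵇ i) cs) ≡ 0
  none [] [] = refl
  none (c ∷ cs) (x≤c ∷ h) with c ≤ᵇ i in eq
  ... | true = ⊥-elim (ℕP.<⇒≱ (ℕP.<-≤-trans i<x x≤c) (ℕP.≤ᵇ⇒≤ c i (subst Bool.T (sym eq) tt)))
  ... | false = none cs h

blockOf-shift : ∀ x xs d → blockOf (x ∷ xs) (x ℕ.+ d) ≡ suc (blockOf xs d)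
blockOf-shift x xs d with x ≤ᵇ x ℕ.+ d in eq
... | false = ⊥-elim (subst Bool.T eq (ℕP.≤⇒≤ᵇ (ℕP.m≤m+n x d)))
... | true = cong suc (shifted (partialSums xs))
  where
  shifted : ∀ cs → length (filterᵇ (_≤ᵇ x ℕ.+ d) (map (x ℕ.+_) cs)) ≡ length (filterᵇ (_≤ᵇ d) cs)
  shifted [] = refl
  shifted (c ∷ cs) with x ℕ.+ c ≤ᵇ x ℕ.+ d in e₁ | c ≤ᵇ d in e₂
  ... | true | true = cong suc (shifted cs)
  ... | false | false = shifted cs
  ... | true | false = ⊥-elim (subst Bool.T e₂ (ℕP.≤⇒≤ᵇ (ℕP.+-cancelˡ-≤ x c d (ℕP.≤ᵇ⇒≤ _ _ (subst Bool.T (sym e₁) tt)))))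
  ... | false | true = ⊥-elim (subst Bool.T e₁ (ℕP.≤⇒≤ᵇ (ℕP.+-monoʳ-≤ x (ℕP.≤ᵇ⇒≤ c d (subst Bool.T (sym e₂) tt)))))

blockOf-mono : ∀ xs {i j} → i ≤ j → blockOf xs i ≤ blockOf xs j
blockOf-mono xs {i} {j} i≤j = go (partialSums xs)
  where
  go : ∀ cs → length (filterᵇ (_≤ᵇ i) cs) ≤ length (filterᵇ (_≤ᵇ j) cs)
  go [] = z≤n
  go (c ∷ cs) with c ≤ᵇ i in e₁ | c ≤ᵇ j in e₂
  ... | true | true = s≤s (go cs)
  ... | false | false = go cs
  ... | false | true = ℕP.m≤n⇒m≤1+n (go cs)
  ... | true | false = ⊥-elim (subst Bool.T e₂ (ℕP.≤⇒≤ᵇ (ℕP.≤-trans (ℕP.≤ᵇ⇒≤ c i (subst Bool.T (sym e₁) tt)) i≤j)))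

blockOf-start : ∀ pre l rest i → i < l → ∀ t →
  (blockOf (pre ++ l ∷ rest) (i ℕ.+ sum pre) ≤ blockOf (pre ++ l ∷ rest) t) ⇔ (sum pre ≤ t)
blockOf-start [] l rest i i<l t = mk⇔ (λ _ → z≤n) λ _ →
  subst (_≤ blockOf (l ∷ rest) t) (sym (blockOf-first l rest (i ℕ.+ 0) (subst (_< l) (sym (ℕP.+-identityʳ i)) i<l))) z≤n
blockOf-start (x ∷ pre) l rest i i<l t = mk⇔ to from
  where
  λs = pre ++ l ∷ rest
  IH = blockOf-start pre l rest i i<l
  start≡ : blockOf (x ∷ λs) (i ℕ.+ (x ℕ.+ sum pre)) ≡ suc (blockOf λs (i ℕ.+ sum pre))
  start≡ = trans (cong (blockOf (x ∷ λs)) (trans (sym (ℕP.+-assoc i x _)) (trans (cong (ℕ._+ sum pre) (ℕP.+-comm i x)) (ℕP.+-assoc x i _))))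
             (blockOf-shift x λs (i ℕ.+ sum pre))
  to : blockOf (x ∷ λs) (i ℕ.+ (x ℕ.+ sum pre)) ≤ blockOf (x ∷ λs) t → x ℕ.+ sum pre ≤ t
  to le with x ℕP.≤? t
  ... | no x≰t = ⊥-elim (ℕP.n≮0 (subst₂ _≤_ start≡ (blockOf-first x λs t (ℕP.≰⇒> x≰t)) le))
  ... | yes x≤t with ℕP.m≤n⇒∃[o]m+o≡n x≤t
  ... | d , refl = ℕP.+-monoʳ-≤ x (Equivalence.to (IH d) (ℕP.≤-pred (subst₂ _≤_ start≡ (blockOf-shift x λs d) le)))
  from : x ℕ.+ sum pre ≤ t → blockOf (x ∷ λs) (i ℕ.+ (x ℕ.+ sum pre)) ≤ blockOf (x ∷ λs) t
  from le with ℕP.m≤n⇒∃[o]m+o≡n (ℕP.≤-trans (ℕP.m≤m+n x (sum pre)) le)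
  ... | d , refl = subst₂ _≤_ (sym start≡) (sym (blockOf-shift x λs d))
                     (s≤s (Equivalence.from (IH d) (ℕP.+-cancelˡ-≤ x _ _ le)))

module Recursion (q : ℕ) .{{_ : NonZero q}} where

  open Formula q public

  elementary : ℕ → List ℕ → ℚ
  elementary zero    _        = 1ℚ
  elementary (suc k) []       = 0ℚ
  elementary (suc k) (l ∷ ls) = [ l ] * elementary k ls + elementary (suc k) ls

  -- The sum of the theorem for subsets of size k + 1 of the parts ls, preceded by parts of total size m.
  hookSum : ℕ → ℕ → List ℕ → ℚ
  hookSum k m []       = 0ℚ
  hookSum k m (l ∷ ls) = [ m ] * ([ l ] * elementary k ls) + hookSum k (m ℕ.+ l) ls

  -- The sums unfold from the first part, as the minimum in the theorem demands, whereas the count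
  -- appends parts at the end. A subset either avoids the last part or contains it.
  elementary-∷ʳ : ∀ k ls l → elementary (suc k) (ls ∷ʳ l) ≡ elementary (suc k) ls + [ l ] * elementary k ls
  elementary-∷ʳ zero [] l = ℚP.+-comm ([ l ] * 1ℚ) 0ℚ
  elementary-∷ʳ (suc k) [] l = ℚP.+-comm ([ l ] * 0ℚ) 0ℚ
  elementary-∷ʳ zero (x ∷ ls) l = trans (cong ([ x ] * 1ℚ +_) (elementary-∷ʳ zero ls l)) (sym (ℚP.+-assoc ([ x ] * 1ℚ) (elementary 1 ls) ([ l ] * 1ℚ)))
  elementary-∷ʳ (suc k) (x ∷ ls) l = begin
    [ x ] * elementary (suc k) (ls ∷ʳ l) + elementary (suc (suc k)) (ls ∷ʳ l)
      ≡⟨ cong₂ (λ a b → [ x ] * a + b) (elementary-∷ʳ k ls l) (elementary-∷ʳ (suc k) ls l) ⟩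
    [ x ] * (elementary (suc k) ls + [ l ] * elementary k ls) + (elementary (suc (suc k)) ls + [ l ] * elementary (suc k) ls)
      ≡⟨ solve 5 (λ x l a b c → x :* (b :+ l :* a) :+ (c :+ l :* b) := (x :* b :+ c) :+ l :* (x :* a :+ b)) refl
           [ x ] [ l ] (elementary k ls) (elementary (suc k) ls) (elementary (suc (suc k)) ls) ⟩
    elementary (suc (suc k)) (x ∷ ls) + [ l ] * elementary (suc k) (x ∷ ls) ∎
    where open ℚSolver.+-*-Solver

  -- The one-element subset made of the new part has this part as its minimum and carries the total
  -- of everything before it. In larger subsets the minimum lies among the earlier parts, so the
  -- recursion keeps `hookSum`.
  hookSum-∷ʳ-zero : ∀ m ls l → hookSum 0 m (ls ∷ʳ l) ≡ hookSum 0 m ls + [ l ] * [ m ℕ.+ sum ls ]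
  hookSum-∷ʳ-zero m [] l = begin
    [ m ] * ([ l ] * 1ℚ) + 0ℚ         ≡⟨ solve 2 (λ m l → m :* (l :* con 1ℚ) :+ con 0ℚ := con 0ℚ :+ l :* m) refl [ m ] [ l ] ⟩
    0ℚ + [ l ] * [ m ]                ≡⟨ cong (λ n → 0ℚ + [ l ] * [ n ]) (ℕP.+-identityʳ m) ⟨
    0ℚ + [ l ] * [ m ℕ.+ 0 ]          ∎
    where open ℚSolver.+-*-Solver
  hookSum-∷ʳ-zero m (x ∷ ls) l = trans (cong ([ m ] * ([ x ] * 1ℚ) +_) (trans (hookSum-∷ʳ-zero (m ℕ.+ x) ls l)
    (cong (λ n → hookSum 0 (m ℕ.+ x) ls + [ l ] * [ n ]) (ℕP.+-assoc m x (sum ls)))))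
    (sym (ℚP.+-assoc ([ m ] * ([ x ] * 1ℚ)) (hookSum 0 (m ℕ.+ x) ls) ([ l ] * [ m ℕ.+ sum (x ∷ ls) ])))

  hookSum-∷ʳ-suc : ∀ k m ls l → hookSum (suc k) m (ls ∷ʳ l) ≡ hookSum (suc k) m ls + [ l ] * hookSum k m ls
  hookSum-∷ʳ-suc k m [] l =
    solve 2 (λ m l → m :* (l :* con 0ℚ) :+ con 0ℚ := con 0ℚ :+ l :* con 0ℚ) refl [ m ] [ l ]
    where open ℚSolver.+-*-Solver
  hookSum-∷ʳ-suc k m (x ∷ ls) l = begin
    [ m ] * ([ x ] * elementary (suc k) (ls ∷ʳ l)) + hookSum (suc k) (m ℕ.+ x) (ls ∷ʳ l)
      ≡⟨ cong₂ (λ a b → [ m ] * ([ x ] * a) + b) (elementary-∷ʳ k ls l) (hookSum-∷ʳ-suc k (m ℕ.+ x) ls l) ⟩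
    [ m ] * ([ x ] * (b + [ l ] * a)) + (d + [ l ] * c)
      ≡⟨ solve 7 (λ m x l a b c d → m :* (x :* (b :+ l :* a)) :+ (d :+ l :* c) := (m :* (x :* b) :+ d) :+ l :* (m :* (x :* a) :+ c))
           refl [ m ] [ x ] [ l ] a b c d ⟩
    hookSum (suc k) m (x ∷ ls) + [ l ] * hookSum k m (x ∷ ls) ∎
    where
    open ℚSolver.+-*-Solver
    a = elementary k ls
    b = elementary (suc k) ls
    c = hookSum k (m ℕ.+ x) ls
    d = hookSum (suc k) (m ℕ.+ x) ls

  coefficient : ℕ → List ℕ → ℚ
  coefficient zero    ls = 1ℚ
  coefficient (suc k) ls = hookSum k 0 ls

  -- The factor by which [ l ] is multiplied when a part l is appended.
  growth : ℕ → List ℕ → ℚ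
  growth zero    ls = [ sum ls ]
  growth (suc k) ls = hookSum k 0 ls

  coefficient-∷ʳ : ∀ k ls l → coefficient (suc k) (ls ∷ʳ l) ≡ coefficient (suc k) ls + [ l ] * growth k ls
  coefficient-∷ʳ zero ls l = hookSum-∷ʳ-zero 0 ls l
  coefficient-∷ʳ (suc k) ls l = hookSum-∷ʳ-suc k 0 ls l

  module _ (ls : List ℕ) (zero-case : sum ls ≡ 0 → ∀ k → hookSum k 0 ls ≡ 0ℚ)
           (N : ℕ → ℕ) (N≡ : ∀ k → ℕ→ℚ (N k) ≡ value k (sum ls) (coefficient k ls)) where

    private
      m = sum ls

    -- For k = 0 this is the geometric sum for q^m - 1. For k > 0 it is q^m - q^(m-1) = (q-1) q^(-1)
    -- q^m, which needs m > 0; before the first block, at m = 0, both sides vanish with `hookSum`.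
    offKernel-value : ∀ k → ℕ→ℚ (offKernel q m k) * coefficient k ls ≡ (Q - 1ℚ) * p * Q ^ℚ m * growth k ls
    offKernel-value zero = begin
      ℕ→ℚ (q ℕ.^ m ∸ 1) * 1ℚ                    ≡⟨ ℚP.*-identityʳ _ ⟩
      ℕ→ℚ (q ℕ.^ m ∸ 1)                         ≡⟨ ℕ→ℚ-∸ (q ℕ.^ m) 1 (ℕP.m^n>0 q m) ⟩
      ℕ→ℚ (q ℕ.^ m) - 1ℚ                        ≡⟨ cong₂ _-_ (ℕ→ℚ-^ q m) (sym (p^Q^≡1 m)) ⟩
      Q ^ℚ m - p ^ℚ m * Q ^ℚ m                  ≡⟨ solve 2 (λ x y → y :- x :* y := (con 1ℚ :- x) :* y) refl (p ^ℚ m) (Q ^ℚ m) ⟩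
      (1ℚ - p ^ℚ m) * Q ^ℚ m                    ≡⟨ cong (_* Q ^ℚ m) (geometric m) ⟨
      (Q - 1ℚ) * p * [ m ] * Q ^ℚ m             ≡⟨ solve 3 (λ a b c → a :* b :* c := a :* c :* b) refl ((Q - 1ℚ) * p) [ m ] (Q ^ℚ m) ⟩
      (Q - 1ℚ) * p * Q ^ℚ m * [ m ]             ∎
      where open ℚSolver.+-*-Solver
    offKernel-value (suc k) = positive m refl
      where
      open ℚSolver.+-*-Solver
      positive : ∀ m → sum ls ≡ m → ℕ→ℚ (offKernel q m (suc k)) * hookSum k 0 ls ≡ (Q - 1ℚ) * p * Q ^ℚ m * hookSum k 0 ls
      positive zero eq = trans (cong (ℕ→ℚ (offKernel q 0 (suc k)) *_) (zero-case eq k)) (trans (ℚP.*-zeroʳ (ℕ→ℚ (offKernel q 0 (suc k))))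
        (sym (trans (cong ((Q - 1ℚ) * p * Q ^ℚ 0 *_) (zero-case eq k)) (ℚP.*-zeroʳ ((Q - 1ℚ) * p * Q ^ℚ 0)))))
      positive (suc m′) _ = cong (_* hookSum k 0 ls) (begin
        ℕ→ℚ (q ℕ.^ suc m′ ∸ q ℕ.^ m′)             ≡⟨ ℕ→ℚ-∸ (q ℕ.^ suc m′) (q ℕ.^ m′) (ℕP.^-monoʳ-≤ q (ℕP.n≤1+n m′)) ⟩
        ℕ→ℚ (q ℕ.^ suc m′) - ℕ→ℚ (q ℕ.^ m′)       ≡⟨ cong₂ _-_ (ℕ→ℚ-^ q (suc m′)) (ℕ→ℚ-^ q m′) ⟩
        Q * Q ^ℚ m′ - Q ^ℚ m′                     ≡⟨ solve 2 (λ Q x → Q :* x :- x := (Q :- con 1ℚ) :* (con 1ℚ :* x)) refl Q (Q ^ℚ m′) ⟩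
        (Q - 1ℚ) * (1ℚ * Q ^ℚ m′)                 ≡⟨ cong (λ y → (Q - 1ℚ) * (y * Q ^ℚ m′)) pQ≡1 ⟨
        (Q - 1ℚ) * (p * Q * Q ^ℚ m′)              ≡⟨ solve 4 (λ D p Q x → D :* (p :* Q :* x) := D :* p :* (Q :* x)) refl (Q - 1ℚ) p Q (Q ^ℚ m′) ⟩
        (Q - 1ℚ) * p * (Q * Q ^ℚ m′)              ∎)

    stay-value : ∀ k i → ℕ→ℚ (N k ℕ.* (q ℕ.^ k) ℕ.^ i) ≡ value k m (coefficient k ls) * Q ^ℚ (k ℕ.* i)
    stay-value k i = trans (ℕ→ℚ-* (N k) _) (cong₂ _*_ (N≡ k)
      (trans (cong ℕ→ℚ (ℕP.^-*-assoc q k i)) (ℕ→ℚ-^ q (k ℕ.* i))))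

    -- Growth in the last of i + 1 columns contributes p^i and turns `[ i ]` into `[ suc i ]`; after
    -- an earlier growth the last column only brings the factor q^(k+1).
    grown-value : ∀ k i → ℕ→ℚ (grownCount q m N (suc k) i) ≡ value (suc k) (i ℕ.+ m) ([ i ] * growth k ls)
    grown-value k zero = sym (trans (cong (value (suc k) m) (ℚP.*-zeroˡ (growth k ls))) (value-zero (suc k) m))
    grown-value k (suc i) = begin
      ℕ→ℚ (G ℕ.* q ℕ.^ suc k ℕ.+ S ℕ.* offKernel q m k)
        ≡⟨ trans (ℕ→ℚ-+ (G ℕ.* q ℕ.^ suc k) (S ℕ.* offKernel q m k)) (cong₂ _+_ (ℕ→ℚ-* G (q ℕ.^ suc k)) (ℕ→ℚ-* S (offKernel q m k))) ⟩
      ℕ→ℚ G * ℕ→ℚ (q ℕ.^ suc k) + ℕ→ℚ S * ℕ→ℚ (offKernel q m k)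
        ≡⟨ cong₂ _+_ (cong₂ _*_ (grown-value k i) (trans (ℕ→ℚ-^ q (suc k)) (cong (Q ^ℚ_) (sym (ℕP.*-identityʳ (suc k))))))
                     (cong (_* ℕ→ℚ (offKernel q m k)) (stay-value k i)) ⟩
      value (suc k) (i ℕ.+ m) ([ i ] * g) * Q ^ℚ (suc k ℕ.* 1) + value k m (coefficient k ls) * Q ^ℚ (k ℕ.* i) * ℕ→ℚ (offKernel q m k)
        ≡⟨ cong₂ _+_ (value-stay (suc k) (i ℕ.+ m) 1 ([ i ] * g)) (value-grow k m i _ _ g (offKernel-value k)) ⟩
      value (suc k) (suc i ℕ.+ m) ([ i ] * g) + value (suc k) (suc i ℕ.+ m) (p ^ℚ i * g)
        ≡⟨ value-+ (suc k) (suc i ℕ.+ m) _ _ ⟩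
      value (suc k) (suc i ℕ.+ m) ([ i ] * g + p ^ℚ i * g)
        ≡⟨ cong (value (suc k) (suc i ℕ.+ m)) (trans (sym (ℚP.*-distribʳ-+ g [ i ] (p ^ℚ i))) (cong (_* g) (sym ([suc] i)))) ⟩
      value (suc k) (suc i ℕ.+ m) ([ suc i ] * g) ∎
      where
      G = grownCount q m N (suc k) i
      S = N k ℕ.* (q ℕ.^ k) ℕ.^ i
      g = growth k ls

    block-value : ∀ k l → ℕ→ℚ (N k ℕ.* (q ℕ.^ k) ℕ.^ l ℕ.+ grownCount q m N k l) ≡ value k (l ℕ.+ m) (coefficient k (ls ∷ʳ l))
    block-value zero l = trans (cong ℕ→ℚ (ℕP.+-identityʳ (N 0 ℕ.* 1 ℕ.^ l))) (trans (stay-value 0 l) (value-stay 0 m l 1ℚ))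
    block-value (suc k) l = begin
      ℕ→ℚ (S ℕ.+ grownCount q m N (suc k) l)       ≡⟨ ℕ→ℚ-+ S _ ⟩
      ℕ→ℚ S + ℕ→ℚ (grownCount q m N (suc k) l)     ≡⟨ cong₂ _+_ (trans (stay-value (suc k) l) (value-stay (suc k) m l _)) (grown-value k l) ⟩
      value (suc k) (l ℕ.+ m) (coefficient (suc k) ls) + value (suc k) (l ℕ.+ m) ([ l ] * growth k ls)
        ≡⟨ trans (value-+ (suc k) (l ℕ.+ m) _ _) (cong (value (suc k) (l ℕ.+ m)) (sym (coefficient-∷ʳ k ls l))) ⟩
      value (suc k) (l ℕ.+ m) (coefficient (suc k) (ls ∷ʳ l)) ∎
      where S = N (suc k) ℕ.* (q ℕ.^ suc k) ℕ.^ l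

-- Sums over subsets

filterᵇ-++ : ∀ {X : Set} (P : X → Bool) xs ys → filterᵇ P (xs ++ ys) ≡ filterᵇ P xs ++ filterᵇ P ys
filterᵇ-++ P [] ys = refl
filterᵇ-++ P (x ∷ xs) ys with P x
... | true = cong (x ∷_) (filterᵇ-++ P xs ys)
... | false = filterᵇ-++ P xs ys

filterᵇ-map : ∀ {X Y : Set} (P : Y → Bool) (f : X → Y) xs → filterᵇ P (map f xs) ≡ map f (filterᵇ (λ x → P (f x)) xs)
filterᵇ-map P f [] = refl
filterᵇ-map P f (x ∷ xs) with P (f x)
... | true = cong (f x ∷_) (filterᵇ-map P f xs)
... | false = filterᵇ-map P f xs

filterᵇ-cong : ∀ {X : Set} (P R : X → Bool) {xs} → All (λ x → P x ≡ R x) xs → filterᵇ P xs ≡ filterᵇ R xs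
filterᵇ-cong P R [] = refl
filterᵇ-cong P R {x ∷ xs} (e ∷ es) with P x | R x
... | true | true = cong (x ∷_) (filterᵇ-cong P R es)
... | false | false = filterᵇ-cong P R es
filterᵇ-cong P R {x ∷ xs} (() ∷ es) | true | false
filterᵇ-cong P R {x ∷ xs} (() ∷ es) | false | true

filterᵇ-none : ∀ {X : Set} (xs : List X) → filterᵇ (λ _ → false) xs ≡ []
filterᵇ-none [] = refl
filterᵇ-none (x ∷ xs) = filterᵇ-none xs

sumℚ-++ : ∀ xs ys → sumℚ (xs ++ ys) ≡ sumℚ xs + sumℚ ys
sumℚ-++ [] ys = sym (ℚP.+-identityˡ _)
sumℚ-++ (x ∷ xs) ys = trans (cong (x +_) (sumℚ-++ xs ys)) (sym (ℚP.+-assoc x _ _))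

sumℚ-map-* : ∀ {X : Set} c (f : X → ℚ) xs → sumℚ (map (λ x → c * f x) xs) ≡ c * sumℚ (map f xs)
sumℚ-map-* c f [] = sym (ℚP.*-zeroʳ c)
sumℚ-map-* c f (x ∷ xs) = trans (cong (c * f x +_) (sumℚ-map-* c f xs)) (sym (ℚP.*-distribˡ-+ c _ _))

sumℚ-map-cong : ∀ {X : Set} (f g : X → ℚ) {xs} → All (λ x → f x ≡ g x) xs → sumℚ (map f xs) ≡ sumℚ (map g xs)
sumℚ-map-cong f g [] = refl
sumℚ-map-cong f g (e ∷ es) = cong₂ _+_ e (sumℚ-map-cong f g es)

upFrom : ℕ → ℕ → List ℕ
upFrom a zero    = []
upFrom a (suc t) = a ∷ upFrom (suc a) t

applyUpTo≡upFrom : ∀ f a t → (∀ i → f i ≡ a ℕ.+ i) → applyUpTo f t ≡ upFrom a t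
applyUpTo≡upFrom f a zero h = refl
applyUpTo≡upFrom f a (suc t) h = cong₂ _∷_ (trans (h 0) (ℕP.+-identityʳ a))
  (applyUpTo≡upFrom (λ i → f (suc i)) (suc a) t λ i → trans (h (suc i)) (ℕP.+-suc a i))

upFrom-≥ : ∀ {b} a t → b ≤ a → All (b ≤_) (upFrom a t)
upFrom-≥ a zero b≤a = []
upFrom-≥ a (suc t) b≤a = b≤a ∷ upFrom-≥ (suc a) t (ℕP.m≤n⇒m≤1+n b≤a)

subsets-All : ∀ {P : ℕ → Set} {xs} → All P xs → All (All P) (subsets xs)
subsets-All [] = [] ∷ []
subsets-All (p ∷ ps) = AllP.++⁺ (AllP.map⁺ (All.map (p ∷_) (subsets-All ps))) (subsets-All ps)

listMin-head : ∀ a A → All (a ≤_) A → listMin a A ≡ a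
listMin-head a [] [] = refl
listMin-head a (x ∷ A) (a≤x ∷ h) = trans (cong (λ m → listMin m A) (ℕP.m≤n⇒m⊓n≡m a≤x)) (listMin-head a A h)

listMin-≥ : ∀ b x A → b ≤ x → All (b ≤_) A → b ≤ listMin x A
listMin-≥ b x [] b≤x [] = b≤x
listMin-≥ b x (y ∷ A) b≤x (b≤y ∷ h) = listMin-≥ b (x ⊓ y) A (ℕP.⊓-glb b≤x b≤y) h

≢⇒≡ᵇ-false : ∀ m n → m ≢ n → (m ≡ᵇ n) ≡ false
≢⇒≡ᵇ-false m n m≢n = Bool-ext (λ t → m≢n (ℕP.≡ᵇ⇒≡ m n t)) λ ()

≡ᵇ-refl : ∀ n → (n ≡ᵇ n) ≡ true
≡ᵇ-refl n = Bool-ext (λ _ → tt) (λ _ → ℕP.≡⇒≡ᵇ n n refl)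

minIsᵇ-< : ∀ A j → All (suc j ≤_) A → minIsᵇ A j ≡ false
minIsᵇ-< [] j [] = refl
minIsᵇ-< (x ∷ A) j (j<x ∷ h) = ≢⇒≡ᵇ-false _ j λ e → ℕP.<-irrefl (sym e) (listMin-≥ (suc j) x A j<x h)

length≤sum : ∀ {ls} → All (λ x → x ≥ 1) ls → length ls ≤ sum ls
length≤sum [] = z≤n
length≤sum (x≥1 ∷ h) = ℕP.+-mono-≤ x≥1 (length≤sum h)

module SubsetSums (q : ℕ) .{{_ : NonZero q}} where

  open Recursion q public

  elementary-vanishes : ∀ k ls → length ls < k → elementary k ls ≡ 0ℚ
  elementary-vanishes (suc k) [] _ = refl
  elementary-vanishes (suc k) (l ∷ ls) (s≤s lt) = trans
    (cong₂ (λ a b → [ l ] * a + b) (elementary-vanishes k ls lt) (elementary-vanishes (suc k) ls (ℕP.m≤n⇒m≤1+n lt)))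
    (trans (ℚP.+-identityʳ _) (ℚP.*-zeroʳ [ l ]))

  -- Too few parts remain for a subset of size k + 1. This accounts for the minima j beyond the
  -- range of the theorem, which `hookSum` still runs through.
  hookSum-vanishes : ∀ k m ls → length ls ≤ k → hookSum k m ls ≡ 0ℚ
  hookSum-vanishes k m [] _ = refl
  hookSum-vanishes k m (l ∷ ls) lt = trans
    (cong₂ (λ a b → [ m ] * ([ l ] * a) + b) (elementary-vanishes k ls lt) (hookSum-vanishes k (m ℕ.+ l) ls (ℕP.<⇒≤ lt)))
    (trans (ℚP.+-identityʳ _) (trans (cong ([ m ] *_) (ℚP.*-zeroʳ [ l ])) (ℚP.*-zeroʳ [ m ])))

  module _ (v : ℕ → ℚ) where

    weight : (List ℕ → Bool) → List (List ℕ) → ℚ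
    weight P As = sumℚ (map (λ A → prodℚ (map v A)) (filterᵇ P As))

    weight-∷ : ∀ P a As → weight P (map (a ∷_) As ++ As) ≡ v a * weight (λ A → P (a ∷ A)) As + weight P As
    weight-∷ P a As = begin
      sumℚ (map Π (filterᵇ P (map (a ∷_) As ++ As)))                           ≡⟨ cong (λ Bs → sumℚ (map Π Bs)) (filterᵇ-++ P (map (a ∷_) As) As) ⟩
      sumℚ (map Π (filterᵇ P (map (a ∷_) As) ++ filterᵇ P As))                 ≡⟨ cong sumℚ (ListP.map-++ Π (filterᵇ P (map (a ∷_) As)) (filterᵇ P As)) ⟩
      sumℚ (map Π (filterᵇ P (map (a ∷_) As)) ++ map Π (filterᵇ P As))         ≡⟨ sumℚ-++ (map Π (filterᵇ P (map (a ∷_) As))) _ ⟩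
      sumℚ (map Π (filterᵇ P (map (a ∷_) As))) + weight P As
        ≡⟨ cong (λ Bs → sumℚ Bs + weight P As) (trans (cong (map Π) (filterᵇ-map P (a ∷_) As)) (sym (ListP.map-∘ (filterᵇ (λ A → P (a ∷ A)) As)))) ⟩
      sumℚ (map (λ A → v a * Π A) (filterᵇ (λ A → P (a ∷ A)) As)) + weight P As ≡⟨ cong (_+ weight P As) (sumℚ-map-* (v a) Π (filterᵇ (λ A → P (a ∷ A)) As)) ⟩
      v a * weight (λ A → P (a ∷ A)) As + weight P As                          ∎
      where
      Π : List ℕ → ℚ
      Π A = prodℚ (map v A)

    weight-cong : ∀ P R {As} → All (λ A → P A ≡ R A) As → weight P As ≡ weight R As
    weight-cong P R h = cong (λ Bs → sumℚ (map (λ A → prodℚ (map v A)) Bs)) (filterᵇ-cong P R h)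

    weight-none : ∀ P {As} → All (λ A → P A ≡ false) As → weight P As ≡ 0ℚ
    weight-none P {As} h = trans (weight-cong P (λ _ → false) h) (cong (λ Bs → sumℚ (map (λ A → prodℚ (map v A)) Bs)) (filterᵇ-none As))

    Parts : ℕ → List ℕ → Set
    Parts a ls = ∀ i → v (a ℕ.+ i) ≡ [ nth ls (suc i) ]

    Parts-head : ∀ {a l ls} → Parts a (l ∷ ls) → v a ≡ [ l ]
    Parts-head {a} h = trans (cong v (sym (ℕP.+-identityʳ a))) (h 0)

    Parts-tail : ∀ {a l ls} → Parts a (l ∷ ls) → Parts (suc a) ls
    Parts-tail {a} h i = trans (cong v (sym (ℕP.+-suc a i))) (h (suc i))

    weight-length : ∀ k a ls → Parts a ls →
      weight (λ A → length A ≡ᵇ k) (subsets (upFrom a (length ls))) ≡ elementary k ls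
    weight-length zero a [] _ = refl
    weight-length (suc k) a [] _ = refl
    weight-length zero a (l ∷ ls) h = trans (weight-∷ (λ A → length A ≡ᵇ 0) a As)
      (trans (cong₂ _+_ (trans (cong (v a *_) (weight-none _ (All.universal (λ _ → refl) As))) (ℚP.*-zeroʳ (v a)))
                        (weight-length zero (suc a) ls (Parts-tail {ls = ls} h))) (ℚP.+-identityˡ 1ℚ))
      where As = subsets (upFrom (suc a) (length ls))
    weight-length (suc k) a (l ∷ ls) h = trans (weight-∷ (λ A → length A ≡ᵇ suc k) a (subsets (upFrom (suc a) (length ls))))
      (cong₂ _+_ (cong₂ _*_ (Parts-head {ls = ls} h) (weight-length k (suc a) ls (Parts-tail {ls = ls} h)))
                 (weight-length (suc k) (suc a) ls (Parts-tail {ls = ls} h)))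

    hasMin : ℕ → ℕ → List ℕ → Bool
    hasMin k j A = (length A ≡ᵇ suc k) ∧ minIsᵇ A j

    subsets-≥ : ∀ a t → All (All (suc a ≤_)) (subsets (upFrom (suc a) t))
    subsets-≥ a t = subsets-All (upFrom-≥ (suc a) t ℕP.≤-refl)

    weight-min-head : ∀ k a l ls → Parts a (l ∷ ls) →
      weight (hasMin k a) (subsets (upFrom a (suc (length ls)))) ≡ [ l ] * elementary k ls
    weight-min-head k a l ls h = begin
      weight (hasMin k a) (map (a ∷_) As ++ As)                        ≡⟨ weight-∷ (hasMin k a) a As ⟩
      v a * weight (λ A → hasMin k a (a ∷ A)) As + weight (hasMin k a) As
        ≡⟨ cong₂ _+_ (cong₂ _*_ (Parts-head {ls = ls} h) (trans (weight-cong _ (λ A → length A ≡ᵇ k) (All.map with-a (subsets-≥ a (length ls))))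
                                                                (weight-length k (suc a) ls (Parts-tail {ls = ls} h))))
                     (weight-none (hasMin k a) (All.map without-a (subsets-≥ a (length ls)))) ⟩
      [ l ] * elementary k ls + 0ℚ                                     ≡⟨ ℚP.+-identityʳ _ ⟩
      [ l ] * elementary k ls                                          ∎
      where
      As = subsets (upFrom (suc a) (length ls))
      with-a : ∀ {A} → All (suc a ≤_) A → hasMin k a (a ∷ A) ≡ (length A ≡ᵇ k)
      with-a {A} a<A = trans (cong ((length A ≡ᵇ k) ∧_)
        (trans (cong (_≡ᵇ a) (listMin-head a A (All.map ℕP.<⇒≤ a<A))) (≡ᵇ-refl a))) (BoolP.∧-identityʳ _)
      without-a : ∀ {A} → All (suc a ≤_) A → hasMin k a A ≡ false
      without-a {A} a<A = trans (cong ((length A ≡ᵇ suc k) ∧_) (minIsᵇ-< A a a<A)) (BoolP.∧-zeroʳ _)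

    weight-min-tail : ∀ k j a t → a < j →
      weight (hasMin k j) (subsets (upFrom a (suc t))) ≡ weight (hasMin k j) (subsets (upFrom (suc a) t))
    weight-min-tail k j a t a<j = begin
      weight (hasMin k j) (map (a ∷_) As ++ As)                                ≡⟨ weight-∷ (hasMin k j) a As ⟩
      v a * weight (λ A → hasMin k j (a ∷ A)) As + weight (hasMin k j) As
        ≡⟨ cong (λ x → v a * x + weight (hasMin k j) As) (weight-none _ (All.map with-a (subsets-≥ a t))) ⟩
      v a * 0ℚ + weight (hasMin k j) As                                        ≡⟨ trans (cong (_+ weight (hasMin k j) As) (ℚP.*-zeroʳ (v a))) (ℚP.+-identityˡ _) ⟩
      weight (hasMin k j) As                                                   ∎
      where
      As = subsets (upFrom (suc a) t)
      with-a : ∀ {A} → All (suc a ≤_) A → hasMin k j (a ∷ A) ≡ false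
      with-a {A} a<A = trans (cong ((length A ≡ᵇ k) ∧_) (trans (cong (_≡ᵇ j) (listMin-head a A (All.map ℕP.<⇒≤ a<A)))
        (≢⇒≡ᵇ-false a j (ℕP.<⇒≢ a<j)))) (BoolP.∧-zeroʳ _)

    sum-over-minimum : ∀ (g : ℕ → ℚ) k a m ls → Parts a ls → (∀ i → g (a ℕ.+ i) ≡ [ m ℕ.+ sum (take i ls) ]) →
      sumℚ (map (λ j → g j * weight (hasMin k j) (subsets (upFrom a (length ls)))) (upFrom a (length ls ∸ k))) ≡ hookSum k m ls
    sum-over-minimum g k a m [] _ _ = cong (λ t → sumℚ (map (λ j → g j * weight (hasMin k j) ([] ∷ [])) (upFrom a t))) (ℕP.0∸n≡0 k)
    sum-over-minimum g k a m (l ∷ ls) hv hg with k ℕP.≤? length ls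
    ... | no k≰t = trans
          (cong (λ t → sumℚ (map (λ j → g j * weight (hasMin k j) (subsets (upFrom a (suc (length ls))))) (upFrom a t)))
            (ℕP.m≤n⇒m∸n≡0 (ℕP.≰⇒> k≰t)))
          (sym (hookSum-vanishes k m (l ∷ ls) (ℕP.≰⇒> k≰t)))
    ... | yes k≤t = begin
          sumℚ (map term (upFrom a (suc (length ls) ∸ k)))        ≡⟨ cong (λ t → sumℚ (map term (upFrom a t))) (ℕP.+-∸-assoc 1 k≤t) ⟩
          term a + sumℚ (map term (upFrom (suc a) (length ls ∸ k)))
            ≡⟨ cong₂ _+_ (cong₂ _*_ g-head (weight-min-head k a l ls hv))
                 (trans (sumℚ-map-cong term term′ (All.map (λ {j} a<j → cong (g j *_) (weight-min-tail k j a (length ls) a<j))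
                                                     (upFrom-≥ (suc a) (length ls ∸ k) ℕP.≤-refl)))
                        (sum-over-minimum g k (suc a) (m ℕ.+ l) ls (Parts-tail {ls = ls} hv) g-tail)) ⟩
          [ m ] * ([ l ] * elementary k ls) + hookSum k (m ℕ.+ l) ls ∎
      where
      term term′ : ℕ → ℚ
      term j = g j * weight (hasMin k j) (subsets (upFrom a (suc (length ls))))
      term′ j = g j * weight (hasMin k j) (subsets (upFrom (suc a) (length ls)))
      g-head : g a ≡ [ m ]
      g-head = trans (cong g (sym (ℕP.+-identityʳ a))) (trans (hg 0) (cong [_] (ℕP.+-identityʳ m)))
      g-tail : ∀ i → g (suc a ℕ.+ i) ≡ [ m ℕ.+ l ℕ.+ sum (take i ls) ]
      g-tail i = trans (cong g (sym (ℕP.+-suc a i))) (trans (hg (suc i)) (cong [_] (sym (ℕP.+-assoc m l _))))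

  hookRHS≡value : ∀ r k l ls →
    hookRHS q (r ℕ.+ suc (suc k)) (suc k) (l ∷ ls) ≡ value (suc k) (r ℕ.+ suc (suc k)) (hookSum k 0 (l ∷ ls))
  hookRHS≡value r k l ls = begin
    hookRHS q (r ℕ.+ suc (suc k)) (suc k) (l ∷ ls)
      ≡⟨ cong₂ (λ js is → prefactor * sumℚ (map (λ j → [ sum (take (j ∸ 1) (l ∷ ls)) ] * weight v (hasMin v k j) (subsets is)) js))
           (applyUpTo≡upFrom (2 ℕ.+_) 2 (length ls ∸ k) (λ _ → refl)) (applyUpTo≡upFrom (2 ℕ.+_) 2 (length ls) (λ _ → refl)) ⟩
    prefactor * sumℚ (map (λ j → [ sum (take (j ∸ 1) (l ∷ ls)) ] * weight v (hasMin v k j) (subsets (upFrom 2 (length ls)))) (upFrom 2 (length ls ∸ k)))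
      ≡⟨ cong (prefactor *_) (sum-over-minimum v (λ j → [ sum (take (j ∸ 1) (l ∷ ls)) ]) k 2 l ls (λ _ → refl) (λ _ → refl)) ⟩
    prefactor * hookSum k l ls
      -- The first part can be included because its term carries the factor [0] = 0; this is why the
      -- indices of the theorem start at 2.
      ≡⟨ cong (prefactor *_) (trans (cong (_+ hookSum k l ls) (ℚP.*-zeroˡ ([ l ] * elementary k ls))) (ℚP.+-identityˡ _)) ⟨
    prefactor * hookSum k 0 (l ∷ ls)
      ≡⟨ value-prefactor r (suc k) (hookSum k 0 (l ∷ ls)) ⟨
    value (suc k) (r ℕ.+ suc (suc k)) (hookSum k 0 (l ∷ ls)) ∎
    where
    v : ℕ → ℚ
    v i = [ nth (l ∷ ls) i ]
    prefactor = ℕ→ℚ ((q ∸ 1) ℕ.^ suc k ℕ.* q ℕ.^ ((r ℕ.+ suc (suc k)) C 2 ∸ ((r ℕ.+ suc (suc k)) ∸ suc k) C 2 ∸ suc k))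
      where open import Data.Nat.Combinatorics using (_C_)

-- Transfer to matrices and induction over the parts

module Main (F : FiniteField) (λs : List ℕ) where

  open Counting F (blockOf λs)

  private instance
    q-nonzero : NonZero q
    q-nonzero = card-nonzero F

  open SubsetSums q

  InNilradical⇔Columns : ∀ {n} (A : Tri n) → InNilradical F λs (toMat A) ⇔ Columns A
  InNilradical⇔Columns A = mk⇔
    (λ h → BlockZero⇒Columns A λ i j le →
      trans (sym (cong₂ (low A) (FinP.opposite-involutive i) (FinP.opposite-involutive j)))
        (trans (sym (entry-toMat A (opposite i) (opposite j))) (h (opposite i) (opposite j) le)))
    (λ cols i j le → trans (entry-toMat A i j) (Columns⇒BlockZero A cols (opposite i) (opposite j)
      (subst₂ (λ x y → blockOf λs (toℕ x) ≤ blockOf λs (toℕ y))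
        (sym (FinP.opposite-involutive j)) (sym (FinP.opposite-involutive i)) le)))

  -- Since `blockOf` is monotone, the nilradical condition covers all entries on and below the
  -- diagonal.
  InNilradical⇒toMat : ∀ {n} (M : Mat F n) → InNilradical F λs M → ∃ λ A → M ≡ toMat A
  InNilradical⇒toMat {n} M h = A , entry-ext λ i j → sym (begin
    entry F (toMat A) i j                                     ≡⟨ entry-toMat A i j ⟩
    low A (opposite i) (opposite j)                           ≡⟨ low-fromLow f f-zero (opposite i) (opposite j) ⟩
    f (opposite i) (opposite j)                               ≡⟨ cong₂ (entry F M) (FinP.opposite-involutive i) (FinP.opposite-involutive j) ⟩
    entry F M i j                                             ∎)
    where
    f : Fin n → Fin n → K
    f i j = entry F M (opposite i) (opposite j)
    f-zero : ∀ i j → toℕ i ≤ toℕ j → f i j ≡ 0K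
    f-zero i j i≤j = h (opposite i) (opposite j) (blockOf-mono λs
      (subst₂ _≤_ (sym (FinP.opposite-prop j)) (sym (FinP.opposite-prop i)) (ℕP.∸-monoʳ-≤ n (s≤s i≤j))))
    A : Tri n
    A = fromLow f

  card-InCμ∩uλ : ∀ r k {N} → HasCard (HookIn k {r ℕ.+ suc k}) N →
                 HasCard (InCμ∩uλ F (r ℕ.+ suc k) (hook (r ℕ.+ suc k) k) λs) N
  card-InCμ∩uλ r k h = card-resp
    (λ { M (A , (hook , cols) , refl) → Hook⇒Conj r k A hook , Equivalence.from (InNilradical⇔Columns A) cols })
    (λ { M (conj , nilradical) → to M conj nilradical (InNilradical⇒toMat M nilradical) })
    (card-image toMat (λ A B _ _ → toMat-injective A B) h)
    where
    to : ∀ M → Conj F M (Jordan F (r ℕ.+ suc k) (hook (r ℕ.+ suc k) k)) → InNilradical F λs M → (∃ λ A → M ≡ toMat A) → ∃ λ A → HookIn k A × M ≡ toMat A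
    to M conj nilradical (A , refl) = A , (Conj⇒Hook r k A conj , Equivalence.to (InNilradical⇔Columns A) nilradical) , refl

  Counts : ℕ → List ℕ → (ℕ → ℕ) → Set
  Counts m ls N = ∀ k → HasCard (HookIn k {m}) (N k) × ℕ→ℚ (N k) ≡ value k m (coefficient k ls)

  counts-empty : ∃ (Counts 0 [])
  counts-empty = N , λ { zero → card-resp (λ { _ refl → hook₀ , tt }) (λ _ _ → refl) (card-singleton tt) , refl
                       ; (suc k) → card-resp (λ _ ()) (λ { A (hook , _) → never k (top hook) }) card-∅ , sym (value-zero (suc k) 0) }
    where
    N : ℕ → ℕ
    N zero    = 1
    N (suc k) = 0
    hook₀ : Hook 0 (app {0} tt)
    hook₀ = record { nil = λ _ → refl ; top = tt
                   ; rank = card-resp (λ { _ refl → [] , refl }) (λ { [] _ → refl }) (card-singleton []) }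
      where open import Data.Vec using ([])
    never : ∀ k {T : V 0 → V 0} → PowNonzero (suc k) T → ⊥
    never k (w , nz) = nz (nil-vec _)
      where
      open import Data.Vec using ([])
      nil-vec : (v : V 0) → v ≡ []
      nil-vec [] = refl

  -- The induction splits the fixed `λs` into treated and remaining parts, because `HookIn` refers
  -- to the block function of the whole list.
  counts-from : ∀ pre m rest → λs ≡ pre ++ rest → sum pre ≡ m → All (λ x → x ≥ 1) rest →
    (sum pre ≡ 0 → ∀ k → hookSum k 0 pre ≡ 0ℚ) → ∃ (Counts m pre) → ∃ (Counts (sum λs) λs)
  counts-from pre m [] refl refl _ _ h =
    subst (λ ls → ∃ (Counts (sum ls) ls)) (sym (ListP.++-identityʳ pre)) h
  counts-from pre m (l ∷ rest) λs≡ refl (l≥1 ∷ pos) zero-case (N , h) =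
    counts-from (pre ∷ʳ l) (l ℕ.+ m) rest (trans λs≡ (sym (ListP.++-assoc pre (l ∷ []) rest))) sum≡ pos
      -- Parts are positive, so the total is zero only before the first block.
      (λ e → ⊥-elim (ℕP.<⇒≢ (ℕP.<-≤-trans l≥1 (ℕP.m≤m+n l m)) (sym (trans (sym sum≡) e))))
      (_ , λ k → card-block l start N (λ k → proj₁ (h k)) k , block-value pre zero-case N (λ k → proj₂ (h k)) k l)
    where
    start : ∀ i → i < l → ∀ t → (blockOf λs (i ℕ.+ m) ≤ blockOf λs t) ⇔ (m ≤ t)
    start = subst (λ ls → ∀ i → i < l → ∀ t → (blockOf ls (i ℕ.+ m) ≤ blockOf ls t) ⇔ (m ≤ t)) (sym λs≡)
              (blockOf-start pre l rest)
    sum≡ : sum (pre ∷ʳ l) ≡ l ℕ.+ m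
    sum≡ = trans (sum-++ pre (l ∷ [])) (trans (cong (m ℕ.+_) (ℕP.+-identityʳ l)) (ℕP.+-comm m l))

  counts : All (λ x → x ≥ 1) λs → ∃ (Counts (sum λs) λs)
  counts pos = counts-from [] 0 λs refl refl pos (λ _ _ → refl) counts-empty

≤⇒∃+ : ∀ {m n} → m ≤ n → ∃ λ r → r ℕ.+ m ≡ n
≤⇒∃+ m≤n = _ , ℕP.m∸n+n≡m m≤n

theorem2p20 : (F : FiniteField) → (n : ℕ) → (λs : List ℕ) → IsPartitionOf λs n →
    (k : ℕ) → 1 ≤ k → k ≤ length λs ∸ 1 →
    ∃ λ N → Fμλ≡ F n (hook n k) λs N
    × ℕ→ℚ N ≡ hookRHS (FiniteField.card F) {{card-nonzero F}} n k λs
theorem2p20 F n (l ∷ ls) (pos , _ , sum≡n) (suc k) _ k≤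
  -- The size n is at least the number of parts, which exceeds the index of the hook; so n has the
  -- form required by `standardHook`.
  with ≤⇒∃+ (ℕP.≤-trans (s≤s k≤) (subst (length (l ∷ ls) ≤_) sum≡n (length≤sum pos)))
... | r , refl with subst (λ n → ∃ (Main.Counts F (l ∷ ls) n (l ∷ ls))) sum≡n (Main.counts F (l ∷ ls) pos)
... | N , h = N (suc k) , Main.card-InCμ∩uλ F (l ∷ ls) r (suc k) (proj₁ (h (suc k))) ,
              trans (proj₂ (h (suc k))) (sym (SubsetSums.hookRHS≡value (FiniteField.card F) {{card-nonzero F}} r k l ls))
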